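{- Let $A$ be a nonsingular $d\times d$ integer matrix and let $m\in\mathbb{Z}_{\geq 0}^d$. Then $$\sum_{\xi\in T_A^*}[\cos(2\pi\xi)]^m=\frac{|\det A|}{2^{|m|}}\sum_{\substack{x\in A\mathbb{Z}^d,\ y\in\mathbb{Z}_{\geq 0}^d\\ \mathrm{abs}(x)+2y=m}}\frac{m!}{(\mathrm{abs}(x)+y)!\,y!}.$$
   Context: Here $T_A^*=(A^{T})^{ -1}\mathbb{Z}^d/\mathbb{Z}^d$ (a finite quotient group). For $\xi\in T_A^*$, $\cos(2\pi\xi):=(\cos(2\pi\xi_1),\dots,\cos(2\pi\xi_d))\in\mathbb{R}^d$ (computed from any representative of $\xi$). For $x\in\mathbb{Z}^d$: $\mathrm{abs}(x)=(|x_1|,\dots,|x_d|)$ and $|x|=\sum_{i=1}^d|x_i|$. For $m\in\mathbb{Z}_{\geq 0}^d$ and $v\in\mathbb{R}^d$: $m!=m_1!m_2!\cdots m_d!$ and $v^m=v_1^{m_1}v_2^{m_2}\cdots v_d^{m_d}$ (with $0^0=1$). -}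

module Defs where

open import Algebra.Bundles.Raw using (RawMonoid; RawSemiring)
import Algebra.Definitions.RawMonoid as RawMonoidDefs
import Algebra.Definitions.RawSemiring as RawSemiringDefs
open import Data.Fin.Base using (Fin; zero; suc; punchIn; toℕ)
open import Data.Integer.Base as ℤ using (ℤ; +_; 0ℤ; 1ℤ; -1ℤ)
import Data.Integer.Properties as ℤP
open import Data.Nat.Base as ℕ using (ℕ; zero; suc; NonZero; _!)
import Data.Nat.Properties as ℕP
import Data.Nat.Coprimality as Coprimality
open import Data.Product.Base using (Σ; ∃; _×_; _,_; proj₁; proj₂)
open import Data.Rational.Base as ℚ
  using (ℚ; mkℚ; 0ℚ; 1ℚ; ½; ∣_∣; _+_; _*_; -_; _-_; _≤_; _<_; _/_)
import Data.Rational.Properties as ℚP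
open import Data.Rational.Solver using (module +-*-Solver)
import Data.Rational.Unnormalised.Base as ℚᵘ
import Data.Rational.Unnormalised.Properties as ℚᵘP
open import Data.Sum.Base using (inj₁; inj₂)
open import Data.Vec.Functional using (Vector)
open import Function.Base using (_∘_)
open import Function.Bundles using (Inverse)
open import Level using (0ℓ)
open import Relation.Binary.Bundles using (Setoid)
import Relation.Binary.Construct.On as On
open import Relation.Binary.Structures using (IsEquivalence)
open import Relation.Binary.PropositionalEquality as ≡
  using (_≡_; refl; sym; trans; cong; cong₂; subst)

private
  module Sumℤ = RawSemiringDefs ℤ.+-*-rawSemiring
  module Sumℕ = RawSemiringDefs ℕ.+-*-rawSemiring
  module Sumℚ = RawSemiringDefs ℚ.+-*-rawSemiring

open Sumℚ using () renaming (_^_ to _^ℚ_)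

IsCauchy : (ℕ → ℚ) → Set
IsCauchy s = ∀ ε → 0ℚ < ε →
  ∃ λ N → ∀ m n → N ℕ.≤ m → N ℕ.≤ n → ∣ s m - s n ∣ < ε

-- As a type this is the set of Cauchy sequences of rationals; equality of
-- real numbers is the relation _≈_ below.
record ℝ : Set where
  constructor mkℝ
  field
    approx   : ℕ → ℚ
    isCauchy : IsCauchy approx

open ℝ public

infix 4 _≈_ _<ℝ_

_≈_ : ℝ → ℝ → Set
x ≈ y = ∀ ε → 0ℚ < ε →
  ∃ λ N → ∀ n → N ℕ.≤ n → ∣ approx x n - approx y n ∣ < ε

_<ℝ_ : ℝ → ℝ → Set
x <ℝ y = ∃ λ ε → 0ℚ < ε ×
  (∃ λ N → ∀ n → N ℕ.≤ n → approx x n + ε < approx y n)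

module CauchyLemmas where
  half-pos : ∀ {ε} → 0ℚ < ε → 0ℚ < ε * ½
  half-pos {ε} 0<ε = subst (_< ε * ½) (ℚP.*-zeroˡ ½) (ℚP.*-monoˡ-<-pos ½ 0<ε)

  half+half : ∀ ε → ε * ½ + ε * ½ ≡ ε
  half+half ε = trans (sym (ℚP.*-distribˡ-+ ε ½ ½)) (ℚP.*-identityʳ ε)

  x-x≡0 : ∀ x → ∣ x - x ∣ ≡ 0ℚ
  x-x≡0 x = cong ∣_∣ (ℚP.+-inverseʳ x)

  ∣a-b∣≡∣b-a∣ : ∀ a b → ∣ a - b ∣ ≡ ∣ b - a ∣
  ∣a-b∣≡∣b-a∣ a b = trans (sym (ℚP.∣-p∣≡∣p∣ (a - b))) (cong ∣_∣
    (solve 2 (λ u v → :- (u :- v) := v :- u) refl a b))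
    where open +-*-Solver

  abstract
    const-cauchy : ∀ q → IsCauchy (λ _ → q)
    const-cauchy q ε 0<ε = 0 , λ _ _ _ _ → subst (_< ε) (sym (x-x≡0 q)) 0<ε

    +-cauchy : ∀ s t → IsCauchy s → IsCauchy t → IsCauchy (λ n → s n + t n)
    +-cauchy s t cs ct ε 0<ε
      with cs (ε * ½) (half-pos 0<ε) | ct (ε * ½) (half-pos 0<ε)
    ... | M , p | N , q = M ℕ.⊔ N , λ m n M≤ N≤ → begin-strict
      ∣ (s m + t m) - (s n + t n) ∣
        ≡⟨ cong ∣_∣ (solve 4 (λ a b c d → (a :+ b) :- (c :+ d) := (a :- c) :+ (b :- d))
                       refl (s m) (t m) (s n) (t n)) ⟩
      ∣ (s m - s n) + (t m - t n) ∣     ≤⟨ ℚP.∣p+q∣≤∣p∣+∣q∣ (s m - s n) (t m - t n) ⟩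
      ∣ s m - s n ∣ + ∣ t m - t n ∣     <⟨ ℚP.+-mono-<
        (p m n (ℕP.≤-trans (ℕP.m≤m⊔n M N) M≤) (ℕP.≤-trans (ℕP.m≤m⊔n M N) N≤))
        (q m n (ℕP.≤-trans (ℕP.m≤n⊔m M N) M≤) (ℕP.≤-trans (ℕP.m≤n⊔m M N) N≤)) ⟩
      ε * ½ + ε * ½                     ≡⟨ half+half ε ⟩
      ε                                 ∎
      where open ℚP.≤-Reasoning
            open +-*-Solver

    0≤⇒≤+ : ∀ a {b} → 0ℚ ≤ b → a ≤ a + b
    0≤⇒≤+ a 0≤b = subst (_≤ a + _) (ℚP.+-identityʳ a) (ℚP.+-monoʳ-≤ a 0≤b)

    absSum : (ℕ → ℚ) → ℕ → ℚ
    absSum s zero    = 0ℚ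
    absSum s (suc n) = absSum s n + ∣ s n ∣

    0≤absSum : ∀ s n → 0ℚ ≤ absSum s n
    0≤absSum s zero    = ℚP.≤-refl
    0≤absSum s (suc n) = ℚP.≤-trans (0≤absSum s n) (0≤⇒≤+ _ (ℚP.0≤∣p∣ (s n)))

    ≤absSum : ∀ s {k n} → k ℕ.< n → ∣ s k ∣ ≤ absSum s n
    ≤absSum s {k} {suc n} k<1+n with ℕP.m≤n⇒m<n∨m≡n (ℕP.≤-pred k<1+n)
    ... | inj₁ k<n  = ℚP.≤-trans (≤absSum s k<n) (0≤⇒≤+ _ (ℚP.0≤∣p∣ (s n)))
    ... | inj₂ refl = subst (_≤ absSum s n + ∣ s n ∣) (ℚP.+-identityˡ _)
                        (ℚP.+-monoˡ-≤ ∣ s n ∣ (0≤absSum s n))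

    0<1 : 0ℚ < 1ℚ
    0<1 = ℚP.positive⁻¹ 1ℚ

    bounded : ∀ s → IsCauchy s → ∃ λ B → 0ℚ < B × (∀ n → ∣ s n ∣ ≤ B)
    bounded s cs with cs 1ℚ 0<1
    ... | N , p = B , 0<B , bound
      where
      open ℚP.≤-Reasoning
      S B : ℚ
      S = absSum s (suc N)
      B = S + 1ℚ
      0<B : 0ℚ < B
      0<B = ℚP.+-mono-≤-< (0≤absSum s (suc N)) 0<1
      bound : ∀ n → ∣ s n ∣ ≤ B
      bound n with ℕP.≤-total n N
      ... | inj₁ n≤N = ℚP.≤-trans (≤absSum s (ℕ.s≤s n≤N)) (0≤⇒≤+ S (ℚP.<⇒≤ 0<1))
      ... | inj₂ N≤n = begin
        ∣ s n ∣                 ≡⟨ cong ∣_∣ (solve 2 (λ a b → a := b :+ (a :- b)) refl (s n) (s N)) ⟩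
        ∣ s N + (s n - s N) ∣   ≤⟨ ℚP.∣p+q∣≤∣p∣+∣q∣ (s N) (s n - s N) ⟩
        ∣ s N ∣ + ∣ s n - s N ∣ ≤⟨ ℚP.+-mono-≤ (≤absSum s ℕP.≤-refl)
                                    (ℚP.<⇒≤ (p n N N≤n ℕP.≤-refl)) ⟩
        S + 1ℚ                  ∎
        where open +-*-Solver

    *-pos : ∀ {a b} → 0ℚ < a → 0ℚ < b → 0ℚ < a * b
    *-pos {a} {b} 0<a 0<b =
      ℚP.positive⁻¹ (a * b) {{ℚP.pos*pos⇒pos a {{ℚ.positive 0<a}} b {{ℚ.positive 0<b}}}}

    *-mono-≤ : ∀ {a b c d} → 0ℚ ≤ a → 0ℚ ≤ d → a ≤ b → c ≤ d → a * c ≤ b * d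
    *-mono-≤ {a} {b} {c} {d} 0≤a 0≤d a≤b c≤d = ℚP.≤-trans
      (ℚP.*-monoˡ-≤-nonNeg a {{ℚ.nonNegative 0≤a}} c≤d)
      (ℚP.*-monoʳ-≤-nonNeg d {{ℚ.nonNegative 0≤d}} a≤b)

    -- ε / B
    quotient : ∀ {ε B} → 0ℚ < ε → 0ℚ < B → ∃ λ δ → 0ℚ < δ × B * δ ≡ ε
    quotient {ε} {B} 0<ε 0<B = B⁻¹ * ε , *-pos 0<B⁻¹ 0<ε ,
        trans (sym (ℚP.*-assoc B B⁻¹ ε))
          (trans (cong (_* ε) (ℚP.*-inverseʳ B)) (ℚP.*-identityˡ ε))
      where
      instance
        B-pos : ℚ.Positive B
        B-pos = ℚ.positive 0<B
        B≢0 : ℚ.NonZero B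
        B≢0 = ℚP.pos⇒nonZero B
      B⁻¹ : ℚ
      B⁻¹ = ℚ.1/ B
      0<B⁻¹ : 0ℚ < B⁻¹
      0<B⁻¹ = ℚP.positive⁻¹ B⁻¹ {{ℚP.1/pos⇒pos B}}

    *-cauchy : ∀ s t → IsCauchy s → IsCauchy t → IsCauchy (λ n → s n * t n)
    *-cauchy s t cs ct ε 0<ε
      with bounded s cs | bounded t ct
    ... | B , 0<B , s≤B | C , 0<C , t≤C
      with quotient (half-pos 0<ε) 0<B | quotient (half-pos 0<ε) 0<C
    ... | δ , 0<δ , Bδ≡ | η , 0<η , Cη≡
      with cs η 0<η | ct δ 0<δ
    ... | M , p | N , q = M ℕ.⊔ N , λ m n M≤ N≤ → begin-strict
      ∣ s m * t m - s n * t n ∣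
        ≡⟨ cong ∣_∣ (solve 4 (λ a b c d → a :* b :- c :* d := a :* (b :- d) :+ d :* (a :- c))
                       refl (s m) (t m) (s n) (t n)) ⟩
      ∣ s m * (t m - t n) + t n * (s m - s n) ∣
        ≤⟨ ℚP.∣p+q∣≤∣p∣+∣q∣ (s m * (t m - t n)) (t n * (s m - s n)) ⟩
      ∣ s m * (t m - t n) ∣ + ∣ t n * (s m - s n) ∣
        ≡⟨ cong₂ _+_ (ℚP.∣p*q∣≡∣p∣*∣q∣ (s m) (t m - t n)) (ℚP.∣p*q∣≡∣p∣*∣q∣ (t n) (s m - s n)) ⟩
      ∣ s m ∣ * ∣ t m - t n ∣ + ∣ t n ∣ * ∣ s m - s n ∣
        ≤⟨ ℚP.+-mono-≤
             (ℚP.*-monoʳ-≤-nonNeg ∣ t m - t n ∣ {{ℚP.∣-∣-nonNeg (t m - t n)}} (s≤B m))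
             (ℚP.*-monoʳ-≤-nonNeg ∣ s m - s n ∣ {{ℚP.∣-∣-nonNeg (s m - s n)}} (t≤C n)) ⟩
      B * ∣ t m - t n ∣ + C * ∣ s m - s n ∣
        <⟨ ℚP.+-mono-<
             (ℚP.*-monoʳ-<-pos B {{ℚ.positive 0<B}}
               (q m n (ℕP.≤-trans (ℕP.m≤n⊔m M N) M≤) (ℕP.≤-trans (ℕP.m≤n⊔m M N) N≤)))
             (ℚP.*-monoʳ-<-pos C {{ℚ.positive 0<C}}
               (p m n (ℕP.≤-trans (ℕP.m≤m⊔n M N) M≤) (ℕP.≤-trans (ℕP.m≤m⊔n M N) N≤))) ⟩
      B * δ + C * η      ≡⟨ cong₂ _+_ Bδ≡ Cη≡ ⟩
      ε * ½ + ε * ½      ≡⟨ half+half ε ⟩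
      ε                  ∎
      where open ℚP.≤-Reasoning
            open +-*-Solver

open CauchyLemmas

fromℚ : ℚ → ℝ
fromℚ q = mkℝ (λ _ → q) (const-cauchy q)

infixl 6 _+ℝ_
infixl 7 _*ℝ_

_+ℝ_ : ℝ → ℝ → ℝ
x +ℝ y = mkℝ (λ n → approx x n + approx y n) (+-cauchy (approx x) (approx y) (isCauchy x) (isCauchy y))

_*ℝ_ : ℝ → ℝ → ℝ
x *ℝ y = mkℝ (λ n → approx x n * approx y n) (*-cauchy (approx x) (approx y) (isCauchy x) (isCauchy y))

ℝ-rawSemiring : RawSemiring 0ℓ 0ℓ
ℝ-rawSemiring = record
  { Carrier = ℝ
  ; _≈_     = _≈_
  ; _+_     = _+ℝ_
  ; _*_     = _*ℝ_
  ; 0#      = fromℚ 0ℚ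
  ; 1#      = fromℚ 1ℚ
  }

-- (-1)ᵏ x²ᵏ⁺ᵖ / (2k+p)!, the k-th term of the power series of
-- cosine (p = 0) and sine (p = 1).
trigTerm : (p : ℕ) → ℚ → ℕ → ℚ
trigTerm p x k = (- 1ℚ) ^ℚ k * (x ^ℚ j * ((+ 1 / j !) {{ℕP._!≢0 j}}))
  where j = k ℕ.* 2 ℕ.+ p

trigSum : (p : ℕ) → ℕ → ℚ → ℚ
trigSum p zero    x = 0ℚ
trigSum p (suc n) x = trigSum p n x + trigTerm p x n

module TrigLemmas where
  ι : ℕ → ℚ
  ι n = mkℚ (+ n) 0 (Coprimality.sym (Coprimality.1-coprimeTo n))

  ι-suc : ∀ n → ι (suc n) ≡ ι n + 1ℚ
  ι-suc n = sym (trans (ℚP./-cong {p₁ = + n ℤ.* + 1 ℤ.+ + 1 ℤ.* + 1} {q₁ = 1} eq refl)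
                       (ℚP.↥p/↧p≡p (ι (suc n))))
    where
    eq : + n ℤ.* + 1 ℤ.+ + 1 ℤ.* + 1 ≡ + suc n
    eq = trans (cong (ℤ._+ + 1) (ℤP.*-identityʳ (+ n))) (cong +_ (ℕP.+-comm n 1))

  0<ιsuc : ∀ n → 0ℚ < ι (suc n)
  0<ιsuc n = ℚP.positive⁻¹ (ι (suc n))

  abstract
    archimedean : ∀ q → ∃ λ n → q ≤ ι n
    archimedean q@(mkℚ a b-1 _) = ℤ.∣ a ∣ , ℚ.*≤* (lem a)
      where
      open ℤP.≤-Reasoning
      lem : ∀ a → a ℤ.* + 1 ℤ.≤ + ℤ.∣ a ∣ ℤ.* + suc b-1
      lem (+ n) = begin
        + n ℤ.* + 1         ≤⟨ ℤP.*-monoˡ-≤-nonNeg (+ n) (ℤ.+≤+ (ℕ.s≤s ℕ.z≤n)) ⟩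
        + n ℤ.* + suc b-1   ∎
      lem ℤ.-[1+ n ] = ℤ.-≤+

    ι-mono : ∀ {m n} → m ℕ.≤ n → ι m ≤ ι n
    ι-mono m≤n = ℚ.*≤* (ℤP.*-monoʳ-≤-nonNeg (+ 1) (ℤ.+≤+ m≤n))

  1/! : ℕ → ℚ
  1/! j = (+ 1 / j !) {{ℕP._!≢0 j}}

  0<1/! : ∀ j → 0ℚ < 1/! j
  0<1/! j = ℚP.positive⁻¹ (1/! j) {{ℚP.normalize-pos 1 (j !) {{ℕP._!≢0 j}}}}

  toℚᵘ-/ : ∀ i n .{{_ : NonZero n}} → ℚ.toℚᵘ (i / n) ℚᵘ.≃ (i ℚᵘ./ n)
  toℚᵘ-/ i (suc n) = ℚP.toℚᵘ-fromℚᵘ (ℚᵘ.mkℚᵘ i n)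

  reciprocal-* : ∀ a b .{{_ : NonZero a}} .{{_ : NonZero b}} .{{_ : NonZero (a ℕ.* b)}} →
                 ℚ.toℚᵘ (ℚ.mkℚ (+ a) 0 (Coprimality.sym (Coprimality.1-coprimeTo a)) * (+ 1 / (a ℕ.* b)))
                 ℚᵘ.≃ ℚ.toℚᵘ (+ 1 / b)
  reciprocal-* a@(suc _) b@(suc _) = begin
    ℚ.toℚᵘ (ι a * (+ 1 / (a ℕ.* b)))            ≈⟨ ℚP.toℚᵘ-homo-* (ι a) (+ 1 / (a ℕ.* b)) ⟩
    ℚᵘ.mkℚᵘ (+ a) 0 ℚᵘ.* ℚ.toℚᵘ (+ 1 / (a ℕ.* b)) ≈⟨ ℚᵘP.*-congˡ {ℚᵘ.mkℚᵘ (+ a) 0} (toℚᵘ-/ (+ 1) (a ℕ.* b)) ⟩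
    ℚᵘ.mkℚᵘ (+ a) 0 ℚᵘ.* (+ 1 ℚᵘ./ (a ℕ.* b))    ≈⟨ ℚᵘ.*≡* (cong +_ eq) ⟩
    + 1 ℚᵘ./ b                                  ≈⟨ ℚᵘP.≃-sym (toℚᵘ-/ (+ 1) b) ⟩
    ℚ.toℚᵘ (+ 1 / b)                            ∎
    where
    open ℚᵘP.≃-Reasoning
    eq : (a ℕ.* 1) ℕ.* b ≡ 1 ℕ.* (1 ℕ.* (a ℕ.* b))
    eq = trans (cong (ℕ._* b) (ℕP.*-identityʳ a))
           (sym (trans (ℕP.*-identityˡ _) (ℕP.*-identityˡ _)))

  1/!-suc : ∀ j → ι (suc j) * 1/! (suc j) ≡ 1/! j
  1/!-suc j = ℚP.toℚᵘ-injective
    (reciprocal-* (suc j) (j !) {{_}} {{ℕP._!≢0 j}} {{ℕP._!≢0 (suc j)}})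

  expTerm : ℚ → ℕ → ℚ
  expTerm B j = B ^ℚ j * 1/! j

  expTerm-suc : ∀ B j → ι (suc j) * expTerm B (suc j) ≡ B * expTerm B j
  expTerm-suc B j = trans
    (solve 4 (λ n b p r → n :* ((b :* p) :* r) := b :* (p :* (n :* r)))
       refl (ι (suc j)) B (B ^ℚ j) (1/! (suc j)))
    (cong (λ r → B * (B ^ℚ j * r)) (1/!-suc j))
    where open +-*-Solver

  0≤^ : ∀ {B} → 0ℚ ≤ B → ∀ n → 0ℚ ≤ B ^ℚ n
  0≤^ 0≤B zero    = ℚP.<⇒≤ 0<1
  0≤^ {B} 0≤B (suc n) = subst (_≤ B * B ^ℚ n) (ℚP.*-zeroʳ B)
    (ℚP.*-monoˡ-≤-nonNeg B {{ℚ.nonNegative 0≤B}} (0≤^ 0≤B n))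

  ∣^∣-mono : ∀ {x B} → ∣ x ∣ ≤ B → ∀ n → ∣ x ^ℚ n ∣ ≤ B ^ℚ n
  ∣^∣-mono x≤B zero = ℚP.≤-refl
  ∣^∣-mono {x} {B} x≤B (suc n) = subst (_≤ B * B ^ℚ n) (sym (ℚP.∣p*q∣≡∣p∣*∣q∣ x (x ^ℚ n)))
    (*-mono-≤ (ℚP.0≤∣p∣ x) (0≤^ (ℚP.≤-trans (ℚP.0≤∣p∣ x) x≤B) n) x≤B (∣^∣-mono x≤B n))

  ∣sign∣ : ∀ k → ∣ (- 1ℚ) ^ℚ k ∣ ≡ 1ℚ
  ∣sign∣ zero    = refl
  ∣sign∣ (suc k) = trans (ℚP.∣p*q∣≡∣p∣*∣q∣ (- 1ℚ) ((- 1ℚ) ^ℚ k))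
                     (trans (ℚP.*-identityˡ _) (∣sign∣ k))

  module Tail (p : ℕ) {B : ℚ} (0<B : 0ℚ < B) where
    open ℚP.≤-Reasoning

    T : ℕ → ℚ
    T k = expTerm B (k ℕ.* 2 ℕ.+ p)

    0≤expTerm : ∀ j → 0ℚ ≤ expTerm B j
    0≤expTerm j = subst (_≤ expTerm B j) (ℚP.*-zeroˡ (1/! j))
      (ℚP.*-monoʳ-≤-nonNeg (1/! j) {{ℚ.nonNegative (ℚP.<⇒≤ (0<1/! j))}} (0≤^ (ℚP.<⇒≤ 0<B) j))

    abstract
      ∣term∣≤ : ∀ x → ∣ x ∣ ≤ B → ∀ k → ∣ trigTerm p x k ∣ ≤ T k
      ∣term∣≤ x x≤B k = begin
        ∣ s * (x ^ℚ j * 1/! j) ∣       ≡⟨ ℚP.∣p*q∣≡∣p∣*∣q∣ s (x ^ℚ j * 1/! j) ⟩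
        ∣ s ∣ * ∣ x ^ℚ j * 1/! j ∣     ≡⟨ cong₂ _*_ (∣sign∣ k) (ℚP.∣p*q∣≡∣p∣*∣q∣ (x ^ℚ j) (1/! j)) ⟩
        1ℚ * (∣ x ^ℚ j ∣ * ∣ 1/! j ∣)  ≡⟨ ℚP.*-identityˡ _ ⟩
        ∣ x ^ℚ j ∣ * ∣ 1/! j ∣         ≡⟨ cong (∣ x ^ℚ j ∣ *_) (ℚP.0≤p⇒∣p∣≡p (ℚP.<⇒≤ (0<1/! j))) ⟩
        ∣ x ^ℚ j ∣ * 1/! j             ≤⟨ ℚP.*-monoʳ-≤-nonNeg (1/! j)
                                            {{ℚ.nonNegative (ℚP.<⇒≤ (0<1/! j))}} (∣^∣-mono x≤B j) ⟩
        B ^ℚ j * 1/! j                 ∎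
        where
        j : ℕ
        j = k ℕ.* 2 ℕ.+ p
        s : ℚ
        s = (- 1ℚ) ^ℚ k

    K : ℕ
    K = proj₁ (archimedean (B + B))

    abstract
      expTerm-halves : ∀ j → K ℕ.≤ j → expTerm B (suc j) + expTerm B (suc j) ≤ expTerm B j
      expTerm-halves j K≤j = ℚP.*-cancelˡ-≤-pos (ι (suc j)) (begin
        ι (suc j) * (e′ + e′)              ≡⟨ ℚP.*-distribˡ-+ (ι (suc j)) e′ e′ ⟩
        ι (suc j) * e′ + ι (suc j) * e′    ≡⟨ cong₂ _+_ (expTerm-suc B j) (expTerm-suc B j) ⟩
        B * e + B * e                      ≡⟨ sym (ℚP.*-distribʳ-+ e B B) ⟩
        (B + B) * e                        ≤⟨ ℚP.*-monoʳ-≤-nonNeg e {{ℚ.nonNegative (0≤expTerm j)}}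
                                                (ℚP.≤-trans (proj₂ (archimedean (B + B)))
                                                  (ι-mono (ℕP.m≤n⇒m≤1+n K≤j))) ⟩
        ι (suc j) * e                      ∎)
        where
        e e′ : ℚ
        e  = expTerm B j
        e′ = expTerm B (suc j)

      T-halves : ∀ k → K ℕ.≤ k → T (suc k) + T (suc k) ≤ T k
      T-halves k K≤k = begin
        T (suc k) + T (suc k)   ≤⟨ expTerm-halves (suc j) (ℕP.m≤n⇒m≤1+n K≤j) ⟩
        expTerm B (suc j)       ≤⟨ 0≤⇒≤+ _ (0≤expTerm (suc j)) ⟩
        expTerm B (suc j) + expTerm B (suc j) ≤⟨ expTerm-halves j K≤j ⟩
        T k                     ∎
        where
        j : ℕ
        j = k ℕ.* 2 ℕ.+ p
        K≤j : K ℕ.≤ j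
        K≤j = ℕP.≤-trans K≤k (ℕP.≤-trans (ℕP.m≤m*n k 2) (ℕP.m≤m+n (k ℕ.* 2) p))

      T-decay : ∀ i → ι (suc i) * T (i ℕ.+ K) ≤ T K
      T-decay zero    = ℚP.≤-reflexive (ℚP.*-identityˡ (T K))
      T-decay (suc i) = begin
        ι (suc (suc i)) * t′              ≡⟨ cong (_* t′) (ι-suc (suc i)) ⟩
        (ι (suc i) + 1ℚ) * t′             ≤⟨ ℚP.*-monoʳ-≤-nonNeg t′
            {{ℚ.nonNegative (0≤expTerm (suc (i ℕ.+ K) ℕ.* 2 ℕ.+ p))}}
            (ℚP.+-monoʳ-≤ (ι (suc i)) (ι-mono {1} {suc i} (ℕ.s≤s ℕ.z≤n))) ⟩
        (ι (suc i) + ι (suc i)) * t′      ≡⟨ solve 2 (λ n t → (n :+ n) :* t := n :* (t :+ t))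
                                               refl (ι (suc i)) t′ ⟩
        ι (suc i) * (t′ + t′)             ≤⟨ ℚP.*-monoˡ-≤-nonNeg (ι (suc i))
                                               (T-halves (i ℕ.+ K) (ℕP.m≤n+m K i)) ⟩
        ι (suc i) * T (i ℕ.+ K)           ≤⟨ T-decay i ⟩
        T K                               ∎
        where
        open +-*-Solver
        t′ : ℚ
        t′ = T (suc i ℕ.+ K)

      T-small : ∀ ε → 0ℚ < ε → ∃ λ N → K ℕ.≤ N × T N + T N < ε
      T-small ε 0<ε with quotient {1ℚ} {ε} 0<1 0<ε
      ... | δ , 0<δ , εδ≡1 with archimedean ((T K + T K) * δ)
      ... | i , h = i ℕ.+ K , ℕP.m≤n+m K i ,
        ℚP.*-cancelˡ-<-nonNeg (ι (suc i)) (begin-strict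
          ι (suc i) * (t + t)            ≡⟨ ℚP.*-distribˡ-+ (ι (suc i)) t t ⟩
          ι (suc i) * t + ι (suc i) * t  ≤⟨ ℚP.+-mono-≤ (T-decay i) (T-decay i) ⟩
          T K + T K                      ≡⟨ sym (ℚP.*-identityʳ _) ⟩
          (T K + T K) * 1ℚ               ≡⟨ cong ((T K + T K) *_) (sym εδ≡1) ⟩
          (T K + T K) * (ε * δ)          ≡⟨ solve 3 (λ a b c → a :* (b :* c) := (a :* c) :* b)
                                              refl (T K + T K) ε δ ⟩
          ((T K + T K) * δ) * ε          ≤⟨ ℚP.*-monoʳ-≤-nonNeg ε {{ℚ.nonNegative (ℚP.<⇒≤ 0<ε)}} h ⟩
          ι i * ε                        <⟨ ℚP.*-monoˡ-<-pos ε {{ℚ.positive 0<ε}} (i<1+i) ⟩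
          ι (suc i) * ε                  ∎)
        where
        open +-*-Solver
        t : ℚ
        t = T (i ℕ.+ K)
        i<1+i : ι i < ι (suc i)
        i<1+i = ℚ.*<* (ℤP.*-monoʳ-<-pos (+ 1) (ℤ.+<+ (ℕP.n<1+n i)))

    abstract
      tail-step : ∀ {S S₀ c t t′ X} → ∣ c ∣ ≤ t → t′ + t′ ≤ t →
                  ∣ S - S₀ ∣ + (t + t) ≤ X → ∣ (S + c) - S₀ ∣ + (t′ + t′) ≤ X
      tail-step {S} {S₀} {c} {t} {t′} {X} c≤t t′≤t h = begin
        ∣ (S + c) - S₀ ∣ + (t′ + t′)   ≡⟨ cong (λ z → ∣ z ∣ + (t′ + t′))
            (solve 3 (λ a b d → (a :+ b) :- d := (a :- d) :+ b) refl S c S₀) ⟩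
        ∣ (S - S₀) + c ∣ + (t′ + t′)   ≤⟨ ℚP.+-mono-≤
            (ℚP.≤-trans (ℚP.∣p+q∣≤∣p∣+∣q∣ (S - S₀) c) (ℚP.+-monoʳ-≤ ∣ S - S₀ ∣ c≤t)) t′≤t ⟩
        (∣ S - S₀ ∣ + t) + t           ≡⟨ ℚP.+-assoc ∣ S - S₀ ∣ t t ⟩
        ∣ S - S₀ ∣ + (t + t)           ≤⟨ h ⟩
        X                              ∎
        where open +-*-Solver

      tail-bound : ∀ x → ∣ x ∣ ≤ B → ∀ N → K ℕ.≤ N → ∀ i →
        ∣ trigSum p (i ℕ.+ N) x - trigSum p N x ∣ + (T (i ℕ.+ N) + T (i ℕ.+ N)) ≤ T N + T N
      tail-bound x x≤B N K≤N zero = ℚP.≤-reflexive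
        (trans (cong (_+ (T N + T N)) (x-x≡0 (trigSum p N x))) (ℚP.+-identityˡ _))
      tail-bound x x≤B N K≤N (suc i) =
        tail-step {trigSum p (i ℕ.+ N) x} {trigSum p N x} {trigTerm p x (i ℕ.+ N)}
                  {T (i ℕ.+ N)} {T (suc (i ℕ.+ N))}
          (∣term∣≤ x x≤B (i ℕ.+ N))
          (T-halves (i ℕ.+ N) (ℕP.≤-trans K≤N (ℕP.m≤n+m N i)))
          (tail-bound x x≤B N K≤N i)

    abstract
      drop-+ : ∀ a t {X ε} → 0ℚ ≤ t → a + (t + t) ≤ X → X < ε → a < ε
      drop-+ a t 0≤t h X<ε = ℚP.≤-<-trans
        (ℚP.≤-trans (0≤⇒≤+ a (ℚP.≤-trans 0≤t (0≤⇒≤+ t 0≤t))) h) X<ε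

    abstract
      tail-< : ∀ N → K ℕ.≤ N → ∀ ε → T N + T N < ε → ∀ x → ∣ x ∣ ≤ B → ∀ i →
               ∣ trigSum p (i ℕ.+ N) x - trigSum p N x ∣ < ε
      tail-< N K≤N ε small x x≤B i =
        drop-+ ∣ trigSum p (i ℕ.+ N) x - trigSum p N x ∣ (T (i ℕ.+ N)) {T N + T N} {ε}
          (0≤expTerm ((i ℕ.+ N) ℕ.* 2 ℕ.+ p)) (tail-bound x x≤B N K≤N i) small

    abstract
      tail-small : ∀ ε → 0ℚ < ε → ∃ λ N → ∀ x → ∣ x ∣ ≤ B → ∀ n → N ℕ.≤ n →
                   ∣ trigSum p n x - trigSum p N x ∣ < ε
      tail-small ε 0<ε =
        let N , K≤N , small = T-small ε 0<ε in
        N , λ x x≤B n N≤n →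
          subst (λ k → ∣ trigSum p k x - trigSum p N x ∣ < ε) (ℕP.m∸n+n≡m N≤n)
            (tail-< N K≤N ε small x x≤B (n ℕ.∸ N))

  abstract
    ^-cauchy : ∀ s → IsCauchy s → ∀ j → IsCauchy (λ n → s n ^ℚ j)
    ^-cauchy s cs zero    = const-cauchy 1ℚ
    ^-cauchy s cs (suc j) = *-cauchy s (λ n → s n ^ℚ j) cs (^-cauchy s cs j)

    trigSum-cauchy : ∀ p s → IsCauchy s → ∀ N → IsCauchy (λ n → trigSum p N (s n))
    trigSum-cauchy p s cs zero    = const-cauchy 0ℚ
    trigSum-cauchy p s cs (suc N) =
      +-cauchy (λ n → trigSum p N (s n)) (λ n → trigTerm p (s n) N) (trigSum-cauchy p s cs N)
        (*-cauchy (λ _ → (- 1ℚ) ^ℚ N) (λ n → expTerm (s n) j) (const-cauchy ((- 1ℚ) ^ℚ N))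
          (*-cauchy (λ n → s n ^ℚ j) (λ _ → 1/! j) (^-cauchy s cs j) (const-cauchy (1/! j))))
      where
      j : ℕ
      j = N ℕ.* 2 ℕ.+ p

    trig-cauchy : ∀ p s → IsCauchy s → IsCauchy (λ n → trigSum p n (s n))
    trig-cauchy p s cs ε 0<ε
      with bounded s cs
    ... | B , 0<B , s≤B
      with Tail.tail-small p 0<B (ε * ½ * ½) (half-pos (half-pos 0<ε))
    ... | N , tail
      with trigSum-cauchy p s cs N (ε * ½) (half-pos 0<ε)
    ... | M , mid = M ℕ.⊔ N , λ m n M≤ N≤ →
      let S : ℕ → ℚ → ℚ
          S = trigSum p
          a = S m (s m) - S N (s m)
          b = S N (s m) - S N (s n)
          c = S N (s n) - S n (s n)
          N≤m = ℕP.≤-trans (ℕP.m≤n⊔m M N) M≤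
          N≤n = ℕP.≤-trans (ℕP.m≤n⊔m M N) N≤
      in begin-strict
      ∣ S m (s m) - S n (s n) ∣
        ≡⟨ cong ∣_∣ (solve 4 (λ u v w z → u :- z := ((u :- v) :+ (w :- z)) :+ (v :- w))
              refl (S m (s m)) (S N (s m)) (S N (s n)) (S n (s n))) ⟩
      ∣ (a + c) + b ∣              ≤⟨ ℚP.∣p+q∣≤∣p∣+∣q∣ (a + c) b ⟩
      ∣ a + c ∣ + ∣ b ∣            ≤⟨ ℚP.+-monoˡ-≤ ∣ b ∣ (ℚP.∣p+q∣≤∣p∣+∣q∣ a c) ⟩
      (∣ a ∣ + ∣ c ∣) + ∣ b ∣      <⟨ ℚP.+-mono-<
        (ℚP.+-mono-< (tail (s m) (s≤B m) m N≤m)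
          (subst (_< ε * ½ * ½) (∣a-b∣≡∣b-a∣ (S n (s n)) (S N (s n))) (tail (s n) (s≤B n) n N≤n)))
        (mid m n (ℕP.≤-trans (ℕP.m≤m⊔n M N) M≤) (ℕP.≤-trans (ℕP.m≤m⊔n M N) N≤)) ⟩
      (ε * ½ * ½ + ε * ½ * ½) + ε * ½   ≡⟨ cong (_+ ε * ½) (half+half (ε * ½)) ⟩
      ε * ½ + ε * ½                     ≡⟨ half+half ε ⟩
      ε                                 ∎
      where open ℚP.≤-Reasoning
            open +-*-Solver

open TrigLemmas

-- The power series are evaluated diagonally: the n-th approximation applies
-- the n-th partial sum to the n-th approximation of x.  Convergence of the
-- partial sums is uniform on bounded sets, so the limit is cos x, resp. sin x.
cos sin : ℝ → ℝ
cos x = mkℝ (λ n → trigSum 0 n (approx x n)) (trig-cauchy 0 (approx x) (isCauchy x))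
sin x = mkℝ (λ n → trigSum 1 n (approx x n)) (trig-cauchy 1 (approx x) (isCauchy x))

-- π is the first positive zero of sine: sine vanishes at π and is positive
-- on the open interval (0,π).  This determines π up to _≈_.
record IsPi (π : ℝ) : Set where
  field
    π>0   : fromℚ 0ℚ <ℝ π
    sinπ  : sin π ≈ fromℚ 0ℚ
    sin>0 : ∀ x → fromℚ 0ℚ <ℝ x → x <ℝ π → fromℚ 0ℚ <ℝ sin x

-- A listing of the elements of S, each exactly once up to the equality of S.
record Enumeration (S : Setoid 0ℓ 0ℓ) : Set where
  field
    size    : ℕ
    inverse : Inverse (≡.setoid (Fin size)) S

∑ : (M : RawMonoid 0ℓ 0ℓ) {S : Setoid 0ℓ 0ℓ} →
    Enumeration S → (Setoid.Carrier S → RawMonoid.Carrier M) → RawMonoid.Carrier M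
∑ M E f = RawMonoidDefs.sum M (f ∘ Inverse.to (Enumeration.inverse E))

∑ℝ : {S : Setoid 0ℓ 0ℓ} → Enumeration S → (Setoid.Carrier S → ℝ) → ℝ
∑ℝ = ∑ (RawSemiring.+-rawMonoid ℝ-rawSemiring)

∑ℚ : {S : Setoid 0ℓ 0ℓ} → Enumeration S → (Setoid.Carrier S → ℚ) → ℚ
∑ℚ = ∑ ℚ.+-0-rawMonoid

Matrix : ℕ → Set
Matrix d = Fin d → Fin d → ℤ

-- Laplace expansion along the first row.
det : ∀ {d} → Matrix d → ℤ
det {zero}  A = 1ℤ
det {suc d} A = Sumℤ.sum λ j →
  -1ℤ Sumℤ.^ toℕ j ℤ.* A zero j ℤ.* det (λ i k → A (suc i) (punchIn j k))

-- x ∈ A ℤᵈ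
InImage : ∀ {d} → Matrix d → Vector ℤ d → Set
InImage {d} A x = ∃ λ (z : Vector ℤ d) → ∀ i → x i ≡ Sumℤ.sum λ j → A i j ℤ.* z j

fromℤ : ℤ → ℚ
fromℤ z = z / 1

-- ξ ∈ (Aᵀ)⁻¹ ℤᵈ, i.e. Aᵀ ξ ∈ ℤᵈ.  When det A ≠ 0, every such real vector ξ
-- has rational coordinates.
InDual : ∀ {d} → Matrix d → Vector ℚ d → Set
InDual {d} A ξ = ∃ λ (k : Vector ℤ d) → ∀ j → (Sumℚ.sum λ i → fromℤ (A i j) * ξ i) ≡ fromℤ (k j)

module ModℤLemmas where
  fromℤ≡mkℚ : ∀ z → fromℤ z ≡ mkℚ z 0 (Coprimality.sym (Coprimality.1-coprimeTo ℤ.∣ z ∣))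
  fromℤ≡mkℚ z = ℚP.↥p/↧p≡p (mkℚ z 0 (Coprimality.sym (Coprimality.1-coprimeTo ℤ.∣ z ∣)))

  fromℤ-+ : ∀ y z → fromℤ y + fromℤ z ≡ fromℤ (y ℤ.+ z)
  fromℤ-+ y z = trans (cong₂ _+_ (fromℤ≡mkℚ y) (fromℤ≡mkℚ z))
    (cong fromℤ (cong₂ ℤ._+_ (ℤP.*-identityʳ y) (ℤP.*-identityʳ z)))

  fromℤ-neg : ∀ z → - fromℤ z ≡ fromℤ (ℤ.- z)
  fromℤ-neg z = trans (sym (ℚP.+-identityʳ (- fromℤ z))) (trans
    (cong (λ w → - fromℤ z + w) (sym (trans (fromℤ-+ z (ℤ.- z)) (cong fromℤ (ℤP.+-inverseʳ z)))))
    (solve 2 (λ a b → :- a :+ (a :+ b) := b) refl (fromℤ z) (fromℤ (ℤ.- z))))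
    where open +-*-Solver

open ModℤLemmas

infix 4 _≡_modℤ

_≡_modℤ : ∀ {d} → Vector ℚ d → Vector ℚ d → Set
_≡_modℤ {d} ξ η = ∃ λ (k : Vector ℤ d) → ∀ i → ξ i - η i ≡ fromℤ (k i)

private
  modℤ-isEquivalence : ∀ {d} → IsEquivalence (_≡_modℤ {d})
  modℤ-isEquivalence = record
    { refl  = λ {ξ} → (λ _ → 0ℤ) , λ i → ℚP.+-inverseʳ (ξ i)
    ; sym   = λ {ξ} {η} (k , p) → (λ i → ℤ.- k i) , λ i →
        trans (solve 2 (λ a b → b :- a := :- (a :- b)) refl (ξ i) (η i))
          (trans (cong -_ (p i)) (fromℤ-neg (k i)))
    ; trans = λ {ξ} {η} {ζ} (k , p) (l , q) → (λ i → k i ℤ.+ l i) , λ i →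
        trans (solve 3 (λ a b c → a :- c := (a :- b) :+ (b :- c)) refl (ξ i) (η i) (ζ i))
          (trans (cong₂ _+_ (p i) (q i)) (fromℤ-+ (k i) (l i)))
    }
    where open +-*-Solver

-- (Aᵀ)⁻¹ ℤᵈ / ℤᵈ
T* : ∀ {d} → Matrix d → Setoid 0ℓ 0ℓ
T* {d} A = record
  { Carrier       = Σ (Vector ℚ d) (InDual A)
  ; _≈_           = λ (ξ , _) (η , _) → ξ ≡ η modℤ
  ; isEquivalence = On.isEquivalence proj₁ modℤ-isEquivalence
  }

∣_∣₁ : ∀ {d} → Vector ℕ d → ℕ
∣ m ∣₁ = Sumℕ.sum m

absᵛ : ∀ {d} → Vector ℤ d → Vector ℕ d
absᵛ x i = ℤ.∣ x i ∣

infixl 6 _+ᵛ_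

_+ᵛ_ : ∀ {d} → Vector ℕ d → Vector ℕ d → Vector ℕ d
(m +ᵛ n) i = m i ℕ.+ n i

infix 8 _!ᵛ

_!ᵛ : ∀ {d} → Vector ℕ d → ℕ
m !ᵛ = Sumℕ.product λ i → m i !

factorial-nonZero : ∀ {d} (m : Vector ℕ d) → NonZero (m !ᵛ)
factorial-nonZero {zero}  m = _
factorial-nonZero {suc d} m =
  ℕP.m*n≢0 (m zero !) _ {{ℕP._!≢0 (m zero)}} {{factorial-nonZero (m ∘ suc)}}

infixr 8 _^ᵛ_

_^ᵛ_ : ∀ {d} → Vector ℝ d → Vector ℕ d → ℝ
v ^ᵛ m = product λ i → v i ^ m i
  where open RawSemiringDefs ℝ-rawSemiring using (product; _^_)

cos[2_*_] : ∀ {d} → ℝ → Vector ℚ d → Vector ℝ d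
cos[2 π * ξ ] i = cos (fromℚ (+ 2 / 1) *ℝ π *ℝ fromℚ (ξ i))

-- The pairs (x , y) with x ∈ A ℤᵈ, y ∈ ℤᵈ nonnegative and abs(x) + 2y = m.
Solutions : ∀ {d} → Matrix d → Vector ℕ d → Setoid 0ℓ 0ℓ
Solutions {d} A m = record
  { Carrier = Σ (Vector ℤ d × Vector ℕ d) λ (x , y) →
                InImage A x × (∀ i → absᵛ x i ℕ.+ 2 ℕ.* y i ≡ m i)
  ; _≈_ = λ ((x , y) , _) ((x′ , y′) , _) → (∀ i → x i ≡ x′ i) × (∀ i → y i ≡ y′ i)
  ; isEquivalence = record
    { refl  = (λ _ → refl) , (λ _ → refl)
    ; sym   = λ (p , q) → (λ i → sym (p i)) , (λ i → sym (q i))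
    ; trans = λ (p , q) (p′ , q′) → (λ i → trans (p i) (p′ i)) , (λ i → trans (q i) (q′ i))
    }
  }

weight : ∀ {d} → Vector ℕ d → Vector ℤ d → Vector ℕ d → ℚ
weight m x y = (+ (m !ᵛ) / ((absᵛ x +ᵛ y) !ᵛ ℕ.* y !ᵛ))
  {{ℕP.m*n≢0 _ _ {{factorial-nonZero (absᵛ x +ᵛ y)}} {{factorial-nonZero y}}}}

coefficient : ∀ {d} → Matrix d → Vector ℕ d → ℚ
coefficient A m = (+ ℤ.∣ det A ∣ / 2 ℕ.^ ∣ m ∣₁) {{ℕP.m^n≢0 2 ∣ m ∣₁}}

{-# OPTIONS --safe #-}

-- Expanding each cosine by 2 cos a cos b = cos (a + b) + cos (a − b) turns
-- 2^|m| [cos 2πξ]^m into the sum of ∏ C(mᵢ,aᵢ) cos (2π (a − b)·ξ) over a + b = m.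
-- Summed over ξ ∈ T*, the term of x = a − b contributes |T*| if x ∈ A ℤᵈ.
-- Otherwise some η ∈ T* has x·η ∉ ℤ, and averaging the translates by ±η
-- multiplies the sum by cos (2π x·η) ≠ 1, so that it vanishes.  The pairs
-- (a , b) with a − b ∈ A ℤᵈ correspond to the solutions (x , y) through
-- y = a ⊓ b.  That |T*| = |det A|, and that such an η exists, is seen by column
-- operations that clear the first row of A: they change neither A ℤᵈ, nor T*,
-- nor det A.
--
-- The trigonometry rests on cos (x + y) = cos x cos y − sin x sin y, obtained
-- from the Cauchy product of the power series.  With sin π = 0 it gives
-- periodicity, and with 1 − cos 2πq = 2 sin² πq it separates cos 2πq from 1
-- when q ∉ ℤ.

module Submission where

-- With complex exponentials a single translation by η would multiply the sum by a constant. For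
-- cosines a single translate also produces sines, and only the average over η and -η returns a
-- multiple of the sum. To cancel a real factor constructively, knowing that it differs from 0 is
-- not enough: a lower bound is needed, and twice a squared sine has one because `IsPi` makes sin πr
-- positive for 0 < r < 1. `InImage A x` is existential and carries no evident decision procedure.
-- The field `separate` supplies one together with the character: every x comes either with a
-- preimage or with a dual point that rules preimages out. It decides which pairs enter the listing
-- of solutions and which character sums vanish. Column operations act on the right of A, so the
-- image stays literally the same, and the dual depends on the image only; row operations would move
-- both. Clearing one row already splits off a coordinate, which permits an induction on d without a
-- Smith normal form. Once both sides are multiplied by 2^|m| they are natural numbers, and the
-- identity becomes a double count of expansion terms against solutions.

-- The Cauchy reals as a commutative ring

module Reals where

  open import Defs
  open import Algebra.Bundles using (CommutativeRing)
  open import Data.Nat.Base as ℕ using (ℕ)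
  import Data.Nat.Properties as ℕP
  open import Data.Product.Base using (_,_)
  open import Data.Rational.Base as ℚ using (ℚ; 0ℚ; 1ℚ; ½; ∣_∣; _+_; _*_; -_; _-_; _≤_; _<_)
  import Data.Rational.Properties as ℚP
  open import Data.Rational.Solver using (module +-*-Solver)
  open import Level using (0ℓ)
  open import Relation.Binary.PropositionalEquality using (_≡_; refl; sym; trans; cong; subst)

  open CauchyLemmas
  open TrigLemmas using (^-cauchy)

  ≗⇒≈ : ∀ {x y} → (∀ n → approx x n ≡ approx y n) → x ≈ y
  ≗⇒≈ {x} {y} eq ε 0<ε = 0 , λ n _ →
    subst (_< ε) (sym (trans (cong (λ z → ∣ z - approx y n ∣) (eq n)) (x-x≡0 (approx y n)))) 0<ε

  ≈-refl : ∀ {x} → x ≈ x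
  ≈-refl {x} = ≗⇒≈ {x} {x} λ _ → refl

  ≈-sym : ∀ {x y} → x ≈ y → y ≈ x
  ≈-sym {x} {y} x≈y ε 0<ε with x≈y ε 0<ε
  ... | N , p = N , λ n N≤n → subst (_< ε) (∣a-b∣≡∣b-a∣ (approx x n) (approx y n)) (p n N≤n)

  abstract
    -- The equation c ≡ a + b is an argument so that each ε/2 estimate can hand its regrouping of
    -- terms to the ring solver.
    split-< : ∀ {ε a b c} → c ≡ a + b → ∣ a ∣ < ε * ½ → ∣ b ∣ < ε * ½ → ∣ c ∣ < ε
    split-< {ε} {a} {b} refl a< b< = begin-strict
      ∣ a + b ∣       ≤⟨ ℚP.∣p+q∣≤∣p∣+∣q∣ a b ⟩
      ∣ a ∣ + ∣ b ∣   <⟨ ℚP.+-mono-< a< b< ⟩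
      ε * ½ + ε * ½   ≡⟨ half+half ε ⟩
      ε               ∎
      where open ℚP.≤-Reasoning

    ≈-trans : ∀ {x y z} → x ≈ y → y ≈ z → x ≈ z
    ≈-trans {x} {y} {z} x≈y y≈z ε 0<ε
      with x≈y (ε * ½) (half-pos 0<ε) | y≈z (ε * ½) (half-pos 0<ε)
    ... | M , p | N , q = M ℕ.⊔ N , λ n h →
      split-< (solve 3 (λ a b c → a :- c := (a :- b) :+ (b :- c)) refl (approx x n) (approx y n) (approx z n))
        (p n (ℕP.≤-trans (ℕP.m≤m⊔n M N) h)) (q n (ℕP.≤-trans (ℕP.m≤n⊔m M N) h))
      where open +-*-Solver

    +ℝ-cong : ∀ {x y u v} → x ≈ y → u ≈ v → x +ℝ u ≈ y +ℝ v
    +ℝ-cong {x} {y} {u} {v} x≈y u≈v ε 0<ε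
      with x≈y (ε * ½) (half-pos 0<ε) | u≈v (ε * ½) (half-pos 0<ε)
    ... | M , p | N , q = M ℕ.⊔ N , λ n h →
      split-< (solve 4 (λ a b c d → (a :+ c) :- (b :+ d) := (a :- b) :+ (c :- d)) refl
                 (approx x n) (approx y n) (approx u n) (approx v n))
        (p n (ℕP.≤-trans (ℕP.m≤m⊔n M N) h)) (q n (ℕP.≤-trans (ℕP.m≤n⊔m M N) h))
      where open +-*-Solver

    ∣*∣-< : ∀ {a b B δ} → 0ℚ < B → ∣ a ∣ ≤ B → ∣ b ∣ < δ → ∣ a * b ∣ < B * δ
    ∣*∣-< {a} {b} {B} {δ} 0<B a≤B b<δ = begin-strict
      ∣ a * b ∣       ≡⟨ ℚP.∣p*q∣≡∣p∣*∣q∣ a b ⟩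
      ∣ a ∣ * ∣ b ∣   ≤⟨ ℚP.*-monoʳ-≤-nonNeg ∣ b ∣ {{ℚP.∣-∣-nonNeg b}} a≤B ⟩
      B * ∣ b ∣       <⟨ ℚP.*-monoʳ-<-pos B {{ℚ.positive 0<B}} b<δ ⟩
      B * δ           ∎
      where open ℚP.≤-Reasoning

    *ℝ-congˡ : ∀ {x u v} → u ≈ v → x *ℝ u ≈ x *ℝ v
    *ℝ-congˡ {x} {u} {v} u≈v ε 0<ε with bounded (approx x) (isCauchy x)
    ... | B , 0<B , x≤B with quotient 0<ε 0<B
    ... | δ , 0<δ , Bδ≡ε with u≈v δ 0<δ
    ... | N , p = N , λ n h → regroup n (∣*∣-< 0<B (x≤B n) (p n h))
      where
      open +-*-Solver
      regroup : ∀ n → ∣ approx x n * (approx u n - approx v n) ∣ < B * δ →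
                 ∣ approx x n * approx u n - approx x n * approx v n ∣ < ε
      regroup n h = subst (λ e → ∣ approx x n * approx u n - approx x n * approx v n ∣ < e) Bδ≡ε
        (subst (λ e → ∣ e ∣ < B * δ)
          (solve 3 (λ a b c → a :* (b :- c) := a :* b :- a :* c) refl
            (approx x n) (approx u n) (approx v n)) h)

  *ℝ-comm : ∀ x y → x *ℝ y ≈ y *ℝ x
  *ℝ-comm x y = ≗⇒≈ {x *ℝ y} {y *ℝ x} λ n → ℚP.*-comm (approx x n) (approx y n)

  *ℝ-cong : ∀ {x y u v} → x ≈ y → u ≈ v → x *ℝ u ≈ y *ℝ v
  *ℝ-cong {x} {y} {u} {v} x≈y u≈v =
    ≈-trans {x *ℝ u} {x *ℝ v} {y *ℝ v} (*ℝ-congˡ {x} {u} {v} u≈v)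
    (≈-trans {x *ℝ v} {v *ℝ x} {y *ℝ v} (*ℝ-comm x v)
    (≈-trans {v *ℝ x} {v *ℝ y} {y *ℝ v} (*ℝ-congˡ {v} {x} {y} x≈y) (*ℝ-comm v y)))

  -- As a product, negation inherits its Cauchy proof from `_*ℝ_`; the later pointwise identities
  -- therefore contain `- 1ℚ * a` in place of `- a`.
  -ℝ_ : ℝ → ℝ
  -ℝ x = fromℚ (- 1ℚ) *ℝ x

  -- A record, so that unlike _≈_, which unfolds to a function type, it lets Agda
  -- infer x and y from a proof.
  infix 4 _≋_
  record _≋_ (x y : ℝ) : Set where
    constructor wrap
    field unwrap : x ≈ y

  open _≋_ public

  pointwise : ∀ {x y} → (∀ n → approx x n ≡ approx y n) → x ≋ y
  pointwise {x} {y} eq = wrap (≗⇒≈ {x} {y} eq)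

  +-*-commutativeRing : CommutativeRing 0ℓ 0ℓ
  +-*-commutativeRing = record
    { Carrier = ℝ
    ; _≈_ = _≋_
    ; _+_ = _+ℝ_
    ; _*_ = _*ℝ_
    ; -_ = -ℝ_
    ; 0# = fromℚ 0ℚ
    ; 1# = fromℚ 1ℚ
    ; isCommutativeRing = record
      { isRing = record
        { +-isAbelianGroup = record
          { isGroup = record
            { isMonoid = record
              { isSemigroup = record
                { isMagma = record
                  { isEquivalence = record
                    { refl = pointwise λ _ → refl
                    ; sym = λ {x} {y} p → wrap (≈-sym {x} {y} (unwrap p))
                    ; trans = λ {x} {y} {z} p q → wrap (≈-trans {x} {y} {z} (unwrap p) (unwrap q))
                    }
                  ; ∙-cong = λ {x} {y} {u} {v} p q → wrap (+ℝ-cong {x} {y} {u} {v} (unwrap p) (unwrap q))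
                  }
                ; assoc = λ x y z → pointwise λ n → ℚP.+-assoc (approx x n) (approx y n) (approx z n)
                }
              ; identity = (λ x → pointwise λ n → ℚP.+-identityˡ (approx x n))
                         , (λ x → pointwise λ n → ℚP.+-identityʳ (approx x n))
              }
            ; inverse = (λ x → pointwise λ n → inverseˡ (approx x n))
                      , (λ x → pointwise λ n → trans (ℚP.+-comm (approx x n) _) (inverseˡ (approx x n)))
            ; ⁻¹-cong = λ {x} {y} p → wrap (*ℝ-congˡ {fromℚ (- 1ℚ)} {x} {y} (unwrap p))
            }
          ; comm = λ x y → pointwise λ n → ℚP.+-comm (approx x n) (approx y n)
          }
        ; *-cong = λ {x} {y} {u} {v} p q → wrap (*ℝ-cong {x} {y} {u} {v} (unwrap p) (unwrap q))
        ; *-assoc = λ x y z → pointwise λ n → ℚP.*-assoc (approx x n) (approx y n) (approx z n)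
        ; *-identity = (λ x → pointwise λ n → ℚP.*-identityˡ (approx x n))
                     , (λ x → pointwise λ n → ℚP.*-identityʳ (approx x n))
        ; distrib = (λ x y z → pointwise λ n → ℚP.*-distribˡ-+ (approx x n) (approx y n) (approx z n))
                  , (λ x y z → pointwise λ n → ℚP.*-distribʳ-+ (approx x n) (approx y n) (approx z n))
        }
      ; *-comm = λ x y → wrap (*ℝ-comm x y)
      }
    }
    where
    inverseˡ : ∀ a → (- 1ℚ) * a + a ≡ 0ℚ
    inverseˡ a = solve 1 (λ a → (:- con 1ℚ) :* a :+ a := con 0ℚ) refl a
      where open +-*-Solver

  module ℝ-Ring = CommutativeRing +-*-commutativeRing

  abstract
    -- Positivity of y means that its approximations eventually exceed a fixed δ, so |z| δ ≤ |z y| <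
    -- ε δ. This bound avoids constructing a reciprocal of y.
    ≈0-cancelʳ : ∀ z y → fromℚ 0ℚ <ℝ y → z *ℝ y ≈ fromℚ 0ℚ → z ≈ fromℚ 0ℚ
    ≈0-cancelʳ z y (δ , 0<δ , M , y>δ) zy≈0 ε 0<ε with zy≈0 (ε * δ) (*-pos 0<ε 0<δ)
    ... | N , p = M ℕ.⊔ N , λ n h →
      subst (λ w → ∣ w ∣ < ε) (sym (ℚP.+-identityʳ (approx z n)))
        (ℚP.*-cancelʳ-<-nonNeg δ {{ℚ.nonNegative (ℚP.<⇒≤ 0<δ)}} (begin-strict
          ∣ approx z n ∣ * δ                ≤⟨ ℚP.*-monoˡ-≤-nonNeg ∣ approx z n ∣ {{ℚP.∣-∣-nonNeg (approx z n)}}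
                                                 (δ≤∣y∣ n (ℕP.≤-trans (ℕP.m≤m⊔n M N) h)) ⟩
          ∣ approx z n ∣ * ∣ approx y n ∣   ≡⟨ sym (ℚP.∣p*q∣≡∣p∣*∣q∣ (approx z n) (approx y n)) ⟩
          ∣ approx z n * approx y n ∣       ≡⟨ cong ∣_∣ (sym (ℚP.+-identityʳ _)) ⟩
          ∣ approx z n * approx y n - 0ℚ ∣  <⟨ p n (ℕP.≤-trans (ℕP.m≤n⊔m M N) h) ⟩
          ε * δ                             ∎))
      where
      open ℚP.≤-Reasoning
      δ≤∣y∣ : ∀ n → M ℕ.≤ n → δ ≤ ∣ approx y n ∣
      δ≤∣y∣ n M≤n = begin
        δ                 ≡⟨ sym (ℚP.+-identityˡ δ) ⟩
        0ℚ + δ            ≤⟨ ℚP.<⇒≤ (y>δ n M≤n) ⟩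
        approx y n        ≡⟨ sym (ℚP.0≤p⇒∣p∣≡p 0≤y) ⟩
        ∣ approx y n ∣    ∎
        where
        0≤y : 0ℚ ≤ approx y n
        0≤y = ℚP.≤-trans (ℚP.≤-trans (ℚP.<⇒≤ 0<δ) (ℚP.≤-reflexive (sym (ℚP.+-identityˡ δ)))) (ℚP.<⇒≤ (y>δ n M≤n))

-- Cauchy products of rational sequences and their truncation error

module CauchyProduct where

  open import Defs
  open import Data.Nat.Base as ℕ using (ℕ; zero; suc)
  open import Data.Rational.Base as ℚ using (ℚ; 0ℚ; 1ℚ; ∣_∣; _+_; _*_; -_; _-_; _≤_)
  import Data.Rational.Properties as ℚP
  open import Data.Rational.Solver using (module +-*-Solver)
  open import Function.Base using (_∘_)
  open import Relation.Binary.PropositionalEquality using (_≡_; refl; sym; trans; cong; cong₂; subst; module ≡-Reasoning)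

  open CauchyLemmas
  open TrigLemmas

  psum : (ℕ → ℚ) → ℕ → ℚ
  psum f zero    = 0ℚ
  psum f (suc n) = psum f n + f n

  -- Coefficients of the Cauchy product. The recursion shifts the first factor only, so proofs about
  -- it are inductions on k with f generalised.
  conv : (ℕ → ℚ) → (ℕ → ℚ) → ℕ → ℚ
  conv f g zero    = f 0 * g 0
  conv f g (suc k) = f 0 * g (suc k) + conv (f ∘ suc) g k

  -- The products f p * g q over the triangle p + q < n.
  tri : (ℕ → ℚ) → (ℕ → ℚ) → ℕ → ℚ
  tri f g = psum (conv f g)

  -- The terms of the product of two partial sums that are missing from the
  -- partial sum of the Cauchy product.
  excess : (ℕ → ℚ) → (ℕ → ℚ) → ℕ → ℚ
  excess f g n = psum f n * psum g n - tri f g n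

  abstract
    psum-cong : ∀ {f g} → (∀ k → f k ≡ g k) → ∀ n → psum f n ≡ psum g n
    psum-cong eq zero    = refl
    psum-cong eq (suc n) = cong₂ _+_ (psum-cong eq n) (eq n)

    psum-suc : ∀ f n → psum f (suc n) ≡ f 0 + psum (f ∘ suc) n
    psum-suc f zero    = ℚP.+-comm 0ℚ (f 0)
    psum-suc f (suc n) = trans (cong (_+ f (suc n)) (psum-suc f n)) (ℚP.+-assoc (f 0) _ _)

    psum-- : ∀ f g n → psum (λ k → f k - g k) n ≡ psum f n - psum g n
    psum-- f g zero    = refl
    psum-- f g (suc n) = trans (cong (_+ (f n - g n)) (psum-- f g n))
      (solve 4 (λ a b c d → (a :- b) :+ (c :- d) := (a :+ c) :- (b :+ d)) refl
         (psum f n) (psum g n) (f n) (g n))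
      where open +-*-Solver

    ∣psum∣≤ : ∀ {f F} → (∀ k → ∣ f k ∣ ≤ F k) → ∀ n → ∣ psum f n ∣ ≤ psum F n
    ∣psum∣≤ f≤F zero = ℚP.≤-refl
    ∣psum∣≤ {f} f≤F (suc n) = ℚP.≤-trans (ℚP.∣p+q∣≤∣p∣+∣q∣ (psum f n) (f n))
      (ℚP.+-mono-≤ (∣psum∣≤ f≤F n) (f≤F n))

    0≤psum : ∀ {F} → (∀ k → 0ℚ ≤ F k) → ∀ n → 0ℚ ≤ psum F n
    0≤psum 0≤F zero    = ℚP.≤-refl
    0≤psum 0≤F (suc n) = ℚP.+-mono-≤ (0≤psum 0≤F n) (0≤F n)

    psum-mono : ∀ {F} → (∀ k → 0ℚ ≤ F k) → ∀ i n → psum F n ≤ psum F (i ℕ.+ n)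
    psum-mono 0≤F zero    n = ℚP.≤-refl
    psum-mono 0≤F (suc i) n = ℚP.≤-trans (psum-mono 0≤F i n) (0≤⇒≤+ _ (0≤F (i ℕ.+ n)))

    -- The triangle is cut along the row of `f 0`, whereas `psum` adds it diagonal by diagonal.
    tri-suc : ∀ f g n → tri f g (suc n) ≡ f 0 * psum g (suc n) + tri (f ∘ suc) g n
    tri-suc f g zero = solve 2 (λ a b → con 0ℚ :+ a :* b := a :* (con 0ℚ :+ b) :+ con 0ℚ) refl (f 0) (g 0)
      where open +-*-Solver
    tri-suc f g (suc n) = trans (cong (_+ conv f g (suc n)) (tri-suc f g n))
      (solve 5 (λ a p b t c → (a :* p :+ t) :+ (a :* b :+ c) := a :* (p :+ b) :+ (t :+ c)) refl
        (f 0) (psum g (suc n)) (g (suc n)) (tri (f ∘ suc) g n) (conv (f ∘ suc) g n))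
      where open +-*-Solver

    -- The row of `f 0` lies wholly inside the triangle and cancels. What is left of the square has
    -- one column more than it has rows, and that column contributes the last term.
    excess-suc : ∀ f g n → excess f g (suc n) ≡ excess (f ∘ suc) g n + psum (f ∘ suc) n * g n
    excess-suc f g n = trans
      (cong₂ (λ a b → a * psum g (suc n) - b) (psum-suc f n) (tri-suc f g n))
      (solve 5 (λ a h p b t → (a :+ h) :* (p :+ b) :- (a :* (p :+ b) :+ t) := (h :* p :- t) :+ h :* b) refl
        (f 0) (psum (f ∘ suc) n) (psum g n) (g n) (tri (f ∘ suc) g n))
      where open +-*-Solver

    -- The excess is a sum of products f p * g q, each with coefficient 1, so majorants of the
    -- factors majorise it termwise; `excess-suc` allows this to be shown without double indices.
    ∣excess∣≤ : ∀ {f g F G} → (∀ k → ∣ f k ∣ ≤ F k) → (∀ k → ∣ g k ∣ ≤ G k) →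
                ∀ n → ∣ excess f g n ∣ ≤ excess F G n
    ∣excess∣≤ f≤F g≤G zero = ℚP.≤-refl
    ∣excess∣≤ {f} {g} {F} {G} f≤F g≤G (suc n) = begin
      ∣ excess f g (suc n) ∣                            ≡⟨ cong ∣_∣ (excess-suc f g n) ⟩
      ∣ excess (f ∘ suc) g n + psum (f ∘ suc) n * g n ∣ ≤⟨ ℚP.∣p+q∣≤∣p∣+∣q∣ (excess (f ∘ suc) g n) (psum (f ∘ suc) n * g n) ⟩
      ∣ excess (f ∘ suc) g n ∣ + ∣ psum (f ∘ suc) n * g n ∣
        ≤⟨ ℚP.+-mono-≤ (∣excess∣≤ (f≤F ∘ suc) g≤G n) ∣*∣≤ ⟩
      excess (F ∘ suc) G n + psum (F ∘ suc) n * G n     ≡⟨ sym (excess-suc F G n) ⟩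
      excess F G (suc n)                                ∎
      where
      open ℚP.≤-Reasoning
      ∣*∣≤ : ∣ psum (f ∘ suc) n * g n ∣ ≤ psum (F ∘ suc) n * G n
      ∣*∣≤ = ℚP.≤-trans (ℚP.≤-reflexive (ℚP.∣p*q∣≡∣p∣*∣q∣ (psum (f ∘ suc) n) (g n)))
        (*-mono-≤ (ℚP.0≤∣p∣ _) (ℚP.≤-trans (ℚP.0≤∣p∣ (g n)) (g≤G n)) (∣psum∣≤ (f≤F ∘ suc) n) (g≤G n))

    0≤tri : ∀ {F G} → (∀ k → 0ℚ ≤ F k) → (∀ k → 0ℚ ≤ G k) → ∀ n → 0ℚ ≤ tri F G n
    0≤tri {F} {G} 0≤F 0≤G = 0≤psum (0≤conv 0≤F)
      where
      0≤* : ∀ {a b} → 0ℚ ≤ a → 0ℚ ≤ b → 0ℚ ≤ a * b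
      0≤* {a} {b} 0≤a 0≤b = subst (_≤ a * b) (ℚP.*-zeroˡ 0ℚ) (*-mono-≤ ℚP.≤-refl 0≤b 0≤a 0≤b)
      0≤conv : ∀ {F} → (∀ k → 0ℚ ≤ F k) → ∀ k → 0ℚ ≤ conv F G k
      0≤conv 0≤F zero    = 0≤* (0≤F 0) (0≤G 0)
      0≤conv 0≤F (suc k) = ℚP.+-mono-≤ (0≤* (0≤F 0) (0≤G (suc k))) (0≤conv (0≤F ∘ suc) k)

    -- Stated for rectangles because the induction removes one row at a time.
    psum*psum≤tri : ∀ {F G} → (∀ k → 0ℚ ≤ F k) → (∀ k → 0ℚ ≤ G k) →
                    ∀ a n → psum F a * psum G n ≤ tri F G (a ℕ.+ n)
    psum*psum≤tri {F} {G} 0≤F 0≤G zero n =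
      subst (_≤ tri F G n) (sym (ℚP.*-zeroˡ (psum G n))) (0≤tri 0≤F 0≤G n)
    psum*psum≤tri {F} {G} 0≤F 0≤G (suc a) n = begin
      psum F (suc a) * psum G n                          ≡⟨ cong (_* psum G n) (psum-suc F a) ⟩
      (F 0 + psum (F ∘ suc) a) * psum G n                ≡⟨ ℚP.*-distribʳ-+ (psum G n) (F 0) (psum (F ∘ suc) a) ⟩
      F 0 * psum G n + psum (F ∘ suc) a * psum G n       ≤⟨ ℚP.+-mono-≤
        (ℚP.*-monoˡ-≤-nonNeg (F 0) {{ℚ.nonNegative (0≤F 0)}} (psum-mono 0≤G (suc a) n))
        (psum*psum≤tri (0≤F ∘ suc) 0≤G a n) ⟩
      F 0 * psum G (suc (a ℕ.+ n)) + tri (F ∘ suc) G (a ℕ.+ n) ≡⟨ sym (tri-suc F G (a ℕ.+ n)) ⟩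
      tri F G (suc a ℕ.+ n)                              ∎
      where open ℚP.≤-Reasoning

    -- The square p, q < n lies inside the triangle p + q < n + n.
    excess≤ : ∀ {F} → (∀ k → 0ℚ ≤ F k) → ∀ n →
              excess F F (n ℕ.+ n) ≤ psum F (n ℕ.+ n) * psum F (n ℕ.+ n) - psum F n * psum F n
    excess≤ {F} 0≤F n = ℚP.+-monoʳ-≤ (psum F (n ℕ.+ n) * psum F (n ℕ.+ n))
      (ℚP.neg-antimono-≤ (psum*psum≤tri 0≤F 0≤F n n))

    conv-cong : ∀ {f f′ g g′} → (∀ k → f k ≡ f′ k) → (∀ k → g k ≡ g′ k) →
                ∀ k → conv f g k ≡ conv f′ g′ k
    conv-cong p q zero    = cong₂ _*_ (p 0) (q 0)
    conv-cong p q (suc k) = cong₂ _+_ (cong₂ _*_ (p 0) (q (suc k))) (conv-cong (p ∘ suc) q k)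

    conv-+ : ∀ f f′ g k → conv (λ i → f i + f′ i) g k ≡ conv f g k + conv f′ g k
    conv-+ f f′ g zero    = ℚP.*-distribʳ-+ (g 0) (f 0) (f′ 0)
    conv-+ f f′ g (suc k) = trans
      (cong ((f 0 + f′ 0) * g (suc k) +_) (conv-+ (f ∘ suc) (f′ ∘ suc) g k))
      (solve 5 (λ a b c d e → (a :+ b) :* c :+ (d :+ e) := (a :* c :+ d) :+ (b :* c :+ e)) refl
        (f 0) (f′ 0) (g (suc k)) (conv (f ∘ suc) g k) (conv (f′ ∘ suc) g k))
      where open +-*-Solver

    conv-*ˡ : ∀ c f g k → conv (λ i → c * f i) g k ≡ c * conv f g k
    conv-*ˡ c f g zero    = ℚP.*-assoc c (f 0) (g 0)
    conv-*ˡ c f g (suc k) = trans (cong (c * f 0 * g (suc k) +_) (conv-*ˡ c (f ∘ suc) g k))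
      (solve 4 (λ c a b d → c :* a :* b :+ c :* d := c :* (a :* b :+ d)) refl c (f 0) (g (suc k)) (conv (f ∘ suc) g k))
      where open +-*-Solver

    conv-*ʳ : ∀ c f g k → conv f (λ i → c * g i) k ≡ c * conv f g k
    conv-*ʳ c f g zero    = solve 3 (λ c a b → a :* (c :* b) := c :* (a :* b)) refl c (f 0) (g 0)
      where open +-*-Solver
    conv-*ʳ c f g (suc k) = trans (cong (f 0 * (c * g (suc k)) +_) (conv-*ʳ c (f ∘ suc) g k))
      (solve 4 (λ c a b d → a :* (c :* b) :+ c :* d := c :* (a :* b :+ d)) refl c (f 0) (g (suc k)) (conv (f ∘ suc) g k))
      where open +-*-Solver

  -- Formal derivative of the power series with coefficients f.
  ∂ : (ℕ → ℚ) → ℕ → ℚ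
  ∂ f k = ι (suc k) * f (suc k)

  abstract
    -- The product rule for power series. Together with `expTerm-suc`, by which the exponential
    -- series solves e′ = x e, it gives the binomial theorem without any binomial coefficient.
    conv-leibniz : ∀ f g k → ∂ (conv f g) k ≡ conv (∂ f) g k + conv f (∂ g) k
    conv-leibniz f g zero =
      solve 5 (λ i a b c d → i :* (a :* b :+ c :* d) := (i :* c) :* d :+ a :* (i :* b)) refl
        (ι 1) (f 0) (g 1) (f 1) (g 0)
      where open +-*-Solver
    conv-leibniz f g (suc k) = begin
      ι (2 ℕ.+ k) * (f 0 * g (2 ℕ.+ k) + conv h g (suc k))
        ≡⟨ ℚP.*-distribˡ-+ (ι (2 ℕ.+ k)) (f 0 * g (2 ℕ.+ k)) (conv h g (suc k)) ⟩
      ι (2 ℕ.+ k) * (f 0 * g (2 ℕ.+ k)) + ι (2 ℕ.+ k) * conv h g (suc k)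
        -- One unit of the factor k + 2 is set aside; it accounts for the index shift between `∂ h`
        -- and `∂ f`.
        ≡⟨ cong (λ z → ι (2 ℕ.+ k) * (f 0 * g (2 ℕ.+ k)) + z * conv h g (suc k)) (ι-suc (suc k)) ⟩
      ι (2 ℕ.+ k) * (f 0 * g (2 ℕ.+ k)) + (ι (suc k) + 1ℚ) * conv h g (suc k)
        ≡⟨ solve 5 (λ i a b j c → i :* (a :* b) :+ (j :+ con 1ℚ) :* c := (a :* (i :* b) :+ c) :+ j :* c) refl
             (ι (2 ℕ.+ k)) (f 0) (g (2 ℕ.+ k)) (ι (suc k)) (conv h g (suc k)) ⟩
      (f 0 * ∂ g (suc k) + conv h g (suc k)) + ∂ (conv h g) k
        ≡⟨ cong ((f 0 * ∂ g (suc k) + conv h g (suc k)) +_) (conv-leibniz h g k) ⟩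
      (f 0 * ∂ g (suc k) + conv h g (suc k)) + (conv (∂ h) g k + conv h (∂ g) k)
        ≡⟨ solve 5 (λ a b c d e → (a :+ (b :+ c)) :+ (d :+ e) := (b :+ (c :+ d)) :+ (a :+ e)) refl
             (f 0 * ∂ g (suc k)) (h 0 * g (suc k)) (conv (h ∘ suc) g k) (conv (∂ h) g k) (conv h (∂ g) k) ⟩
      (h 0 * g (suc k) + (conv (h ∘ suc) g k + conv (∂ h) g k)) + conv f (∂ g) (suc k)
        ≡⟨ cong (λ z → (h 0 * g (suc k) + z) + conv f (∂ g) (suc k)) (sym (conv-+ (h ∘ suc) (∂ h) g k)) ⟩
      (h 0 * g (suc k) + conv (λ i → h (suc i) + ∂ h i) g k) + conv f (∂ g) (suc k)
        ≡⟨ cong (_+ conv f (∂ g) (suc k)) (cong₂ _+_ (cong (_* g (suc k)) (sym ∂f0)) (conv-cong ∂f-suc (λ _ → refl) k)) ⟩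
      conv (∂ f) g (suc k) + conv f (∂ g) (suc k) ∎
      where
      open ≡-Reasoning
      open +-*-Solver
      h : ℕ → ℚ
      h = f ∘ suc
      ∂f0 : ∂ f 0 ≡ h 0
      ∂f0 = ℚP.*-identityˡ (h 0)
      ∂f-suc : ∀ i → h (suc i) + ∂ h i ≡ ∂ f (suc i)
      ∂f-suc i = sym (trans (cong (_* h (suc i)) (ι-suc (suc i)))
        (solve 2 (λ j a → (j :+ con 1ℚ) :* a := a :+ j :* a) refl (ι (suc i)) (h (suc i))))

    ι-cancelˡ : ∀ n {a b} → ι (suc n) * a ≡ ι (suc n) * b → a ≡ b
    ι-cancelˡ n eq = ℚP.≤-antisym (ℚP.*-cancelˡ-≤-pos (ι (suc n)) (ℚP.≤-reflexive eq))
                                 (ℚP.*-cancelˡ-≤-pos (ι (suc n)) (ℚP.≤-reflexive (sym eq)))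

    -- Both sides solve (k + 1) c(k + 1) = (x + y) c(k).
    conv-expTerm : ∀ x y k → conv (expTerm x) (expTerm y) k ≡ expTerm (x + y) k
    conv-expTerm x y zero    = refl
    conv-expTerm x y (suc k) = ι-cancelˡ k (begin
      ∂ (conv ex ey) k                            ≡⟨ conv-leibniz ex ey k ⟩
      conv (∂ ex) ey k + conv ex (∂ ey) k         ≡⟨ cong₂ _+_ (conv-cong (expTerm-suc x) (λ _ → refl) k)
                                                               (conv-cong (λ _ → refl) (expTerm-suc y) k) ⟩
      conv (λ i → x * ex i) ey k + conv ex (λ i → y * ey i) k
                                                  ≡⟨ cong₂ _+_ (conv-*ˡ x ex ey k) (conv-*ʳ y ex ey k) ⟩
      x * conv ex ey k + y * conv ex ey k         ≡⟨ sym (ℚP.*-distribʳ-+ (conv ex ey k) x y) ⟩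
      (x + y) * conv ex ey k                      ≡⟨ cong ((x + y) *_) (conv-expTerm x y k) ⟩
      (x + y) * expTerm (x + y) k                 ≡⟨ sym (expTerm-suc (x + y) k) ⟩
      ι (suc k) * expTerm (x + y) (suc k)         ∎)
      where
      open ≡-Reasoning
      ex ey : ℕ → ℚ
      ex = expTerm x
      ey = expTerm y

-- The addition theorem for the partial sums of cosine

module Addition where

  open import Defs
  import Algebra.Definitions.RawSemiring as RawSemiringDefs
  open import Data.Nat.Base as ℕ using (ℕ; zero; suc)
  import Data.Nat.Properties as ℕP
  open import Data.Product.Base using (∃; _,_; proj₁; proj₂)
  open import Data.Rational.Base as ℚ using (ℚ; 0ℚ; 1ℚ; ½; ∣_∣; _+_; _*_; -_; _-_; _≤_; _<_)
  import Data.Rational.Properties as ℚP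
  open import Data.Rational.Solver using (module +-*-Solver)
  open import Data.Sum.Base using (inj₁; inj₂)
  open import Function.Base using (_∘_)
  open import Relation.Binary.PropositionalEquality using (_≡_; refl; sym; trans; cong; cong₂; subst; module ≡-Reasoning)
  open Reals
  open CauchyProduct

  open CauchyLemmas
  open TrigLemmas

  open RawSemiringDefs ℚ.+-*-rawSemiring using () renaming (_^_ to _^ℚ_)

  -- Re iᵏ and Im iᵏ
  γ σ : ℕ → ℚ
  γ zero    = 1ℚ
  γ (suc k) = - σ k
  σ zero    = 0ℚ
  σ (suc k) = γ k

  abstract
    γ-+ : ∀ i j → γ i * γ j - σ i * σ j ≡ γ (i ℕ.+ j)
    σ-+ : ∀ i j → σ i * γ j + γ i * σ j ≡ σ (i ℕ.+ j)
    γ-+ zero    j = solve 2 (λ a b → con 1ℚ :* a :- con 0ℚ :* b := a) refl (γ j) (σ j)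
      where open +-*-Solver
    γ-+ (suc i) j = trans
      (solve 4 (λ a b c d → (:- a) :* b :- c :* d := :- (a :* b :+ c :* d)) refl (σ i) (γ j) (γ i) (σ j))
      (cong -_ (σ-+ i j))
      where open +-*-Solver
    σ-+ zero    j = solve 2 (λ a b → con 0ℚ :* a :+ con 1ℚ :* b := b) refl (γ j) (σ j)
      where open +-*-Solver
    σ-+ (suc i) j = trans
      (solve 4 (λ a b c d → a :* b :+ (:- c) :* d := a :* b :- c :* d) refl (γ i) (γ j) (σ i) (σ j))
      (γ-+ i j)
      where open +-*-Solver

    -- The coefficient law is assumed for arbitrary sequences rather than for `γ` and `σ`, because
    -- the induction shifts the first index and the total but keeps the second index.
    conv-addition : ∀ {γ₁ γ₂ σ₁ σ₂ γ₃ : ℕ → ℚ} →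
      (∀ i j → γ₁ i * γ₂ j - σ₁ i * σ₂ j ≡ γ₃ (i ℕ.+ j)) → ∀ f g k →
      conv (λ i → γ₁ i * f i) (λ i → γ₂ i * g i) k - conv (λ i → σ₁ i * f i) (λ i → σ₂ i * g i) k
      ≡ γ₃ k * conv f g k
    conv-addition {γ₁} {γ₂} {σ₁} {σ₂} law f g zero = trans
      (solve 6 (λ a b c d u v → (a :* u) :* (b :* v) :- (c :* u) :* (d :* v) := (a :* b :- c :* d) :* (u :* v)) refl
        (γ₁ 0) (γ₂ 0) (σ₁ 0) (σ₂ 0) (f 0) (g 0))
      (cong (_* (f 0 * g 0)) (law 0 0))
      where open +-*-Solver
    conv-addition {γ₁} {γ₂} {σ₁} {σ₂} {γ₃} law f g (suc k) = begin
      (γ₁ 0 * f 0 * (γ₂ (suc k) * g (suc k)) + cc) - (σ₁ 0 * f 0 * (σ₂ (suc k) * g (suc k)) + ss)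
        ≡⟨ solve 8 (λ a b c d u v p q → ((a :* u) :* (b :* v) :+ p) :- ((c :* u) :* (d :* v) :+ q)
                     := (a :* b :- c :* d) :* (u :* v) :+ (p :- q)) refl
             (γ₁ 0) (γ₂ (suc k)) (σ₁ 0) (σ₂ (suc k)) (f 0) (g (suc k)) cc ss ⟩
      (γ₁ 0 * γ₂ (suc k) - σ₁ 0 * σ₂ (suc k)) * (f 0 * g (suc k)) + (cc - ss)
        ≡⟨ cong₂ _+_ (cong (_* (f 0 * g (suc k))) (law 0 (suc k)))
                     (conv-addition {γ₁ ∘ suc} {γ₂} {σ₁ ∘ suc} {σ₂} {γ₃ ∘ suc} (λ i → law (suc i)) (f ∘ suc) g k) ⟩
      γ₃ (suc k) * (f 0 * g (suc k)) + γ₃ (suc k) * conv (f ∘ suc) g k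
        ≡⟨ sym (ℚP.*-distribˡ-+ (γ₃ (suc k)) _ _) ⟩
      γ₃ (suc k) * conv f g (suc k) ∎
      where
      open ≡-Reasoning
      open +-*-Solver
      cc ss : ℚ
      cc = conv (λ i → γ₁ (suc i) * f (suc i)) (λ i → γ₂ i * g i) k
      ss = conv (λ i → σ₁ (suc i) * f (suc i)) (λ i → σ₂ i * g i) k

  -- The two series padded with zeros in the degrees of the other parity, so that their Cauchy
  -- products run over all degrees and combine into that of the exponential series.
  cosTerm sinTerm : ℚ → ℕ → ℚ
  cosTerm x k = γ k * expTerm x k
  sinTerm x k = σ k * expTerm x k

  abstract
    σ-even : ∀ k → σ (k ℕ.* 2) ≡ 0ℚ
    σ-even zero    = refl
    σ-even (suc k) = cong -_ (σ-even k)

    γ-even : ∀ k → γ (k ℕ.* 2) ≡ (- 1ℚ) ^ℚ k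
    γ-even zero    = refl
    γ-even (suc k) = trans (cong -_ (γ-even k))
      (solve 1 (λ a → :- a := (:- con 1ℚ) :* a) refl ((- 1ℚ) ^ℚ k))
      where open +-*-Solver

    trigSum-cos : ∀ n x → trigSum 0 n x ≡ psum (cosTerm x) (n ℕ.* 2)
    trigSum-cos zero    x = refl
    trigSum-cos (suc n) x = begin
      trigSum 0 n x + (- 1ℚ) ^ℚ n * expTerm x (n ℕ.* 2 ℕ.+ 0)
        ≡⟨ cong₂ (λ s j → trigSum 0 n x + s * expTerm x j) (sym (γ-even n)) (ℕP.+-identityʳ (n ℕ.* 2)) ⟩
      trigSum 0 n x + cosTerm x (n ℕ.* 2)
        ≡⟨ cong (_+ cosTerm x (n ℕ.* 2)) (trigSum-cos n x) ⟩
      psum (cosTerm x) (suc (n ℕ.* 2))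
        ≡⟨ sym (ℚP.+-identityʳ _) ⟩
      psum (cosTerm x) (suc (n ℕ.* 2)) + 0ℚ
        ≡⟨ cong (psum (cosTerm x) (suc (n ℕ.* 2)) +_)
             (sym (trans (cong (λ z → - z * expTerm x (suc (n ℕ.* 2))) (σ-even n)) (ℚP.*-zeroˡ (expTerm x (suc (n ℕ.* 2)))))) ⟩
      psum (cosTerm x) (suc n ℕ.* 2) ∎
      where open ≡-Reasoning

    trigSum-sin : ∀ n x → trigSum 1 n x ≡ psum (sinTerm x) (n ℕ.* 2)
    trigSum-sin zero    x = refl
    trigSum-sin (suc n) x = begin
      trigSum 1 n x + (- 1ℚ) ^ℚ n * expTerm x (n ℕ.* 2 ℕ.+ 1)
        ≡⟨ cong₂ (λ s j → trigSum 1 n x + s * expTerm x j) (sym (γ-even n)) (ℕP.+-comm (n ℕ.* 2) 1) ⟩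
      trigSum 1 n x + sinTerm x (suc (n ℕ.* 2))
        ≡⟨ cong (_+ sinTerm x (suc (n ℕ.* 2))) (trans (trigSum-sin n x) (sym (ℚP.+-identityʳ _))) ⟩
      psum (sinTerm x) (n ℕ.* 2) + 0ℚ + sinTerm x (suc (n ℕ.* 2))
        ≡⟨ cong (λ z → psum (sinTerm x) (n ℕ.* 2) + z + sinTerm x (suc (n ℕ.* 2)))
             (sym (trans (cong (_* expTerm x (n ℕ.* 2)) (σ-even n)) (ℚP.*-zeroˡ (expTerm x (n ℕ.* 2))))) ⟩
      psum (sinTerm x) (suc n ℕ.* 2) ∎
      where open ≡-Reasoning

    tri-addition : ∀ x y n →
      tri (cosTerm x) (cosTerm y) n - tri (sinTerm x) (sinTerm y) n ≡ psum (cosTerm (x + y)) n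
    tri-addition x y n = trans (sym (psum-- _ _ n)) (psum-cong (λ k → trans
      (conv-addition {γ} {γ} {σ} {σ} {γ} γ-+ (expTerm x) (expTerm y) k)
      (cong (γ k *_) (conv-expTerm x y k))) n)

    -- The triangular parts of the products satisfy the addition theorem exactly, by `tri-addition`;
    -- a finite stage therefore fails only by the terms outside the triangle.
    excess-addition : ∀ x y n →
      trigSum 0 n (x + y) - (trigSum 0 n x * trigSum 0 n y - trigSum 1 n x * trigSum 1 n y)
      ≡ excess (sinTerm x) (sinTerm y) (n ℕ.* 2) - excess (cosTerm x) (cosTerm y) (n ℕ.* 2)
    excess-addition x y n = begin
      trigSum 0 n (x + y) - (trigSum 0 n x * trigSum 0 n y - trigSum 1 n x * trigSum 1 n y)
        ≡⟨ cong₂ _-_ (trans (trigSum-cos n (x + y)) (sym (tri-addition x y N)))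
             (cong₂ _-_ (cong₂ _*_ (trigSum-cos n x) (trigSum-cos n y)) (cong₂ _*_ (trigSum-sin n x) (trigSum-sin n y))) ⟩
      (tcc - tss) - (pcc - pss)
        ≡⟨ solve 4 (λ a b c d → (a :- b) :- (c :- d) := (d :- b) :- (c :- a)) refl tcc tss pcc pss ⟩
      (pss - tss) - (pcc - tcc) ∎
      where
      open ≡-Reasoning
      open +-*-Solver
      N : ℕ
      N = n ℕ.* 2
      tcc tss pcc pss : ℚ
      tcc = tri (cosTerm x) (cosTerm y) N
      tss = tri (sinTerm x) (sinTerm y) N
      pcc = psum (cosTerm x) N * psum (cosTerm y) N
      pss = psum (sinTerm x) N * psum (sinTerm y) N

    ∣γ∣≤1 : ∀ k → ∣ γ k ∣ ≤ 1ℚ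
    ∣σ∣≤1 : ∀ k → ∣ σ k ∣ ≤ 1ℚ
    ∣γ∣≤1 zero    = ℚP.≤-refl
    ∣γ∣≤1 (suc k) = subst (_≤ 1ℚ) (sym (ℚP.∣-p∣≡∣p∣ (σ k))) (∣σ∣≤1 k)
    ∣σ∣≤1 zero    = ℚP.<⇒≤ 0<1
    ∣σ∣≤1 (suc k) = ∣γ∣≤1 k

    ∣expTerm∣≤ : ∀ {x B} → ∣ x ∣ ≤ B → ∀ k → ∣ expTerm x k ∣ ≤ expTerm B k
    ∣expTerm∣≤ {x} {B} x≤B k = begin
      ∣ x ^ℚ k * 1/! k ∣       ≡⟨ ℚP.∣p*q∣≡∣p∣*∣q∣ (x ^ℚ k) (1/! k) ⟩
      ∣ x ^ℚ k ∣ * ∣ 1/! k ∣   ≡⟨ cong (∣ x ^ℚ k ∣ *_) (ℚP.0≤p⇒∣p∣≡p (ℚP.<⇒≤ (0<1/! k))) ⟩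
      ∣ x ^ℚ k ∣ * 1/! k       ≤⟨ ℚP.*-monoʳ-≤-nonNeg (1/! k) {{ℚ.nonNegative (ℚP.<⇒≤ (0<1/! k))}} (∣^∣-mono x≤B k) ⟩
      B ^ℚ k * 1/! k           ∎
      where open ℚP.≤-Reasoning

    ∣*expTerm∣≤ : ∀ {c x B} → ∣ c ∣ ≤ 1ℚ → ∣ x ∣ ≤ B → ∀ k → ∣ c * expTerm x k ∣ ≤ expTerm B k
    ∣*expTerm∣≤ {c} {x} {B} c≤1 x≤B k = begin
      ∣ c * expTerm x k ∣        ≡⟨ ℚP.∣p*q∣≡∣p∣*∣q∣ c (expTerm x k) ⟩
      ∣ c ∣ * ∣ expTerm x k ∣    ≤⟨ ℚP.*-monoʳ-≤-nonNeg ∣ expTerm x k ∣ {{ℚP.∣-∣-nonNeg (expTerm x k)}} c≤1 ⟩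
      1ℚ * ∣ expTerm x k ∣       ≡⟨ ℚP.*-identityˡ _ ⟩
      ∣ expTerm x k ∣            ≤⟨ ∣expTerm∣≤ {x} {B} x≤B k ⟩
      expTerm B k                ∎
      where open ℚP.≤-Reasoning

    psum-expTerm-cauchy : ∀ {B} → 0ℚ < B → IsCauchy (psum (expTerm B))
    psum-expTerm-cauchy {B} 0<B ε 0<ε
      with Tail.T-small 0 0<B (ε * ½) (half-pos 0<ε)
    -- `T-small` controls the N-th term of even degree, which is the term of degree 2N in the full
    -- series.
    ... | N , K≤N , small = N ℕ.* 2 ℕ.+ 0 , λ m n M≤m M≤n →
      split-< (solve 3 (λ a b c → a :- b := (a :- c) :+ (c :- b)) refl (S m) (S n) (S M))
        (near m M≤m) (subst (_< ε * ½) (∣a-b∣≡∣b-a∣ (S n) (S M)) (near n M≤n))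
      where
      open +-*-Solver
      M : ℕ
      M = N ℕ.* 2 ℕ.+ 0
      e S : ℕ → ℚ
      e = expTerm B
      S = psum e
      K≤M : Tail.K 0 0<B ℕ.≤ M
      K≤M = ℕP.≤-trans K≤N (ℕP.≤-trans (ℕP.m≤m*n N 2) (ℕP.m≤m+n (N ℕ.* 2) 0))
      0≤e : ∀ k → 0ℚ ≤ e k
      0≤e = Tail.0≤expTerm 0 0<B
      -- Twice the current term dominates the remaining tail; keeping it on the left lets the
      -- halving of the terms pay for each new one.
      tail-bound : ∀ i → ∣ S (i ℕ.+ M) - S M ∣ + (e (i ℕ.+ M) + e (i ℕ.+ M)) ≤ e M + e M
      tail-bound zero    = ℚP.≤-reflexive (trans (cong (_+ (e M + e M)) (x-x≡0 (S M))) (ℚP.+-identityˡ _))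
      tail-bound (suc i) = Tail.tail-step 0 0<B {S (i ℕ.+ M)} {S M} {e (i ℕ.+ M)} {e (i ℕ.+ M)} {e (suc (i ℕ.+ M))}
        (ℚP.≤-reflexive (ℚP.0≤p⇒∣p∣≡p (0≤e (i ℕ.+ M))))
        (Tail.expTerm-halves 0 0<B (i ℕ.+ M) (ℕP.≤-trans K≤M (ℕP.m≤n+m M i)))
        (tail-bound i)
      near : ∀ m → M ℕ.≤ m → ∣ S m - S M ∣ < ε * ½
      near m M≤m = subst (λ k → ∣ S k - S M ∣ < ε * ½) (ℕP.m∸n+n≡m M≤m)
        (Tail.drop-+ 0 0<B ∣ S (m ℕ.∸ M ℕ.+ M) - S M ∣ (e (m ℕ.∸ M ℕ.+ M)) (0≤e (m ℕ.∸ M ℕ.+ M)) (tail-bound (m ℕ.∸ M)) small)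

    p≤∣p∣ : ∀ p → p ≤ ∣ p ∣
    p≤∣p∣ p with ℚP.≤-total 0ℚ p
    ... | inj₁ 0≤p = ℚP.≤-reflexive (sym (ℚP.0≤p⇒∣p∣≡p 0≤p))
    ... | inj₂ p≤0 = ℚP.≤-trans p≤0 (ℚP.0≤∣p∣ p)

    -- By `excess≤` the missing terms amount to at most S(2n)² - S(n)², which is small because the
    -- square of a Cauchy sequence is Cauchy.
    excess-small : ∀ {B} → 0ℚ < B → ∀ ε → 0ℚ < ε →
                   ∃ λ N → ∀ n → N ℕ.≤ n → excess (expTerm B) (expTerm B) (n ℕ.* 2) < ε
    excess-small {B} 0<B ε 0<ε = proj₁ S²-cauchy , bound
      where
      open ℚP.≤-Reasoning
      e S : ℕ → ℚ
      e = expTerm B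
      S = psum e
      S²-cauchy : ∃ λ N → ∀ m n → N ℕ.≤ m → N ℕ.≤ n → ∣ S m * S m - S n * S n ∣ < ε
      S²-cauchy = *-cauchy S S (psum-expTerm-cauchy 0<B) (psum-expTerm-cauchy 0<B) ε 0<ε
      n*2≡n+n : ∀ n → n ℕ.* 2 ≡ n ℕ.+ n
      n*2≡n+n n = trans (ℕP.*-comm n 2) (cong (n ℕ.+_) (ℕP.+-identityʳ n))
      bound : ∀ n → proj₁ S²-cauchy ℕ.≤ n → excess e e (n ℕ.* 2) < ε
      bound n N≤n = begin-strict
        excess e e (n ℕ.* 2)                            ≡⟨ cong (excess e e) (n*2≡n+n n) ⟩
        excess e e (n ℕ.+ n)                            ≤⟨ excess≤ (Tail.0≤expTerm 0 0<B) n ⟩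
        S (n ℕ.+ n) * S (n ℕ.+ n) - S n * S n           ≤⟨ p≤∣p∣ (S (n ℕ.+ n) * S (n ℕ.+ n) - S n * S n) ⟩
        ∣ S (n ℕ.+ n) * S (n ℕ.+ n) - S n * S n ∣       <⟨ proj₂ S²-cauchy (n ℕ.+ n) n (ℕP.≤-trans N≤n (ℕP.m≤m+n n n)) N≤n ⟩
        ε                                               ∎

-- Cosine on the reals: congruence, addition theorem, parity

module Cosine where

  open import Defs
  import Algebra.Definitions.RawSemiring as RawSemiringDefs
  open import Data.Nat.Base as ℕ using (ℕ; zero; suc)
  import Data.Nat.Properties as ℕP
  open import Data.Product.Base using (∃; _×_; _,_; proj₁; proj₂)
  open import Data.Rational.Base as ℚ using (ℚ; 0ℚ; 1ℚ; ½; ∣_∣; _+_; _*_; -_; _-_; _≤_; _<_)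
  import Data.Rational.Properties as ℚP
  open import Data.Rational.Solver using (module +-*-Solver)
  open import Relation.Binary.PropositionalEquality using (_≡_; refl; sym; trans; cong; cong₂; subst)
  open Reals
  open CauchyProduct
  open Addition

  open CauchyLemmas
  open TrigLemmas

  open RawSemiringDefs ℚ.+-*-rawSemiring using () renaming (_^_ to _^ℚ_)

  powℝ : ℝ → ℕ → ℝ
  powℝ x j = mkℝ (λ n → approx x n ^ℚ j) (^-cauchy (approx x) (isCauchy x) j)

  -- With the number of terms fixed, a partial sum is a polynomial in x, and its congruence is that
  -- of the ring operations; `cos` itself changes the polynomial at every stage.
  trigSumℝ : ℕ → ℕ → ℝ → ℝ
  trigSumℝ p N x = mkℝ (λ n → trigSum p N (approx x n)) (trigSum-cauchy p (approx x) (isCauchy x) N)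

  abstract
    powℝ-cong : ∀ {x y} → x ≈ y → ∀ j → powℝ x j ≈ powℝ y j
    powℝ-cong {x} {y} x≈y zero    = ≈-refl {powℝ x 0}
    powℝ-cong {x} {y} x≈y (suc j) = *ℝ-cong {x} {y} {powℝ x j} {powℝ y j} x≈y (powℝ-cong {x} {y} x≈y j)

    trigSumℝ-cong : ∀ {x y} → x ≈ y → ∀ p N → trigSumℝ p N x ≈ trigSumℝ p N y
    trigSumℝ-cong {x} {y} x≈y p zero    = ≈-refl {fromℚ 0ℚ}
    trigSumℝ-cong {x} {y} x≈y p (suc N) =
      +ℝ-cong {trigSumℝ p N x} {trigSumℝ p N y} {s *ℝ (powℝ x j *ℝ r)} {s *ℝ (powℝ y j *ℝ r)}
        (trigSumℝ-cong {x} {y} x≈y p N)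
        (*ℝ-congˡ {s} {powℝ x j *ℝ r} {powℝ y j *ℝ r}
          (*ℝ-cong {powℝ x j} {powℝ y j} {r} {r} (powℝ-cong {x} {y} x≈y j) (≈-refl {r})))
      where
      j : ℕ
      j = N ℕ.* 2 ℕ.+ p
      s r : ℝ
      s = fromℚ ((- 1ℚ) ^ℚ N)
      r = fromℚ (1/! j)

    trigSum-uniform : ∀ p {B} → 0ℚ < B → ∀ ε → 0ℚ < ε →
      ∃ λ N → ∀ x → ∣ x ∣ ≤ B → ∀ n → N ℕ.≤ n → ∣ trigSum p n x - trigSum p N x ∣ < ε
    trigSum-uniform p 0<B = Tail.tail-small p 0<B

    ∣∣≤+ˡ : ∀ {a B C} → 0ℚ < C → ∣ a ∣ ≤ B → ∣ a ∣ ≤ B + C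
    ∣∣≤+ˡ {a} {B} 0<C a≤B = ℚP.≤-trans a≤B (0≤⇒≤+ B (ℚP.<⇒≤ 0<C))

    ∣∣≤+ʳ : ∀ {a B C} → 0ℚ < B → ∣ a ∣ ≤ C → ∣ a ∣ ≤ B + C
    ∣∣≤+ʳ {a} {B} {C} 0<B a≤C = subst (∣ a ∣ ≤_) (ℚP.+-comm C B) (∣∣≤+ˡ {a} 0<B a≤C)

    common-bound : ∀ x y → ∃ λ B → 0ℚ < B × (∀ n → ∣ approx x n ∣ ≤ B) × (∀ n → ∣ approx y n ∣ ≤ B)
    common-bound x y = proj₁ bx + proj₁ by , ℚP.+-mono-< (proj₁ (proj₂ bx)) (proj₁ (proj₂ by)) ,
        (λ n → ∣∣≤+ˡ {approx x n} (proj₁ (proj₂ by)) (proj₂ (proj₂ bx) n)) ,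
        (λ n → ∣∣≤+ʳ {approx y n} (proj₁ (proj₂ bx)) (proj₂ (proj₂ by) n))
      where
      bx : ∃ λ B → 0ℚ < B × (∀ n → ∣ approx x n ∣ ≤ B)
      bx = bounded (approx x) (isCauchy x)
      by : ∃ λ B → 0ℚ < B × (∀ n → ∣ approx y n ∣ ≤ B)
      by = bounded (approx y) (isCauchy y)

    -- Stage n evaluates the n-th partial sum, so continuity of a single polynomial does not
    -- suffice. Both sides are moved to a fixed N-th sum, uniformly on a common bound of the
    -- approximations, and compared there.
    cos-cong : ∀ {x y} → x ≈ y → cos x ≈ cos y
    cos-cong {x} {y} x≈y ε 0<ε = M ℕ.⊔ N , λ n h →
        let N≤n = ℕP.≤-trans (ℕP.m≤n⊔m M N) h in
        split-< (regroup (S n (approx x n)) (S N (approx x n)) (S N (approx y n)) (S n (approx y n)))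
          (split-< refl (proj₂ uniform (approx x n) (x≤B n) n N≤n)
            (subst (_< ε * ½ * ½) (∣a-b∣≡∣b-a∣ (S n (approx y n)) (S N (approx y n)))
              (proj₂ uniform (approx y n) (y≤B n) n N≤n)))
          (proj₂ mid n (ℕP.≤-trans (ℕP.m≤m⊔n M N) h))
      where
      open +-*-Solver
      S : ℕ → ℚ → ℚ
      S = trigSum 0
      regroup : ∀ a b c d → a - d ≡ ((a - b) + (c - d)) + (b - c)
      regroup = solve 4 (λ a b c d → a :- d := ((a :- b) :+ (c :- d)) :+ (b :- c)) refl
      xy : ∃ λ B → 0ℚ < B × (∀ n → ∣ approx x n ∣ ≤ B) × (∀ n → ∣ approx y n ∣ ≤ B)
      xy = common-bound x y
      x≤B : ∀ n → ∣ approx x n ∣ ≤ proj₁ xy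
      x≤B = proj₁ (proj₂ (proj₂ xy))
      y≤B : ∀ n → ∣ approx y n ∣ ≤ proj₁ xy
      y≤B = proj₂ (proj₂ (proj₂ xy))
      uniform : ∃ λ N → ∀ z → ∣ z ∣ ≤ proj₁ xy → ∀ n → N ℕ.≤ n → ∣ S n z - S N z ∣ < ε * ½ * ½
      uniform = trigSum-uniform 0 (proj₁ (proj₂ xy)) (ε * ½ * ½) (half-pos (half-pos 0<ε))
      N : ℕ
      N = proj₁ uniform
      mid : ∃ λ M → ∀ n → M ℕ.≤ n → ∣ S N (approx x n) - S N (approx y n) ∣ < ε * ½
      mid = trigSumℝ-cong {x} {y} x≈y 0 N (ε * ½) (half-pos 0<ε)
      M : ℕ
      M = proj₁ mid

    -- Since `approx (x +ℝ y) n` is `approx x n + approx y n`, each stage is an instance of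
    -- `excess-addition`; both excesses are dominated by that of the exponential series at a common
    -- bound.
    cos-+ : ∀ x y → cos (x +ℝ y) ≈ (cos x *ℝ cos y) +ℝ (-ℝ (sin x *ℝ sin y))
    cos-+ x y ε 0<ε = proj₁ small , λ n h →
        split-< (trans (cong (λ z → trigSum 0 n (approx x n + approx y n) - (trigSum 0 n (approx x n) * trigSum 0 n (approx y n) + z))
                         (neg (trigSum 1 n (approx x n) * trigSum 1 n (approx y n))))
                  (excess-addition (approx x n) (approx y n) n))
          (ℚP.≤-<-trans (∣excess∣≤ (sin≤ n (approx x n) (x≤B n)) (sin≤ n (approx y n) (y≤B n)) (n ℕ.* 2)) (proj₂ small n h))
          (subst (_< ε * ½) (sym (ℚP.∣-p∣≡∣p∣ (excess (cosTerm (approx x n)) (cosTerm (approx y n)) (n ℕ.* 2))))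
            (ℚP.≤-<-trans (∣excess∣≤ (cos≤ n (approx x n) (x≤B n)) (cos≤ n (approx y n) (y≤B n)) (n ℕ.* 2)) (proj₂ small n h)))
      where
      neg : ∀ a → (- 1ℚ) * a ≡ - a
      neg = solve 1 (λ a → (:- con 1ℚ) :* a := :- a) refl
        where open +-*-Solver
      xy : ∃ λ B → 0ℚ < B × (∀ n → ∣ approx x n ∣ ≤ B) × (∀ n → ∣ approx y n ∣ ≤ B)
      xy = common-bound x y
      B : ℚ
      B = proj₁ xy
      x≤B : ∀ n → ∣ approx x n ∣ ≤ B
      x≤B = proj₁ (proj₂ (proj₂ xy))
      y≤B : ∀ n → ∣ approx y n ∣ ≤ B
      y≤B = proj₂ (proj₂ (proj₂ xy))
      small : ∃ λ N → ∀ n → N ℕ.≤ n → excess (expTerm B) (expTerm B) (n ℕ.* 2) < ε * ½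
      small = excess-small (proj₁ (proj₂ xy)) (ε * ½) (half-pos 0<ε)
      sin≤ : ∀ (n : ℕ) z → ∣ z ∣ ≤ B → ∀ k → ∣ sinTerm z k ∣ ≤ expTerm B k
      sin≤ n z z≤B k = ∣*expTerm∣≤ {σ k} {z} {B} (∣σ∣≤1 k) z≤B k
      cos≤ : ∀ (n : ℕ) z → ∣ z ∣ ≤ B → ∀ k → ∣ cosTerm z k ∣ ≤ expTerm B k
      cos≤ n z z≤B k = ∣*expTerm∣≤ {γ k} {z} {B} (∣γ∣≤1 k) z≤B k

    -- All exponents 2k + p have the parity of p, so the exponent p alone decides the sign; c is 1
    -- for cosine and -1 for sine.
    trigSum-parity : ∀ p c → (∀ x → (- 1ℚ * x) ^ℚ p ≡ c * x ^ℚ p) →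
                     ∀ n x → trigSum p n (- 1ℚ * x) ≡ c * trigSum p n x
    trigSum-parity p c h zero    x = sym (ℚP.*-zeroʳ c)
    trigSum-parity p c h (suc n) x = trans
      (cong₂ (λ u v → u + (- 1ℚ) ^ℚ n * (v * 1/! (n ℕ.* 2 ℕ.+ p))) (trigSum-parity p c h n x) (parity-^ n))
      (solve 5 (λ c u s v r → c :* u :+ s :* (c :* v :* r) := c :* (u :+ s :* (v :* r))) refl
        c (trigSum p n x) ((- 1ℚ) ^ℚ n) (x ^ℚ (n ℕ.* 2 ℕ.+ p)) (1/! (n ℕ.* 2 ℕ.+ p)))
      where
      open +-*-Solver
      parity-^ : ∀ k → (- 1ℚ * x) ^ℚ (k ℕ.* 2 ℕ.+ p) ≡ c * x ^ℚ (k ℕ.* 2 ℕ.+ p)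
      parity-^ zero    = h x
      parity-^ (suc k) = trans (cong (λ z → - 1ℚ * x * (- 1ℚ * x * z)) (parity-^ k))
        (solve 3 (λ c x z → (:- con 1ℚ) :* x :* ((:- con 1ℚ) :* x :* (c :* z)) := c :* (x :* (x :* z))) refl
          c x (x ^ℚ (k ℕ.* 2 ℕ.+ p)))

    cos-neg : ∀ x → cos (-ℝ x) ≈ cos x
    cos-neg x = ≗⇒≈ {cos (-ℝ x)} {cos x} λ n →
      trans (trigSum-parity 0 1ℚ (λ _ → refl) n (approx x n)) (ℚP.*-identityˡ _)

    sin-neg : ∀ x → sin (-ℝ x) ≈ -ℝ sin x
    sin-neg x = ≗⇒≈ {sin (-ℝ x)} { -ℝ sin x} λ n →
      trigSum-parity 1 (- 1ℚ) (λ z → solve 1 (λ z → ((:- con 1ℚ) :* z) :* con 1ℚ := (:- con 1ℚ) :* (z :* con 1ℚ)) refl z) n (approx x n)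
      where open +-*-Solver

    cos-0 : cos (fromℚ 0ℚ) ≈ fromℚ 1ℚ
    -- Stage 0 is the empty sum, so the comparison with 1 starts at stage 1.
    cos-0 ε 0<ε = 1 , λ n h → subst (_< ε) (sym (trans (cong (λ z → ∣ z - 1ℚ ∣) (cosSum0 n h)) refl)) 0<ε
      where
      vanish : ∀ n → trigTerm 0 0ℚ (suc n) ≡ 0ℚ
      vanish n = trans (cong ((- 1ℚ) ^ℚ (suc n) *_)
                   (trans (cong (_* 1/! (suc n ℕ.* 2 ℕ.+ 0)) (ℚP.*-zeroˡ (0ℚ ^ℚ (suc (n ℕ.* 2 ℕ.+ 0)))))
                          (ℚP.*-zeroˡ (1/! (suc n ℕ.* 2 ℕ.+ 0)))))
                 (ℚP.*-zeroʳ ((- 1ℚ) ^ℚ (suc n)))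
      cosSum0 : ∀ n → 1 ℕ.≤ n → trigSum 0 n 0ℚ ≡ 1ℚ
      cosSum0 (suc zero)    _ = refl
      cosSum0 (suc (suc n)) _ = trans (cong₂ _+_ (cosSum0 (suc n) (ℕ.s≤s ℕ.z≤n)) (vanish n)) (ℚP.+-identityʳ 1ℚ)

-- Cosine at rational multiples of 2π: periodicity and separation from 1

module CosineOfTurns where

  open import Defs
  open import Data.Integer.Base as ℤ using (ℤ; +_; -[1+_])
  import Data.Integer.Properties as ℤP
  import Data.Integer.DivMod as ℤD
  import Data.Rational.Unnormalised.Base as ℚᵘ
  import Data.Rational.Unnormalised.Properties as ℚᵘP
  open import Data.Nat.Base as ℕ using (ℕ; zero; suc)
  import Data.Nat.Properties as ℕP
  open import Data.Product.Base using (∃; _×_; _,_)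
  open import Data.Rational.Base as ℚ using (ℚ; mkℚ; 0ℚ; 1ℚ; _+_; _*_; -_; _-_; _≤_; _<_; _/_)
  import Data.Rational.Properties as ℚP
  open import Data.Rational.Solver using (module +-*-Solver)
  open import Relation.Binary.PropositionalEquality using (_≡_; _≢_; refl; sym; trans; cong; cong₂; subst; subst₂)
  import Relation.Binary.Reasoning.Setoid as SetoidReasoning
  open Reals
  open Cosine

  open CauchyLemmas
  open ModℤLemmas

  abstract
    cos-≋ : ∀ {x y} → x ≋ y → cos x ≋ cos y
    cos-≋ {x} {y} x≋y = wrap (cos-cong {x} {y} (unwrap x≋y))

    cos-minus : ∀ x y → cos (x +ℝ (-ℝ y)) ≋ (cos x *ℝ cos y) +ℝ (sin x *ℝ sin y)
    cos-minus x y = begin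
      cos (x +ℝ (-ℝ y))                                            ≈⟨ wrap (cos-+ x (-ℝ y)) ⟩
      (cos x *ℝ cos (-ℝ y)) +ℝ (-ℝ (sin x *ℝ sin (-ℝ y)))
        ≈⟨ ℝ-Ring.+-cong (ℝ-Ring.*-congˡ (wrap (cos-neg y))) (ℝ-Ring.-‿cong (ℝ-Ring.*-congˡ (wrap (sin-neg y)))) ⟩
      (cos x *ℝ cos y) +ℝ (-ℝ (sin x *ℝ (-ℝ (sin y))))
        ≈⟨ ℝ-Ring.+-congˡ (pointwise λ n → neg-neg (approx (sin x) n) (approx (sin y) n)) ⟩
      (cos x *ℝ cos y) +ℝ (sin x *ℝ sin y)                         ∎
      where
      open SetoidReasoning ℝ-Ring.setoid
      neg-neg : ∀ a b → - 1ℚ * (a * (- 1ℚ * b)) ≡ a * b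
      neg-neg = solve 2 (λ a b → (:- con 1ℚ) :* (a :* ((:- con 1ℚ) :* b)) := a :* b) refl
        where open +-*-Solver

    cos+cos : ∀ x y → cos (x +ℝ y) +ℝ cos (x +ℝ (-ℝ y)) ≋ (cos x *ℝ cos y) +ℝ (cos x *ℝ cos y)
    cos+cos x y = begin
      cos (x +ℝ y) +ℝ cos (x +ℝ (-ℝ y))     ≈⟨ ℝ-Ring.+-cong (wrap (cos-+ x y)) (cos-minus x y) ⟩
      ((cos x *ℝ cos y) +ℝ (-ℝ (sin x *ℝ sin y))) +ℝ ((cos x *ℝ cos y) +ℝ (sin x *ℝ sin y))
        ≈⟨ pointwise (λ n → cancel (approx (cos x *ℝ cos y) n) (approx (sin x *ℝ sin y) n)) ⟩
      (cos x *ℝ cos y) +ℝ (cos x *ℝ cos y)  ∎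
      where
      open SetoidReasoning ℝ-Ring.setoid
      cancel : ∀ a b → (a + - 1ℚ * b) + (a + b) ≡ a + a
      cancel = solve 2 (λ a b → (a :+ (:- con 1ℚ) :* b) :+ (a :+ b) := a :+ a) refl
        where open +-*-Solver

    -- This form serves twice: y = π makes the sine terms vanish and gives the period, while y = x
    -- makes the left side 1 and leaves a squared sine.
    cos≋cos+sin : ∀ x y → cos (x +ℝ (-ℝ y)) ≋ cos (x +ℝ y) +ℝ ((sin x *ℝ sin y) +ℝ (sin x *ℝ sin y))
    cos≋cos+sin x y = begin
      cos (x +ℝ (-ℝ y))                     ≈⟨ cos-minus x y ⟩
      (cos x *ℝ cos y) +ℝ (sin x *ℝ sin y)
        ≈⟨ pointwise (λ n → cancel (approx (cos x *ℝ cos y) n) (approx (sin x *ℝ sin y) n)) ⟩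
      ((cos x *ℝ cos y) +ℝ (-ℝ (sin x *ℝ sin y))) +ℝ ((sin x *ℝ sin y) +ℝ (sin x *ℝ sin y))
        ≈⟨ ℝ-Ring.+-congʳ (wrap (cos-+ x y)) ⟨
      cos (x +ℝ y) +ℝ ((sin x *ℝ sin y) +ℝ (sin x *ℝ sin y)) ∎
      where
      open SetoidReasoning ℝ-Ring.setoid
      cancel : ∀ a b → a + b ≡ (a + - 1ℚ * b) + (b + b)
      cancel = solve 2 (λ a b → a :+ b := (a :+ (:- con 1ℚ) :* b) :+ (b :+ b)) refl
        where open +-*-Solver

  IsInteger : ℚ → Set
  IsInteger q = ∃ λ k → q ≡ fromℤ k

  abstract
    fromℤ-* : ∀ y z → fromℤ y * fromℤ z ≡ fromℤ (y ℤ.* z)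
    fromℤ-* y z = cong₂ _*_ (fromℤ≡mkℚ y) (fromℤ≡mkℚ z)

  fractional-part : ∀ q → (∀ k → q ≢ fromℤ k) → ∃ λ r → 0ℚ < r × r < 1ℚ × ∃ λ k → q ≡ r + fromℤ k
  fractional-part q@(mkℚ a b-1 _) q∉ℤ =
      + r / d , 0<r/d , r/d<1 , a ℤ./ℕ d , q≡
    where
    d r : ℕ
    d = suc b-1
    r = a ℤ.%ℕ d
    q≡ : q ≡ + r / d + fromℤ (a ℤ./ℕ d)
    q≡ = ℚP.toℚᵘ-injective (begin
      ℚᵘ.mkℚᵘ a b-1                                    ≈⟨ ℚᵘ.*≡* (trans (cong (ℤ._* + (d ℕ.* 1)) (ℤD.a≡a%ℕn+[a/ℕn]*n a d)) clear) ⟩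
      (+ r ℚᵘ./ d) ℚᵘ.+ (a ℤ./ℕ d ℚᵘ./ 1)              ≈⟨ ℚᵘP.+-cong (TrigLemmas.toℚᵘ-/ (+ r) d) (TrigLemmas.toℚᵘ-/ (a ℤ./ℕ d) 1) ⟨
      ℚ.toℚᵘ (+ r / d) ℚᵘ.+ ℚ.toℚᵘ (fromℤ (a ℤ./ℕ d))  ≈⟨ ℚP.toℚᵘ-homo-+ (+ r / d) (fromℤ (a ℤ./ℕ d)) ⟨
      ℚ.toℚᵘ (+ r / d + fromℤ (a ℤ./ℕ d))              ∎)
      where
      open ℚᵘP.≃-Reasoning
      clear : (+ r ℤ.+ a ℤ./ℕ d ℤ.* + d) ℤ.* + (d ℕ.* 1) ≡ (+ r ℤ.* + 1 ℤ.+ a ℤ./ℕ d ℤ.* + d) ℤ.* + d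
      clear = trans (cong (λ z → (+ r ℤ.+ a ℤ./ℕ d ℤ.* + d) ℤ.* + z) (ℕP.*-identityʳ d))
        (cong (λ z → (z ℤ.+ a ℤ./ℕ d ℤ.* + d) ℤ.* + d) (sym (ℤP.*-identityʳ (+ r))))
    r≢0 : r ≢ 0
    r≢0 r≡0 = q∉ℤ (a ℤ./ℕ d) (trans q≡ (trans (cong (λ z → + z / d + fromℤ (a ℤ./ℕ d)) r≡0)
      (trans (cong (_+ fromℤ (a ℤ./ℕ d)) (ℚP.0/n≡0 d)) (ℚP.+-identityˡ _))))
    0<r/d : 0ℚ < + r / d
    0<r/d = ℚP.positive⁻¹ (+ r / d) {{ℚP.normalize-pos r d {{ℕ.nonZero}} {{ℕ.≢-nonZero r≢0}}}}
    r/d<1 : + r / d < 1ℚ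
    r/d<1 = ℚP.toℚᵘ-cancel-< (ℚᵘP.<-respˡ-≃ (ℚᵘP.≃-sym (TrigLemmas.toℚᵘ-/ (+ r) d))
      (ℚᵘ.*<* (subst₂ ℤ._<_ (sym (ℤP.*-identityʳ (+ r))) (sym (ℤP.*-identityˡ (+ d))) (ℤ.+<+ (ℤD.n%ℕd<d a d)))))

  module _ {π : ℝ} (isPi : IsPi π) where

    open IsPi isPi

    cos2π : ℚ → ℝ
    cos2π q = cos (fromℚ (+ 2 / 1) *ℝ π *ℝ fromℚ q)

    abstract
      cos2π-0 : cos2π 0ℚ ≋ fromℚ 1ℚ
      cos2π-0 = ℝ-Ring.trans (cos-≋ (ℝ-Ring.zeroʳ (fromℚ (+ 2 / 1) *ℝ π))) (wrap cos-0)

      cos2π+cos2π : ∀ p q → cos2π (p + q) +ℝ cos2π (p - q) ≋ (cos2π p *ℝ cos2π q) +ℝ (cos2π p *ℝ cos2π q)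
      cos2π+cos2π p q = ℝ-Ring.trans
        (ℝ-Ring.+-cong
          (cos-≋ (pointwise λ n → ℚP.*-distribˡ-+ (approx 2π n) p q))
          (cos-≋ (pointwise λ n → minus (approx 2π n) p q)))
        (cos+cos x y)
        where
        2π x y : ℝ
        2π = fromℚ (+ 2 / 1) *ℝ π
        x = 2π *ℝ fromℚ p
        y = 2π *ℝ fromℚ q
        minus : ∀ a p q → a * (p - q) ≡ a * p + - 1ℚ * (a * q)
        minus = solve 3 (λ a p q → a :* (p :- q) := a :* p :+ (:- con 1ℚ) :* (a :* q)) refl
          where open +-*-Solver

      -- cos (x − π) − cos (x + π) = 2 sin x sin π = 0
      cos2π-+1 : ∀ q → cos2π (q + 1ℚ) ≋ cos2π q
      cos2π-+1 q = begin
        cos2π (q + 1ℚ)        ≈⟨ cos-≋ (pointwise λ n → plus (approx π n) q) ⟩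
        cos (x +ℝ π)      ≈⟨ ℝ-Ring.+-identityʳ (cos (x +ℝ π)) ⟨
        cos (x +ℝ π) +ℝ fromℚ 0ℚ ≈⟨ ℝ-Ring.+-congˡ sin²≋0 ⟨
        cos (x +ℝ π) +ℝ ((sin x *ℝ sin π) +ℝ (sin x *ℝ sin π)) ≈⟨ cos≋cos+sin x π ⟨
        cos (x +ℝ (-ℝ π)) ≈⟨ cos-≋ (pointwise λ n → minus (approx π n) q) ⟩
        cos2π q               ∎
        where
        open SetoidReasoning ℝ-Ring.setoid
        open +-*-Solver
        2π x : ℝ
        2π = fromℚ (+ 2 / 1) *ℝ π
        x = (2π *ℝ fromℚ q) +ℝ π
        plus : ∀ a q → (1ℚ + 1ℚ) * a * (q + 1ℚ) ≡ ((1ℚ + 1ℚ) * a * q + a) + a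
        plus = solve 2 (λ a q → (con 1ℚ :+ con 1ℚ) :* a :* (q :+ con 1ℚ) := ((con 1ℚ :+ con 1ℚ) :* a :* q :+ a) :+ a) refl
        minus : ∀ a q → ((1ℚ + 1ℚ) * a * q + a) + (- 1ℚ) * a ≡ (1ℚ + 1ℚ) * a * q
        minus = solve 2 (λ a q → ((con 1ℚ :+ con 1ℚ) :* a :* q :+ a) :+ (:- con 1ℚ) :* a := (con 1ℚ :+ con 1ℚ) :* a :* q) refl
        sin*0 : sin x *ℝ sin π ≋ fromℚ 0ℚ
        sin*0 = ℝ-Ring.trans (ℝ-Ring.*-congˡ (wrap sinπ)) (ℝ-Ring.zeroʳ (sin x))
        sin²≋0 : (sin x *ℝ sin π) +ℝ (sin x *ℝ sin π) ≋ fromℚ 0ℚ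
        sin²≋0 = ℝ-Ring.trans (ℝ-Ring.+-cong sin*0 sin*0) (ℝ-Ring.+-identityʳ (fromℚ 0ℚ))

      cos2π-+ℕ : ∀ q n → cos2π (q + fromℤ (+ n)) ≋ cos2π q
      cos2π-+ℕ q zero    = ℝ-Ring.reflexive (cong cos2π (ℚP.+-identityʳ q))
      cos2π-+ℕ q (suc n) = ℝ-Ring.trans
        (ℝ-Ring.reflexive (cong cos2π (trans
          (cong (λ z → q + fromℤ (+ z)) (ℕP.+-comm 1 n))
          (trans (cong (λ z → q + z) (sym (fromℤ-+ (+ n) (+ 1)))) (sym (ℚP.+-assoc q (fromℤ (+ n)) 1ℚ))))))
        (ℝ-Ring.trans (cos2π-+1 (q + fromℤ (+ n))) (cos2π-+ℕ q n))

      cos2π-periodic : ∀ q k → cos2π (q + fromℤ k) ≋ cos2π q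
      cos2π-periodic q (+ n)    = cos2π-+ℕ q n
      -- The ℕ case is read backwards, starting from q + k.
      cos2π-periodic q -[1+ n ] = ℝ-Ring.trans (ℝ-Ring.sym (cos2π-+ℕ (q + fromℤ -[1+ n ]) (suc n)))
        (ℝ-Ring.reflexive (cong cos2π (trans (ℚP.+-assoc q _ _)
          (trans (cong (λ z → q + z) (trans (fromℤ-+ -[1+ n ] (+ suc n)) (cong fromℤ (ℤP.+-inverseˡ (+ suc n))))) (ℚP.+-identityʳ q)))))

      -- `sin>0` asks for explicit gaps: if ε separates π from 0, then ε r separates π r from 0, and
      -- ε (1 - r) separates it from π.
      0<sin : ∀ r → 0ℚ < r → r < 1ℚ → fromℚ 0ℚ <ℝ sin (π *ℝ fromℚ r)
      0<sin r 0<r r<1 with π>0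
      ... | ε , 0<ε , N , p = sin>0 (π *ℝ fromℚ r)
          (ε * r , *-pos 0<ε 0<r , N , λ n h → subst (_< approx π n * r) (zero-+ ε r) (scale r 0<r n h))
          (ε * (1ℚ - r) , *-pos 0<ε 0<1-r , N , λ n h → begin-strict
            approx π n * r + ε * (1ℚ - r)                <⟨ ℚP.+-monoʳ-< (approx π n * r)
              (subst (_< approx π n * (1ℚ - r)) (cong (_* (1ℚ - r)) (ℚP.+-identityˡ ε)) (scale (1ℚ - r) 0<1-r n h)) ⟩
            approx π n * r + approx π n * (1ℚ - r)       ≡⟨ solve 2 (λ a r → a :* r :+ a :* (con 1ℚ :- r) := a) refl (approx π n) r ⟩
            approx π n                                   ∎)
        where
        open ℚP.≤-Reasoning
        open +-*-Solver
        0<1-r : 0ℚ < 1ℚ - r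
        0<1-r = subst (_< 1ℚ - r) (ℚP.+-inverseʳ r) (ℚP.+-monoˡ-< (- r) r<1)
        scale : ∀ r → 0ℚ < r → ∀ n → N ℕ.≤ n → (0ℚ + ε) * r < approx π n * r
        scale r 0<r n h = ℚP.*-monoˡ-<-pos r {{ℚ.positive 0<r}} (p n h)
        zero-+ : ∀ ε r → (0ℚ + ε) * r ≡ 0ℚ + ε * r
        zero-+ = solve 2 (λ ε r → (con 0ℚ :+ ε) :* r := con 0ℚ :+ ε :* r) refl

      cos2π+2sin² : ∀ r → let s = sin (π *ℝ fromℚ r) in fromℚ 1ℚ ≋ cos2π r +ℝ ((s *ℝ s) +ℝ (s *ℝ s))
      cos2π+2sin² r = begin
        fromℚ 1ℚ            ≈⟨ wrap cos-0 ⟨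
        cos (fromℚ 0ℚ)      ≈⟨ cos-≋ (ℝ-Ring.-‿inverseʳ x) ⟨
        cos (x +ℝ (-ℝ x))   ≈⟨ cos≋cos+sin x x ⟩
        cos (x +ℝ x) +ℝ ((sin x *ℝ sin x) +ℝ (sin x *ℝ sin x))
          ≈⟨ ℝ-Ring.+-congʳ (cos-≋ (pointwise λ n → double (approx π n) r)) ⟩
        cos2π r +ℝ ((sin x *ℝ sin x) +ℝ (sin x *ℝ sin x)) ∎
        where
        open SetoidReasoning ℝ-Ring.setoid
        x 2π : ℝ
        x = π *ℝ fromℚ r
        2π = fromℚ (+ 2 / 1) *ℝ π
        double : ∀ a r → a * r + a * r ≡ (1ℚ + 1ℚ) * a * r
        double = solve 2 (λ a r → a :* r :+ a :* r := (con 1ℚ :+ con 1ℚ) :* a :* r) refl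
          where open +-*-Solver

      -- 1 − cos 2πq = 2 sin² πq, which is positive for q ∉ ℤ.
      cos2π-cancel : ∀ q → (∀ k → q ≢ fromℤ k) → ∀ z →
                 z +ℝ z ≋ (z *ℝ cos2π q) +ℝ (z *ℝ cos2π q) → z ≋ fromℚ 0ℚ
      cos2π-cancel q q∉ℤ z h with fractional-part q q∉ℤ
      ... | r , 0<r , r<1 , k , refl =
          wrap (≈0-cancelʳ z four 0<4 (≈0-cancelʳ (z *ℝ four) s 0<s (≈0-cancelʳ ((z *ℝ four) *ℝ s) s 0<s (unwrap 4s²z≋0))))
        where
        open SetoidReasoning ℝ-Ring.setoid
        open +-*-Solver
        s four E : ℝ
        s = sin (π *ℝ fromℚ r)
        four = fromℚ (+ 4 / 1)
        E = cos2π r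
        0<s : fromℚ 0ℚ <ℝ s
        0<s = 0<sin r 0<r r<1
        0<4 : fromℚ 0ℚ <ℝ four
        0<4 = 1ℚ , 0<1 , 0 , λ _ _ → ℚ.*<* (ℤ.+<+ (ℕ.s≤s (ℕ.s≤s ℕ.z≤n)))
        split : ∀ z s e → z * (+ 4 / 1) * s * s ≡ (z * (e + (s * s + s * s)) + z * (e + (s * s + s * s))) + - 1ℚ * (z * e + z * e)
        split = solve 3 (λ z s e → z :* con (+ 4 / 1) :* s :* s := (z :* (e :+ (s :* s :+ s :* s)) :+ z :* (e :+ (s :* s :+ s :* s))) :+ (:- con 1ℚ) :* (z :* e :+ z :* e)) refl
        z*1 : z *ℝ (E +ℝ ((s *ℝ s) +ℝ (s *ℝ s))) ≋ z
        z*1 = ℝ-Ring.trans (ℝ-Ring.*-congˡ (ℝ-Ring.sym (cos2π+2sin² r))) (ℝ-Ring.*-identityʳ z)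
        4s²z≋0 : ((z *ℝ four) *ℝ s) *ℝ s ≋ fromℚ 0ℚ
        4s²z≋0 = begin
          ((z *ℝ four) *ℝ s) *ℝ s ≈⟨ pointwise (λ n → split (approx z n) (approx s n) (approx E n)) ⟩
          ((z *ℝ (E +ℝ ((s *ℝ s) +ℝ (s *ℝ s)))) +ℝ (z *ℝ (E +ℝ ((s *ℝ s) +ℝ (s *ℝ s))))) +ℝ (-ℝ ((z *ℝ E) +ℝ (z *ℝ E)))
            ≈⟨ ℝ-Ring.+-congʳ (ℝ-Ring.+-cong z*1 z*1) ⟩
          (z +ℝ z) +ℝ (-ℝ ((z *ℝ E) +ℝ (z *ℝ E)))
            ≈⟨ ℝ-Ring.+-congʳ (ℝ-Ring.trans h (ℝ-Ring.+-cong ze ze)) ⟩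
          ((z *ℝ E) +ℝ (z *ℝ E)) +ℝ (-ℝ ((z *ℝ E) +ℝ (z *ℝ E)))
            ≈⟨ ℝ-Ring.-‿inverseʳ ((z *ℝ E) +ℝ (z *ℝ E)) ⟩
          fromℚ 0ℚ ∎
          where
          ze : z *ℝ cos2π (r + fromℤ k) ≋ z *ℝ E
          ze = ℝ-Ring.*-congˡ (cos2π-periodic r k)

-- Determinants under operations on adjacent columns

module Determinant where

  open import Defs
  import Algebra.Definitions.RawSemiring as RawSemiringDefs
  import Algebra.Properties.CommutativeMonoid.Sum as CommutativeMonoidSum
  import Algebra.Properties.Semiring.Sum as SemiringSum
  open import Algebra.Bundles using (CommutativeMonoid)
  open import Data.Bool.Base using (if_then_else_)
  open import Data.Fin.Base using (Fin; zero; suc; punchIn; punchOut; toℕ)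
  import Data.Fin.Properties as FinP
  open import Data.Integer.Base as ℤ using (ℤ; 0ℤ; -1ℤ; _+_; _*_)
  import Data.Integer.Properties as ℤP
  open import Data.Integer.Solver using (module +-*-Solver)
  open import Data.Nat.Base using (zero; suc)
  open import Data.Product.Base using (∃₂; _×_; _,_)
  open import Data.Sum.Base using (_⊎_; inj₁; inj₂)
  open import Data.Vec.Functional using (Vector)
  open import Function.Base using (_∘_)
  open import Relation.Binary.PropositionalEquality using (_≡_; _≢_; refl; sym; trans; cong; cong₂; subst; module ≡-Reasoning)
  open import Relation.Nullary using (yes; no; does; contradiction)
  open import Relation.Nullary.Decidable using (dec-true; dec-false)

  open RawSemiringDefs ℤ.+-*-rawSemiring using (sum; _^_)
  private module Σℤ = SemiringSum ℤP.+-*-semiring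

  module _ {a ℓ} (M : CommutativeMonoid a ℓ) where
    private
      module M = CommutativeMonoid M
      module ΣM = CommutativeMonoidSum M

    sum-zero : ∀ {n} (f : Vector M.Carrier n) → (∀ k → f k M.≈ M.ε) → ΣM.sum f M.≈ M.ε
    sum-zero {n} f f≈0 = M.trans (ΣM.sum-cong-≋ f≈0) (ΣM.sum-replicate-zero n)

    sum-single : ∀ {n} (f : Vector M.Carrier n) j → (∀ k → k ≢ j → f k M.≈ M.ε) → ΣM.sum f M.≈ f j
    sum-single {suc n} f j f≈0 = M.trans (ΣM.sum-remove {n} {j} f)
      (M.trans (M.∙-congˡ (sum-zero _ λ k → f≈0 (punchIn j k) (FinP.punchInᵢ≢i j k))) (M.identityʳ (f j)))

  -- Alternation is proved for neighbouring columns only: deleting either of two equal neighbours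
  -- leaves the same minor, with opposite signs, whereas for distant columns the minors would differ
  -- by a permutation.
  data Adjacent : ∀ {n} → Fin n → Fin n → Set where
    here  : ∀ {n} → Adjacent {suc (suc n)} zero (suc zero)
    there : ∀ {n} {j l : Fin n} → Adjacent j l → Adjacent (suc j) (suc l)

  adjacent-≢ : ∀ {n} {j l : Fin n} → Adjacent j l → j ≢ l
  adjacent-≢ (there a) eq = adjacent-≢ a (FinP.suc-injective eq)

  adjacent-toℕ : ∀ {n} {j l : Fin n} → Adjacent j l → toℕ l ≡ suc (toℕ j)
  adjacent-toℕ here      = refl
  adjacent-toℕ (there a) = cong suc (adjacent-toℕ a)

  -- No index lies between adjacent ones, so deleting a third column keeps the pair adjacent and the
  -- induction hypothesis applies to the minor.
  adjacent-minor : ∀ {n} {j l : Fin (suc n)} → Adjacent j l → ∀ k → k ≢ j → k ≢ l →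
    ∃₂ λ j′ l′ → Adjacent j′ l′ × punchIn k j′ ≡ j × punchIn k l′ ≡ l
  adjacent-minor here zero k≢j _ = contradiction refl k≢j
  adjacent-minor here (suc zero) _ k≢l = contradiction refl k≢l
  adjacent-minor {suc (suc n)} here (suc (suc k)) _ _ = zero , suc zero , here , refl , refl
  adjacent-minor (there a) zero _ _ = _ , _ , a , refl , refl
  adjacent-minor {suc n} (there a) (suc k) k≢j k≢l with adjacent-minor a k (k≢j ∘ cong suc) (k≢l ∘ cong suc)
  ... | j′ , l′ , a′ , refl , refl = suc j′ , suc l′ , there a′ , refl , refl

  -- Deleting j or l leaves the same list of columns except at one place, which holds the surviving
  -- member of the pair.
  punchIn-adjacent : ∀ {n} {j l : Fin (suc n)} → Adjacent j l → ∀ k →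
    punchIn j k ≡ punchIn l k ⊎ (punchIn j k ≡ l × punchIn l k ≡ j)
  punchIn-adjacent here zero    = inj₂ (refl , refl)
  punchIn-adjacent here (suc k) = inj₁ refl
  punchIn-adjacent (there a) zero = inj₁ refl
  punchIn-adjacent (there a) (suc k) with punchIn-adjacent a k
  ... | inj₁ eq        = inj₁ (cong suc eq)
  ... | inj₂ (p , q)   = inj₂ (cong suc p , cong suc q)

  sum-adjacent-cancel : ∀ {n} {j l : Fin n} (f : Vector ℤ n) → Adjacent j l →
    (∀ k → k ≢ j → k ≢ l → f k ≡ 0ℤ) → f j + f l ≡ 0ℤ → sum f ≡ 0ℤ
  sum-adjacent-cancel f here f≡0 cancel = trans (sym (ℤP.+-assoc (f zero) _ _))
    (trans (cong₂ _+_ cancel (sum-zero ℤP.+-0-commutativeMonoid _ λ k → f≡0 (suc (suc k)) (λ ()) (λ ()))) refl)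
  sum-adjacent-cancel f (there a) f≡0 cancel = cong₂ _+_ (f≡0 zero (λ ()) (λ ()))
    (sum-adjacent-cancel (f ∘ suc) a
      (λ k k≢j k≢l → f≡0 (suc k) (k≢j ∘ FinP.suc-injective) (k≢l ∘ FinP.suc-injective)) cancel)

  minor : ∀ {d} → Matrix (suc d) → Fin (suc d) → Matrix d
  minor A j i k = A (suc i) (punchIn j k)

  det-cong : ∀ {d} {A B : Matrix d} → (∀ i j → A i j ≡ B i j) → det A ≡ det B
  det-cong {zero}  A≡B = refl
  det-cong {suc d} A≡B = Σℤ.sum-cong-≋ λ j →
    cong₂ _*_ (cong (-1ℤ ^ toℕ j *_) (A≡B zero j)) (det-cong λ i k → A≡B (suc i) (punchIn j k))

  -- In the expansion term of column j the entry splits and the minor is common; in every other term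
  -- the entry is common and the minor is linear by induction.
  det-linear : ∀ {d} (j : Fin d) (q : ℤ) {A B C : Matrix d} →
    (∀ i k → k ≢ j → C i k ≡ A i k) → (∀ i k → k ≢ j → C i k ≡ B i k) →
    (∀ i → C i j ≡ A i j + q * B i j) → det C ≡ det A + q * det B
  det-linear {suc d} j q {A} {B} {C} C≡A C≡B Cj = begin
    sum (term C)                                   ≡⟨ Σℤ.sum-cong-≋ term-linear ⟩
    sum (λ k → term A k + q * term B k)            ≡⟨ Σℤ.∑-distrib-+ (term A) (λ k → q * term B k) ⟩
    sum (term A) + sum (λ k → q * term B k)        ≡⟨ cong (sum (term A) +_) (sym (Σℤ.*-distribˡ-sum q (term B))) ⟩
    sum (term A) + q * sum (term B)                ∎
    where
    open ≡-Reasoning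
    open +-*-Solver
    term : Matrix (suc d) → Fin (suc d) → ℤ
    term X k = -1ℤ ^ toℕ k * X zero k * det (minor X k)
    term-linear : ∀ k → term C k ≡ term A k + q * term B k
    term-linear k with k FinP.≟ j
    ... | yes refl = begin
      -1ℤ ^ toℕ j * C zero j * det (minor C j)
        ≡⟨ cong₂ (λ u v → -1ℤ ^ toℕ j * u * v) (Cj zero) (det-cong λ i l → C≡A (suc i) (punchIn j l) (FinP.punchInᵢ≢i j l)) ⟩
      -1ℤ ^ toℕ j * (A zero j + q * B zero j) * det (minor A j)
        ≡⟨ solve 5 (λ s a q b m → s :* (a :+ q :* b) :* m := s :* a :* m :+ q :* (s :* b :* m)) refl
             (-1ℤ ^ toℕ j) (A zero j) q (B zero j) (det (minor A j)) ⟩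
      term A j + q * (-1ℤ ^ toℕ j * B zero j * det (minor A j))
        ≡⟨ cong (λ z → term A j + q * (-1ℤ ^ toℕ j * B zero j * z))
             (det-cong λ i l → trans (sym (C≡A (suc i) (punchIn j l) (FinP.punchInᵢ≢i j l))) (C≡B (suc i) (punchIn j l) (FinP.punchInᵢ≢i j l))) ⟩
      term A j + q * term B j ∎
    ... | no k≢j = begin
      -1ℤ ^ toℕ k * C zero k * det (minor C k)
        ≡⟨ cong (-1ℤ ^ toℕ k * C zero k *_) (det-linear (punchOut k≢j) q
             (λ i l l≢ → C≡A (suc i) (punchIn k l) (off l l≢)) (λ i l l≢ → C≡B (suc i) (punchIn k l) (off l l≢))
             (λ i → subst (λ m → C (suc i) m ≡ A (suc i) m + q * B (suc i) m) (sym (FinP.punchIn-punchOut k≢j)) (Cj (suc i)))) ⟩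
      -1ℤ ^ toℕ k * C zero k * (det (minor A k) + q * det (minor B k))
        ≡⟨ solve 5 (λ s c a q b → s :* c :* (a :+ q :* b) := s :* c :* a :+ q :* (s :* c :* b)) refl
             (-1ℤ ^ toℕ k) (C zero k) (det (minor A k)) q (det (minor B k)) ⟩
      -1ℤ ^ toℕ k * C zero k * det (minor A k) + q * (-1ℤ ^ toℕ k * C zero k * det (minor B k))
        ≡⟨ cong₂ (λ a b → -1ℤ ^ toℕ k * a * det (minor A k) + q * (-1ℤ ^ toℕ k * b * det (minor B k))) (C≡A zero k k≢j) (C≡B zero k k≢j) ⟩
      term A k + q * term B k ∎
      where
      off : ∀ l → l ≢ punchOut k≢j → punchIn k l ≢ j
      off l l≢ eq = l≢ (FinP.punchIn-injective k l _ (trans eq (sym (FinP.punchIn-punchOut k≢j))))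

  det-alternating : ∀ {d} {j l : Fin d} {A : Matrix d} → Adjacent j l → (∀ i → A i j ≡ A i l) → det A ≡ 0ℤ
  det-alternating {suc d} {j} {l} {A} adj Aj≡Al = sum-adjacent-cancel term adj vanish cancel
    where
    open +-*-Solver
    term : Fin (suc d) → ℤ
    term k = -1ℤ ^ toℕ k * A zero k * det (minor A k)
    vanish : ∀ k → k ≢ j → k ≢ l → term k ≡ 0ℤ
    vanish k k≢j k≢l with adjacent-minor adj k k≢j k≢l
    ... | j′ , l′ , adj′ , refl , refl =
      trans (cong (-1ℤ ^ toℕ k * A zero k *_) (det-alternating adj′ (Aj≡Al ∘ suc))) (ℤP.*-zeroʳ (-1ℤ ^ toℕ k * A zero k))
    minors≡ : ∀ i k → minor A l i k ≡ minor A j i k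
    minors≡ i k with punchIn-adjacent adj k
    ... | inj₁ eq = cong (A (suc i)) (sym eq)
    ... | inj₂ (p , q) = trans (cong (A (suc i)) q) (trans (Aj≡Al (suc i)) (cong (A (suc i)) (sym p)))
    cancel : term j + term l ≡ 0ℤ
    cancel = trans (cong (term j +_) (cong₂ _*_ (cong₂ _*_ (cong (-1ℤ ^_) (adjacent-toℕ adj)) (sym (Aj≡Al zero))) (det-cong minors≡)))
      (solve 3 (λ s a m → s :* a :* m :+ (con -1ℤ :* s) :* a :* m := con 0ℤ) refl
        (-1ℤ ^ toℕ j) (A zero j) (det (minor A j)))

  -- Column j receives q times column l.
  shear : ∀ {r c} → (Fin r → Fin c → ℤ) → Fin c → Fin c → ℤ → Fin r → Fin c → ℤ
  shear A j l q i k = if does (k FinP.≟ j) then A i j + q * A i l else A i k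

  shear-at : ∀ {r c} (A : Fin r → Fin c → ℤ) j l q i → shear A j l q i j ≡ A i j + q * A i l
  shear-at A j l q i rewrite dec-true (j FinP.≟ j) refl = refl

  shear-off : ∀ {r c} (A : Fin r → Fin c → ℤ) j l q i {k} → k ≢ j → shear A j l q i k ≡ A i k
  shear-off A j l q i {k} k≢j rewrite dec-false (k FinP.≟ j) k≢j = refl

  -- By linearity in column j, the determinant changes by q times that of a matrix in which column l
  -- stands twice.
  det-shear : ∀ {d} (A : Matrix d) {j l} q → Adjacent j l ⊎ Adjacent l j → det (shear A j l q) ≡ det A
  det-shear A {j} {l} q adj = begin
    det (shear A j l q)     ≡⟨ det-linear j q {A} {B} (λ i k → shear-off A j l q i)
                                 (λ i k k≢j → trans (shear-off A j l q i k≢j) (sym (B-off i k k≢j)))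
                                 (λ i → trans (shear-at A j l q i) (cong (λ z → A i j + q * z) (sym (B-at i)))) ⟩
    det A + q * det B       ≡⟨ cong (λ z → det A + q * z) (det-B adj) ⟩
    det A + q * 0ℤ          ≡⟨ cong (λ z → det A + z) (ℤP.*-zeroʳ q) ⟩
    det A + 0ℤ              ≡⟨ ℤP.+-identityʳ (det A) ⟩
    det A                   ∎
    where
    open ≡-Reasoning
    B : Matrix _
    B i k = if does (k FinP.≟ j) then A i l else A i k
    B-at : ∀ i → B i j ≡ A i l
    B-at i rewrite dec-true (j FinP.≟ j) refl = refl
    B-off : ∀ i k → k ≢ j → B i k ≡ A i k
    B-off i k k≢j rewrite dec-false (k FinP.≟ j) k≢j = refl
    det-B : Adjacent j l ⊎ Adjacent l j → det B ≡ 0ℤ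
    det-B (inj₁ a) = det-alternating a λ i → trans (B-at i) (sym (B-off i l (adjacent-≢ a ∘ sym)))
    det-B (inj₂ a) = det-alternating a λ i → trans (B-off i l (adjacent-≢ a)) (sym (B-at i))

  det-block : ∀ {d} (A : Matrix (suc d)) → (∀ k → A zero (suc k) ≡ 0ℤ) →
              det A ≡ A zero zero * det (minor A zero)
  det-block A row≡0 = trans (sum-single ℤP.+-0-commutativeMonoid _ zero vanish)
    (cong (_* det (minor A zero)) (ℤP.*-identityˡ (A zero zero)))
    where
    vanish : ∀ k → k ≢ zero → -1ℤ ^ toℕ k * A zero k * det (minor A k) ≡ 0ℤ
    vanish zero    k≢0 = contradiction refl k≢0
    vanish (suc k) _ = cong (_* det (minor A (suc k)))
      (trans (cong (-1ℤ ^ toℕ (suc k) *_) (row≡0 k)) (ℤP.*-zeroʳ (-1ℤ ^ toℕ (suc k))))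

-- Clearing the first row by the Euclidean algorithm on columns

module ColumnReduction where

  open import Defs
  import Algebra.Definitions.RawSemiring as RawSemiringDefs
  import Algebra.Properties.Semiring.Sum as SemiringSum
  open import Data.Bool.Base using (if_then_else_)
  open import Data.Fin.Base using (Fin; zero; suc; toℕ; fromℕ<)
  import Data.Fin.Properties as FinP
  open import Data.Integer.Base as ℤ using (ℤ; 0ℤ; 1ℤ; -1ℤ; _+_; _*_; -_)
  import Data.Integer.Properties as ℤP
  import Data.Integer.DivMod as ℤD
  open import Data.Integer.Solver using (module +-*-Solver)
  open import Data.Nat.Base as ℕ using (ℕ; zero; suc)
  import Data.Nat.Properties as ℕP
  open import Data.Product.Base using (∃; _×_; _,_; proj₁; proj₂)
  open import Data.Sum.Base using (_⊎_; inj₁; inj₂)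
  open import Data.Vec.Functional using (Vector)
  open import Function.Base using (_∘_)
  open import Relation.Binary.PropositionalEquality using (_≡_; _≢_; refl; sym; trans; cong; cong₂; subst; module ≡-Reasoning)
  open import Relation.Nullary using (yes; no; does; contradiction)
  open import Relation.Nullary.Decidable using (dec-true; dec-false)
  open Determinant

  open RawSemiringDefs ℤ.+-*-rawSemiring using (sum)
  private module Σℤ = SemiringSum ℤP.+-*-semiring

  column : ∀ {d} → Matrix d → Fin d → Vector ℤ d
  column A j i = A i j

  image-resp : ∀ {d} {A : Matrix d} {x y} → (∀ i → x i ≡ y i) → InImage A x → InImage A y
  image-resp x≡y (z , p) = z , λ i → trans (sym (x≡y i)) (p i)

  column∈image : ∀ {d} (A : Matrix d) j → InImage A (column A j)
  column∈image A j = δ , λ i → sym (trans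
      (sum-single ℤP.+-0-commutativeMonoid (λ k → A i k * δ k) j λ k k≢j → trans (cong (A i k *_) (δ-off k k≢j)) (ℤP.*-zeroʳ (A i k)))
      (trans (cong (A i j *_) δ-at) (ℤP.*-identityʳ (A i j))))
    where
    δ : Vector ℤ _
    δ k = if does (k FinP.≟ j) then 1ℤ else 0ℤ
    δ-at : δ j ≡ 1ℤ
    δ-at rewrite dec-true (j FinP.≟ j) refl = refl
    δ-off : ∀ k → k ≢ j → δ k ≡ 0ℤ
    δ-off k k≢j rewrite dec-false (k FinP.≟ j) k≢j = refl

  image-+* : ∀ {d} {A : Matrix d} {x y} q → InImage A x → InImage A y → InImage A (λ i → x i + q * y i)
  image-+* {A = A} {x} {y} q (z , p) (w , r) = (λ k → z k + q * w k) , λ i → begin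
      x i + q * y i
        ≡⟨ cong₂ (λ u v → u + q * v) (p i) (r i) ⟩
      sum (λ k → A i k * z k) + q * sum (λ k → A i k * w k)
        ≡⟨ cong (sum (λ k → A i k * z k) +_) (Σℤ.*-distribˡ-sum q (λ k → A i k * w k)) ⟩
      sum (λ k → A i k * z k) + sum (λ k → q * (A i k * w k))
        ≡⟨ sym (Σℤ.∑-distrib-+ (λ k → A i k * z k) (λ k → q * (A i k * w k))) ⟩
      sum (λ k → A i k * z k + q * (A i k * w k))
        ≡⟨ Σℤ.sum-cong-≋ (λ k → solve 4 (λ a z q w → a :* z :+ q :* (a :* w) := a :* (z :+ q :* w)) refl (A i k) (z k) q (w k)) ⟩
      sum (λ k → A i k * (z k + q * w k)) ∎
    where
    open ≡-Reasoning
    open +-*-Solver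

  image-⊆ : ∀ {d} {A B : Matrix d} → (∀ j → InImage A (column B j)) → ∀ {x} → InImage B x → InImage A x
  image-⊆ {A = A} {B} B⊆A {x} (z , p) = (λ k → sum λ j → W j k * z j) , λ i → begin
      x i                                                ≡⟨ p i ⟩
      sum (λ j → B i j * z j)                            ≡⟨ Σℤ.sum-cong-≋ (λ j → cong (_* z j) (proj₂ (B⊆A j) i)) ⟩
      sum (λ j → sum (λ k → A i k * W j k) * z j)        ≡⟨ Σℤ.sum-cong-≋ (λ j → trans (Σℤ.*-distribʳ-sum (z j) (λ k → A i k * W j k))
                                                             (Σℤ.sum-cong-≋ λ k → ℤP.*-assoc (A i k) (W j k) (z j))) ⟩
      sum (λ j → sum (λ k → A i k * (W j k * z j)))      ≡⟨ Σℤ.∑-comm (λ j k → A i k * (W j k * z j)) ⟩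
      sum (λ k → sum (λ j → A i k * (W j k * z j)))      ≡⟨ Σℤ.sum-cong-≋ (λ k → sym (Σℤ.*-distribˡ-sum (A i k) (λ j → W j k * z j))) ⟩
      sum (λ k → A i k * sum (λ j → W j k * z j))        ∎
    where
    open ≡-Reasoning
    W : Fin _ → Vector ℤ _
    W j = proj₁ (B⊆A j)

  infix 4 _~_
  -- Column equivalence is recorded by its invariants, without the unimodular matrix that effects
  -- it. The two inclusions of images also give those of the duals, by `dual-~`.
  record _~_ {d} (A B : Matrix d) : Set where
    field
      det≡ : det B ≡ det A
      B⊆A  : ∀ {x} → InImage B x → InImage A x
      A⊆B  : ∀ {x} → InImage A x → InImage B x

  open _~_ public

  ~-refl : ∀ {d} {A : Matrix d} → A ~ A
  ~-refl = record { det≡ = refl ; B⊆A = λ p → p ; A⊆B = λ p → p }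

  ~-sym : ∀ {d} {A B : Matrix d} → A ~ B → B ~ A
  ~-sym p = record { det≡ = sym (det≡ p) ; B⊆A = A⊆B p ; A⊆B = B⊆A p }

  ~-trans : ∀ {d} {A B C : Matrix d} → A ~ B → B ~ C → A ~ C
  ~-trans p q = record { det≡ = trans (det≡ q) (det≡ p) ; B⊆A = B⊆A p ∘ B⊆A q ; A⊆B = A⊆B q ∘ A⊆B p }

  -- The shear by - q undoes the shear by q, so the columns of either matrix are integer
  -- combinations of those of the other.
  ~-shear : ∀ {d} (A : Matrix d) {j l} q → Adjacent j l ⊎ Adjacent l j → A ~ shear A j l q
  ~-shear A {j} {l} q adj = record
      { det≡ = det-shear A q adj
      ; B⊆A  = image-⊆ {A = A} {B} B-columns
      ; A⊆B  = image-⊆ {A = B} {A} A-columns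
      }
    where
    open +-*-Solver
    B : Matrix _
    B = shear A j l q
    l≢j : Adjacent j l ⊎ Adjacent l j → l ≢ j
    l≢j (inj₁ a) = adjacent-≢ a ∘ sym
    l≢j (inj₂ a) = adjacent-≢ a
    B-columns : ∀ k → InImage A (column B k)
    B-columns k with k FinP.≟ j
    ... | yes refl = image-+* {A = A} q (column∈image A j) (column∈image A l)
    ... | no  k≢j  = column∈image A k
    A-columns : ∀ k → InImage B (column A k)
    A-columns k with k FinP.≟ j
    ... | no  k≢j  = image-resp {A = B} (λ i → shear-off A j l q i k≢j) (column∈image B k)
    ... | yes refl = image-resp {A = B}
      (λ i → trans (cong₂ (λ u v → u + - q * v) (shear-at A j l q i) (shear-off A j l q i (l≢j adj)))
                   (solve 3 (λ a q b → (a :+ q :* b) :+ (:- q) :* b := a) refl (A i j) q (A i l)))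
      (image-+* {A = B} (- q) (column∈image B j) (column∈image B l))

  -- With r = a mod b, the pair (a , b) becomes (r + b , - r): unlike a swap of
  -- columns this leaves the determinant unchanged, sign included.
  euclid : ∀ {d} n (A : Matrix (suc d)) {j l} → Adjacent j l → ℤ.∣ A zero l ∣ ℕ.≤ n →
    ∃ λ B → A ~ B × B zero l ≡ 0ℤ × (∀ k → k ≢ j → k ≢ l → B zero k ≡ A zero k)
  euclid n A {j} {l} adj ≤n with A zero l ℤP.≟ 0ℤ
  ... | yes Al≡0 = A , ~-refl , Al≡0 , λ _ _ _ → refl
  ... | no  Al≢0 with n
  ...   | zero  = contradiction (ℤP.∣i∣≡0⇒i≡0 (ℕP.n≤0⇒n≡0 ≤n)) Al≢0
  ...   | suc m = step
    where
    open +-*-Solver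
    a b q : ℤ
    a = A zero j
    b = A zero l
    instance
      b-nonZero : ℤ.NonZero b
      b-nonZero = ℤ.≢-nonZero Al≢0
    q = a ℤ./ b
    r : ℕ
    r = a ℤ.% b
    A₁ A₂ : Matrix _
    A₁ = shear A j l (1ℤ + - q)
    A₂ = shear A₁ l j -1ℤ
    l≢j : l ≢ j
    l≢j = adjacent-≢ adj ∘ sym
    A₂l : A₂ zero l ≡ - (ℤ.+ r)
    A₂l = trans (shear-at A₁ l j -1ℤ zero)
      (trans (cong₂ (λ u v → u + -1ℤ * v) (shear-off A j l (1ℤ + - q) zero l≢j) (shear-at A j l (1ℤ + - q) zero))
      (trans (cong (λ z → b + -1ℤ * (z + (1ℤ + - q) * b)) (ℤD.a≡a%n+[a/n]*n a b))
        (solve 3 (λ r q b → b :+ con -1ℤ :* ((r :+ q :* b) :+ (con 1ℤ :+ :- q) :* b) := :- r) refl (ℤ.+ r) q b)))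
    decrease : ℤ.∣ A₂ zero l ∣ ℕ.≤ m
    decrease = ℕP.≤-pred (ℕP.≤-trans
      (subst (λ z → suc z ℕ.≤ ℤ.∣ b ∣) (sym (trans (cong ℤ.∣_∣ A₂l) (ℤP.∣-i∣≡∣i∣ (ℤ.+ r)))) (ℤD.n%d<d a b)) ≤n)
    step : ∃ λ B → A ~ B × B zero l ≡ 0ℤ × (∀ k → k ≢ j → k ≢ l → B zero k ≡ A zero k)
    step with euclid m A₂ adj decrease
    ... | B , A₂~B , Bl≡0 , rest = B ,
      ~-trans (~-trans (~-shear A (1ℤ + - q) (inj₁ adj)) (~-shear A₁ -1ℤ (inj₂ adj))) A₂~B , Bl≡0 ,
      λ k k≢j k≢l → trans (rest k k≢j k≢l)
        (trans (shear-off A₁ l j -1ℤ zero k≢l) (shear-off A j l (1ℤ + - q) zero k≢j))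

  predecessor : ∀ {n} (l : Fin (suc n)) → l ≢ zero → ∃ λ j → Adjacent j l
  predecessor {n}     zero    l≢0 = contradiction refl l≢0
  predecessor {suc n} (suc zero) _ = zero , here
  predecessor {suc n} (suc (suc l)) _ with predecessor (suc l) (λ ())
  ... | j , a = suc j , there a

  -- The row is cleared from the right, each entry being absorbed by its left neighbour; t bounds
  -- the positions of the entries that may still be nonzero.
  clear-row : ∀ {d} t (A : Matrix (suc d)) → (∀ k → t ℕ.< toℕ k → A zero k ≡ 0ℤ) →
    ∃ λ B → A ~ B × (∀ k → B zero (suc k) ≡ 0ℤ)
  clear-row zero A A≡0 = A , ~-refl , λ k → A≡0 (suc k) (ℕ.s≤s ℕ.z≤n)
  clear-row {d} (suc t) A A≡0 with suc t ℕP.≤? d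
  ... | no t≰d = clear-row t A λ k t<k → contradiction (ℕP.≤-trans t<k (FinP.toℕ≤pred[n] k)) t≰d
  ... | yes t≤d with predecessor (fromℕ< (ℕ.s≤s t≤d)) (λ ())
  ...   | j , adj with euclid ℤ.∣ A zero _ ∣ A adj ℕP.≤-refl
  ...     | B , A~B , Bl≡0 , rest = let C , B~C , C≡0 = clear-row t B B≡0 in C , ~-trans A~B B~C , C≡0
    where
    l : Fin (suc d)
    l = fromℕ< (ℕ.s≤s t≤d)
    toℕ-l : toℕ l ≡ suc t
    toℕ-l = FinP.toℕ-fromℕ< (ℕ.s≤s t≤d)
    B≡0 : ∀ k → t ℕ.< toℕ k → B zero k ≡ 0ℤ
    B≡0 k t<k with k FinP.≟ l
    ... | yes refl = Bl≡0
    ... | no  k≢l  = trans (rest k k≢j k≢l) (A≡0 k (ℕP.≤∧≢⇒< t<k λ eq → k≢l (FinP.toℕ-injective (trans (sym eq) (sym toℕ-l)))))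
      where
      -- Column j, which the Euclidean step alters, has index t, and only the columns beyond t must
      -- be zero.
      k≢j : k ≢ j
      k≢j refl = ℕP.<-irrefl (ℕP.suc-injective (trans (sym toℕ-l) (adjacent-toℕ adj))) t<k

  reduce : ∀ {d} (A : Matrix (suc d)) → ∃ λ B → A ~ B × (∀ k → B zero (suc k) ≡ 0ℤ)
  reduce {d} A = clear-row d A λ k d<k → contradiction (FinP.toℕ≤pred[n] k) (ℕP.<⇒≱ d<k)

-- Order of the dual group and separation of vectors outside the image

module DualLattices where

  open import Defs
  import Algebra.Properties.Semiring.Sum as SemiringSum
  open import Algebra.Bundles using (CommutativeRing)
  open import Data.Fin.Base using (Fin; zero; suc; toℕ; fromℕ<; remQuot; combine)
  import Data.Fin.Properties as FinP
  open import Data.Integer.Base as ℤ using (ℤ; +_; 0ℤ; 1ℤ)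
  import Data.Integer.Properties as ℤP
  import Data.Integer.DivMod as ℤD
  import Data.Integer.Solver as ℤSolver
  open import Data.Nat.Base as ℕ using (ℕ; zero; suc)
  import Data.Nat.Properties as ℕP
  open import Data.Product.Base using (∃; _×_; _,_; proj₁; proj₂)
  open import Data.Rational.Base as ℚ using (ℚ; 0ℚ; 1ℚ; _+_; _*_; -_; _-_)
  import Data.Rational.Properties as ℚP
  open import Data.Rational.Solver using (module +-*-Solver)
  open import Data.Sum.Base using (_⊎_; inj₁; inj₂)
  open import Data.Vec.Functional using (Vector; _∷_)
  open import Function.Base using (_∘_)
  open import Function.Bundles using (Inverse)
  open import Level using (0ℓ)
  open import Relation.Binary.Bundles using (Setoid)
  open import Relation.Binary.PropositionalEquality using (_≡_; _≢_; refl; sym; trans; cong; cong₂; subst; module ≡-Reasoning)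
  open import Relation.Nullary using (yes; no; contradiction)
  open Determinant
  open ColumnReduction
  open CosineOfTurns using (IsInteger; fromℤ-*)

  open ModℤLemmas

  private
    module Σℤ = SemiringSum ℤP.+-*-semiring
    module Σℚ = SemiringSum (CommutativeRing.semiring ℚP.+-*-commutativeRing)

  fromℤ-injective : ∀ {y z} → fromℤ y ≡ fromℤ z → y ≡ z
  fromℤ-injective {y} {z} eq = cong ℚ.↥_ (trans (sym (fromℤ≡mkℚ y)) (trans eq (fromℤ≡mkℚ z)))

  fromℤ-sum : ∀ {n} (f : Vector ℤ n) → Σℚ.sum (λ i → fromℤ (f i)) ≡ fromℤ (Σℤ.sum f)
  fromℤ-sum {zero}  f = refl
  fromℤ-sum {suc n} f = trans (cong (λ z → fromℤ (f zero) + z) (fromℤ-sum (f ∘ suc))) (fromℤ-+ (f zero) _)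

  dot : ∀ {d} → Vector ℤ d → Vector ℚ d → ℚ
  dot x ξ = Σℚ.sum λ i → fromℤ (x i) * ξ i

  abstract
    dot-+ʳ : ∀ {d} (x : Vector ℤ d) ξ η → dot x (λ i → ξ i + η i) ≡ dot x ξ + dot x η
    dot-+ʳ x ξ η = trans (Σℚ.sum-cong-≋ λ i → ℚP.*-distribˡ-+ (fromℤ (x i)) (ξ i) (η i))
      (Σℚ.∑-distrib-+ (λ i → fromℤ (x i) * ξ i) (λ i → fromℤ (x i) * η i))

    dot-*ʳ : ∀ {d} (x : Vector ℤ d) c ξ → dot x (λ i → c * ξ i) ≡ c * dot x ξ
    dot-*ʳ x c ξ = trans
      (Σℚ.sum-cong-≋ λ i → solve 3 (λ a c b → a :* (c :* b) := c :* (a :* b)) refl (fromℤ (x i)) c (ξ i))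
      (sym (Σℚ.*-distribˡ-sum c (λ i → fromℤ (x i) * ξ i)))
      where open +-*-Solver

    dot-+*ˡ : ∀ {d} (x y : Vector ℤ d) q ξ → dot (λ i → x i ℤ.+ q ℤ.* y i) ξ ≡ dot x ξ + fromℤ q * dot y ξ
    dot-+*ˡ x y q ξ = begin
      dot (λ i → x i ℤ.+ q ℤ.* y i) ξ
        ≡⟨ Σℚ.sum-cong-≋ (λ i → cong (_* ξ i) (sym (trans (cong (λ z → fromℤ (x i) + z) (fromℤ-* q (y i))) (fromℤ-+ (x i) (q ℤ.* y i))))) ⟩
      Σℚ.sum (λ i → (fromℤ (x i) + fromℤ q * fromℤ (y i)) * ξ i)
        ≡⟨ Σℚ.sum-cong-≋ (λ i → solve 4 (λ x q y ξ → (x :+ q :* y) :* ξ := x :* ξ :+ q :* (y :* ξ)) refl (fromℤ (x i)) (fromℤ q) (fromℤ (y i)) (ξ i)) ⟩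
      Σℚ.sum (λ i → fromℤ (x i) * ξ i + fromℤ q * (fromℤ (y i) * ξ i))
        ≡⟨ Σℚ.∑-distrib-+ (λ i → fromℤ (x i) * ξ i) (λ i → fromℤ q * (fromℤ (y i) * ξ i)) ⟩
      dot x ξ + Σℚ.sum (λ i → fromℤ q * (fromℤ (y i) * ξ i))
        ≡⟨ cong (λ z → dot x ξ + z) (sym (Σℚ.*-distribˡ-sum (fromℤ q) (λ i → fromℤ (y i) * ξ i))) ⟩
      dot x ξ + fromℤ q * dot y ξ ∎
      where
      open ≡-Reasoning
      open +-*-Solver

    dot-modℤ : ∀ {d} (x : Vector ℤ d) {ξ η} → ξ ≡ η modℤ → ∃ λ k → dot x ξ ≡ dot x η + fromℤ k
    dot-modℤ x {ξ} {η} (k , p) = Σℤ.sum (λ i → x i ℤ.* k i) , (begin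
      dot x ξ                             ≡⟨ Σℚ.sum-cong-≋ (λ i → cong (fromℤ (x i) *_)
                                               (trans (solve 2 (λ a b → a := b :+ (a :- b)) refl (ξ i) (η i)) (cong (λ z → η i + z) (p i)))) ⟩
      dot x (λ i → η i + fromℤ (k i))     ≡⟨ dot-+ʳ x η (λ i → fromℤ (k i)) ⟩
      dot x η + dot x (λ i → fromℤ (k i)) ≡⟨ cong (λ z → dot x η + z)
                                               (trans (Σℚ.sum-cong-≋ λ i → fromℤ-* (x i) (k i)) (fromℤ-sum (λ i → x i ℤ.* k i))) ⟩
      dot x η + fromℤ (Σℤ.sum (λ i → x i ℤ.* k i)) ∎)
      where
      open ≡-Reasoning
      open +-*-Solver

    -- For x = A z the pairing x · ξ is z · (Aᵀ ξ), a pairing of integer vectors.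
    image-dot : ∀ {d} (A : Matrix d) {x ξ} → InImage A x → InDual A ξ → IsInteger (dot x ξ)
    image-dot A {x} {ξ} (z , p) (k , q) = Σℤ.sum (λ j → z j ℤ.* k j) , (begin
      Σℚ.sum (λ i → fromℤ (x i) * ξ i)
        ≡⟨ Σℚ.sum-cong-≋ (λ i → cong (_* ξ i) (trans (cong fromℤ (p i)) (sym (fromℤ-sum (λ j → A i j ℤ.* z j))))) ⟩
      Σℚ.sum (λ i → Σℚ.sum (λ j → fromℤ (A i j ℤ.* z j)) * ξ i)
        ≡⟨ Σℚ.sum-cong-≋ (λ i → Σℚ.*-distribʳ-sum (ξ i) (λ j → fromℤ (A i j ℤ.* z j))) ⟩
      Σℚ.sum (λ i → Σℚ.sum (λ j → fromℤ (A i j ℤ.* z j) * ξ i))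
        ≡⟨ Σℚ.∑-comm (λ i j → fromℤ (A i j ℤ.* z j) * ξ i) ⟩
      Σℚ.sum (λ j → Σℚ.sum (λ i → fromℤ (A i j ℤ.* z j) * ξ i))
        ≡⟨ Σℚ.sum-cong-≋ (λ j → Σℚ.sum-cong-≋ (λ i → trans (cong (_* ξ i) (sym (fromℤ-* (A i j) (z j))))
             (solve 3 (λ a z ξ → (a :* z) :* ξ := z :* (a :* ξ)) refl (fromℤ (A i j)) (fromℤ (z j)) (ξ i)))) ⟩
      Σℚ.sum (λ j → Σℚ.sum (λ i → fromℤ (z j) * (fromℤ (A i j) * ξ i)))
        ≡⟨ Σℚ.sum-cong-≋ (λ j → trans (sym (Σℚ.*-distribˡ-sum (fromℤ (z j)) (λ i → fromℤ (A i j) * ξ i)))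
             (trans (cong (fromℤ (z j) *_) (q j)) (fromℤ-* (z j) (k j)))) ⟩
      Σℚ.sum (λ j → fromℤ (z j ℤ.* k j))
        ≡⟨ fromℤ-sum (λ j → z j ℤ.* k j) ⟩
      fromℤ (Σℤ.sum (λ j → z j ℤ.* k j)) ∎)
      where
      open ≡-Reasoning
      open +-*-Solver

    -- A dual vector is one that pairs integrally with the columns; those of B lie in the image of
    -- A, where `image-dot` applies.
    dual-~ : ∀ {d} {A B : Matrix d} → A ~ B → ∀ {ξ} → InDual A ξ → InDual B ξ
    dual-~ {A = A} {B} A~B {ξ} dual = (λ j → proj₁ (integral j)) , λ j → proj₂ (integral j)
      where
      integral : ∀ j → IsInteger (dot (column B j) ξ)
      integral j = image-dot A {column B j} {ξ} (B⊆A A~B (column∈image B j)) dual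

  module _ (S : Setoid 0ℓ 0ℓ) where
    private module S = Setoid S

    bijection⇒enumeration : ∀ {n} (f : Fin n → S.Carrier) →
      (∀ {i j} → f i S.≈ f j → i ≡ j) → (∀ s → ∃ λ i → f i S.≈ s) → Enumeration S
    bijection⇒enumeration {n} f injective surjective = record
      { size    = n
      ; inverse = record
        { to        = f
        ; from      = λ s → proj₁ (surjective s)
        ; to-cong   = λ { refl → S.refl }
        ; from-cong = λ {s} {t} s≈t → injective
            (S.trans (proj₂ (surjective s)) (S.trans s≈t (S.sym (proj₂ (surjective t)))))
        ; inverse   = (λ { {s} refl → proj₂ (surjective s) })
                    , (λ {i} {s} s≈fi → injective (S.trans (proj₂ (surjective s)) s≈fi))
        }
      }

  -- All the fields are obtained in one induction on d. By `image-dot` the alternatives of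
  -- `separate` exclude each other, so it also decides membership in the image.
  record DualLattice {d} (A : Matrix d) : Set where
    field
      enumeration : Enumeration (T* A)
      size≡∣det∣  : Enumeration.size enumeration ≡ ℤ.∣ det A ∣
      separate    : ∀ x → InImage A x ⊎ ∃ λ η → InDual A η × (∀ k → dot x η ≢ fromℤ k)

  -- Both quotients have the same points; only the integrality witnesses change, and the equality of
  -- `T*` ignores these.
  dualLattice-~ : ∀ {d} {A B : Matrix d} → A ~ B → DualLattice B → DualLattice A
  dualLattice-~ {A = A} {B} A~B L = record
    { enumeration = record
      { size    = Enumeration.size enumeration
      ; inverse = record
        { to        = λ i → let ξ , p = Inverse.to inv i in ξ , dual-~ (~-sym A~B) p
        ; from      = λ (ξ , p) → Inverse.from inv (ξ , dual-~ A~B p)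
        ; to-cong   = λ eq → Inverse.to-cong inv eq
        ; from-cong = λ eq → Inverse.from-cong inv eq
        ; inverse   = (λ eq → Inverse.inverseˡ inv eq) , (λ eq → Inverse.inverseʳ inv eq)
        }
      }
    ; size≡∣det∣ = trans size≡∣det∣ (cong ℤ.∣_∣ (det≡ A~B))
    ; separate = sep
    }
    where
    open DualLattice L
    inv = Enumeration.inverse enumeration
    sep : ∀ x → InImage A x ⊎ ∃ λ η → InDual A η × (∀ k → dot x η ≢ fromℤ k)
    sep x with separate x
    ... | inj₁ x∈B               = inj₁ (B⊆A A~B x∈B)
    ... | inj₂ (η , dual , x·η∉) = inj₂ (η , dual-~ (~-sym A~B) dual , x·η∉)

  fromℤ-inverse : ∀ {g} → g ≢ 0ℤ → ∃ λ g⁻¹ → fromℤ g * g⁻¹ ≡ 1ℚ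
  fromℤ-inverse {g} g≢0 = ℚ.1/ fromℤ g , ℚP.*-inverseʳ (fromℤ g)
    where
    instance
      nonZero : ℚ.NonZero (fromℤ g)
      nonZero = subst ℚ.NonZero (sym (fromℤ≡mkℚ g)) (ℕ.≢-nonZero (g≢0 ∘ ℤP.∣i∣≡0⇒i≡0))

  -- |r - s| is at most max(r, s) and hence below |g|, which no nonzero multiple of g is.
  residue-unique : ∀ g k {r s} → r ℕ.< ℤ.∣ g ∣ → s ℕ.< ℤ.∣ g ∣ → + r ℤ.- + s ≡ g ℤ.* k → r ≡ s
  residue-unique g k {r} {s} r<g s<g eq with k ℤP.≟ 0ℤ
  ... | yes refl = ℤP.+-injective (ℤP.i-j≡0⇒i≡j (+ r) (+ s) (trans eq (ℤP.*-zeroʳ g)))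
  ... | no  k≢0  = contradiction (begin-strict
      ℤ.∣ g ∣                  ≤⟨ ℕP.m≤m*n ℤ.∣ g ∣ ℤ.∣ k ∣ {{ℕ.≢-nonZero (k≢0 ∘ ℤP.∣i∣≡0⇒i≡0)}} ⟩
      ℤ.∣ g ∣ ℕ.* ℤ.∣ k ∣      ≡⟨ sym (ℤP.abs-* g k) ⟩
      ℤ.∣ g ℤ.* k ∣            ≡⟨ cong ℤ.∣_∣ (sym eq) ⟩
      ℤ.∣ + r ℤ.- + s ∣        ≡⟨ cong ℤ.∣_∣ (ℤP.m-n≡m⊖n r s) ⟩
      ℤ.∣ r ℤ.⊖ s ∣            ≤⟨ ℤP.∣m⊝n∣≤m⊔n r s ⟩
      r ℕ.⊔ s                  <⟨ ℕP.⊔-lub r<g s<g ⟩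
      ℤ.∣ g ∣                  ∎) (ℕP.<-irrefl refl)
    where open ℕP.≤-Reasoning

  -- M is block triangular, with corner g, the column c below it and the block B. The conditions on
  -- (ξ₀ , ξ) are that ξ is dual to B and that g ξ₀ + c · ξ is an integer, so `T* M` fibres over
  -- `T* B` with |g| points in each fibre.
  module Block {d} (M : Matrix (suc d)) (row≡0 : ∀ k → M zero (suc k) ≡ 0ℤ) (det≢0 : det M ≢ 0ℤ)
    (L : DualLattice (minor M zero)) where

    open DualLattice L

    B : Matrix d
    B = minor M zero
    g : ℤ
    g = M zero zero
    c : Vector ℤ d
    c i = M (suc i) zero

    g≢0 : g ≢ 0ℤ
    g≢0 g≡0 = det≢0 (trans (det-block M row≡0) (cong (ℤ._* det B) g≡0))
    instance
      g-nonZero : ℤ.NonZero g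
      g-nonZero = ℤ.≢-nonZero g≢0

    g⁻¹ : ℚ
    g⁻¹ = proj₁ (fromℤ-inverse g≢0)

    gg⁻¹≡1 : fromℤ g * g⁻¹ ≡ 1ℚ
    gg⁻¹≡1 = proj₂ (fromℤ-inverse g≢0)

    g-cancel : ∀ p → fromℤ g * (p * g⁻¹) ≡ p
    g-cancel p = trans (solve 3 (λ g p h → g :* (p :* h) := p :* (g :* h)) refl (fromℤ g) p g⁻¹)
      (trans (cong (p *_) gg⁻¹≡1) (ℚP.*-identityʳ p))
      where open +-*-Solver

    inDual : ∀ {ξ₀ ξ} → InDual B ξ → IsInteger (fromℤ g * ξ₀ + dot c ξ) → InDual M (ξ₀ ∷ ξ)
    inDual {ξ₀} {ξ} (k , p) (k₀ , p₀) = (k₀ ∷ k) , λ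
      { zero    → p₀
      ; (suc j) → trans (cong (_+ dot (column B j) ξ) (trans (cong (λ z → fromℤ z * ξ₀) (row≡0 j)) (ℚP.*-zeroˡ ξ₀)))
                    (trans (ℚP.+-identityˡ _) (p j)) }

    inDual-tail : ∀ {ξ} → InDual M ξ → InDual B (ξ ∘ suc)
    inDual-tail {ξ} (k , p) = k ∘ suc , λ j → trans (sym (ℚP.+-identityˡ _))
      (trans (cong (_+ dot (column B j) (ξ ∘ suc)) (sym (trans (cong (λ z → fromℤ z * ξ zero) (row≡0 j)) (ℚP.*-zeroˡ (ξ zero))))) (p (suc j)))

    n : ℕ
    n = Enumeration.size enumeration
    open Inverse (Enumeration.inverse enumeration) using () renaming (to to representative; from to index)

    representative-index : ∀ (ξ : Setoid.Carrier (T* B)) → proj₁ ξ ≡ proj₁ (representative (index ξ)) modℤ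
    representative-index ξ = Setoid.sym (T* B) {representative (index ξ)} {ξ} (Inverse.inverseˡ (Enumeration.inverse enumeration) {ξ} refl)

    representative-injective : ∀ {i j} → Setoid._≈_ (T* B) (representative i) (representative j) → i ≡ j
    representative-injective {i} {j} eq = trans
      (sym (Inverse.inverseʳ (Enumeration.inverse enumeration) {i} {representative i} (Setoid.refl (T* B) {representative i})))
      (Inverse.inverseʳ (Enumeration.inverse enumeration) {j} {representative i} eq)

    ζ : Fin n → Vector ℚ d
    ζ i = proj₁ (representative i)

    -- The solution ξ₀ of g ξ₀ + c · ζ i = r.
    first : Fin n → ℕ → ℚ
    first i r = (fromℤ (+ r) - dot c (ζ i)) * g⁻¹

    point : Fin n × Fin ℤ.∣ g ∣ → Setoid.Carrier (T* M)
    point (i , r) = first i (toℕ r) ∷ ζ i ,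
      inDual (proj₂ (representative i)) (+ toℕ r , trans (cong (_+ dot c (ζ i)) (g-cancel (fromℤ (+ toℕ r) - dot c (ζ i))))
        (solve 2 (λ r c → r :- c :+ c := r) refl (fromℤ (+ toℕ r)) (dot c (ζ i))))
      where open +-*-Solver

    point-injective : ∀ {p q} → Setoid._≈_ (T* M) (point p) (point q) → p ≡ q
    point-injective {i , r} {j , s} (k , eq)
      with representative-injective {i} {j} (k ∘ suc , eq ∘ suc)
    ... | refl = cong (i ,_) (FinP.toℕ-injective (residue-unique g (k zero) (FinP.toℕ<n r) (FinP.toℕ<n s)
          (fromℤ-injective (begin
            fromℤ (+ toℕ r ℤ.- + toℕ s)                       ≡⟨ sym (fromℤ-+ (+ toℕ r) (ℤ.- + toℕ s)) ⟩
            fromℤ (+ toℕ r) + fromℤ (ℤ.- + toℕ s)             ≡⟨ cong (λ z → fromℤ (+ toℕ r) + z) (sym (fromℤ-neg (+ toℕ s))) ⟩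
            fromℤ (+ toℕ r) - fromℤ (+ toℕ s)                 ≡⟨ sym (g-cancel (fromℤ (+ toℕ r) - fromℤ (+ toℕ s))) ⟩
            fromℤ g * ((fromℤ (+ toℕ r) - fromℤ (+ toℕ s)) * g⁻¹)
              ≡⟨ cong (fromℤ g *_) (solve 4 (λ r s c h → (r :- s) :* h := (r :- c) :* h :- (s :- c) :* h) refl
                   (fromℤ (+ toℕ r)) (fromℤ (+ toℕ s)) (dot c (ζ i)) g⁻¹) ⟩
            fromℤ g * (first i (toℕ r) - first i (toℕ s))     ≡⟨ cong (fromℤ g *_) (eq zero) ⟩
            fromℤ g * fromℤ (k zero)                          ≡⟨ fromℤ-* g (k zero) ⟩
            fromℤ (g ℤ.* k zero)                              ∎))))
      where
      open ≡-Reasoning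
      open +-*-Solver

    point-surjective : ∀ ξ → ∃ λ p → Setoid._≈_ (T* M) (point p) ξ
    point-surjective (ξ , dual@(k , p)) = (i , fromℕ< r<g) , (ℤ.- q ∷ l′) , λ
        { zero    → head-eq
        ; (suc j) → tail-eq j }
      where
      open ≡-Reasoning
      open +-*-Solver
      ξ′ : Setoid.Carrier (T* B)
      ξ′ = ξ ∘ suc , inDual-tail {ξ} dual
      i : Fin n
      i = index ξ′
      l′ : Vector ℤ d
      l′ = proj₁ (Setoid.sym (T* B) {ξ′} {representative i} (representative-index ξ′))
      tail-eq : ∀ j → ζ i j - ξ (suc j) ≡ fromℤ (l′ j)
      tail-eq = proj₂ (Setoid.sym (T* B) {ξ′} {representative i} (representative-index ξ′))
      m : ∃ λ m → dot c (ζ i) ≡ dot c (ξ ∘ suc) + fromℤ m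
      m = dot-modℤ c {ζ i} {ξ ∘ suc} (l′ , tail-eq)
      -- a is the integer g ξ₀ + c · ζ i: passing from the tail of ξ to its representative changes
      -- the pairing with c by `proj₁ m`. The residue of a modulo g picks the point of the fibre,
      -- and the quotient is, up to sign, the integer by which the heads differ.
      a q : ℤ
      a = k zero ℤ.+ proj₁ m
      q = a ℤ./ g
      r<g : a ℤ.% g ℕ.< ℤ.∣ g ∣
      r<g = ℤD.n%d<d a g
      r : ℕ
      r = a ℤ.% g
      gξ₀ : fromℤ g * ξ zero ≡ fromℤ (+ r) + fromℤ q * fromℤ g - dot c (ζ i)
      gξ₀ = begin
        fromℤ g * ξ zero
          ≡⟨ solve 2 (λ a b → a := a :+ b :- b) refl (fromℤ g * ξ zero) (dot c (ξ ∘ suc)) ⟩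
        fromℤ g * ξ zero + dot c (ξ ∘ suc) - dot c (ξ ∘ suc)
          ≡⟨ cong (_- dot c (ξ ∘ suc)) (p zero) ⟩
        fromℤ (k zero) - dot c (ξ ∘ suc)
          ≡⟨ solve 3 (λ k c m → k :- c := (k :+ m) :- (c :+ m)) refl (fromℤ (k zero)) (dot c (ξ ∘ suc)) (fromℤ (proj₁ m)) ⟩
        (fromℤ (k zero) + fromℤ (proj₁ m)) - (dot c (ξ ∘ suc) + fromℤ (proj₁ m))
          ≡⟨ cong₂ _-_ (trans (fromℤ-+ (k zero) (proj₁ m)) (trans (cong fromℤ (ℤD.a≡a%n+[a/n]*n a g))
               (trans (sym (fromℤ-+ (+ r) (q ℤ.* g))) (cong (λ z → fromℤ (+ r) + z) (sym (fromℤ-* q g))))))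
               (sym (proj₂ m)) ⟩
        fromℤ (+ r) + fromℤ q * fromℤ g - dot c (ζ i) ∎
      head-eq : first i (toℕ (fromℕ< r<g)) - ξ zero ≡ fromℤ (ℤ.- q)
      head-eq = begin
        first i (toℕ (fromℕ< r<g)) - ξ zero
          ≡⟨ cong₂ _-_ (cong (first i) (FinP.toℕ-fromℕ< r<g)) (sym (trans (cong (_* g⁻¹) (sym gξ₀))
               (trans (solve 3 (λ g x h → (g :* x) :* h := g :* (x :* h)) refl (fromℤ g) (ξ zero) g⁻¹) (g-cancel (ξ zero))))) ⟩
        (fromℤ (+ r) - dot c (ζ i)) * g⁻¹ - (fromℤ (+ r) + fromℤ q * fromℤ g - dot c (ζ i)) * g⁻¹
          ≡⟨ solve 5 (λ r c q g h → (r :- c) :* h :- (r :+ q :* g :- c) :* h := :- (g :* (q :* h))) refl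
               (fromℤ (+ r)) (dot c (ζ i)) (fromℤ q) (fromℤ g) g⁻¹ ⟩
        - (fromℤ g * (fromℤ q * g⁻¹))
          ≡⟨ cong -_ (g-cancel (fromℤ q)) ⟩
        - fromℤ q
          ≡⟨ fromℤ-neg q ⟩
        fromℤ (ℤ.- q) ∎

    M-enumeration : Enumeration (T* M)
    M-enumeration = bijection⇒enumeration (T* M) (point ∘ remQuot ℤ.∣ g ∣)
      (λ {i} {j} eq → trans (sym (FinP.combine-remQuot {n} ℤ.∣ g ∣ i))
        (trans (cong (λ (a , b) → combine a b) (point-injective eq)) (FinP.combine-remQuot {n} ℤ.∣ g ∣ j)))
      (λ ξ → let (i , r) , eq = point-surjective ξ in
        combine i r , subst (λ z → Setoid._≈_ (T* M) (point z) ξ) (sym (FinP.remQuot-combine i r)) eq)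

    M-size : n ℕ.* ℤ.∣ g ∣ ≡ ℤ.∣ det M ∣
    M-size = begin
      n ℕ.* ℤ.∣ g ∣             ≡⟨ cong (ℕ._* ℤ.∣ g ∣) size≡∣det∣ ⟩
      ℤ.∣ det B ∣ ℕ.* ℤ.∣ g ∣   ≡⟨ ℕP.*-comm ℤ.∣ det B ∣ ℤ.∣ g ∣ ⟩
      ℤ.∣ g ∣ ℕ.* ℤ.∣ det B ∣   ≡⟨ sym (ℤP.abs-* g (det B)) ⟩
      ℤ.∣ g ℤ.* det B ∣         ≡⟨ cong ℤ.∣_∣ (sym (det-block M row≡0)) ⟩
      ℤ.∣ det M ∣               ∎
      where open ≡-Reasoning

    Separated : Vector ℤ (suc d) → Set
    Separated x = ∃ λ η → InDual M η × (∀ k → dot x η ≢ fromℤ k)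

    -- Forward substitution: the first row determines z₀, and the other rows ask for a preimage
    -- under B.
    M-image : ∀ {x} z₀ → x zero ≡ z₀ ℤ.* g → InImage B (λ i → x (suc i) ℤ.+ (ℤ.- z₀) ℤ.* c i) → InImage M x
    M-image {x} z₀ x₀≡ (z , p) = (z₀ ∷ z) , λ
      { zero    → trans x₀≡ (trans (ℤP.*-comm z₀ g) (sym (trans
                    (cong (λ w → g ℤ.* z₀ ℤ.+ w) (sum-zero ℤP.+-0-commutativeMonoid (λ j → M zero (suc j) ℤ.* z j) λ j →
                      cong (ℤ._* z j) (row≡0 j)))
                    (ℤP.+-identityʳ (g ℤ.* z₀)))))
      ; (suc i) → trans (solve 3 (λ x z c → x := c :* z :+ (x :+ (:- z) :* c)) refl (x (suc i)) z₀ (c i))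
                    (cong (λ w → c i ℤ.* z₀ ℤ.+ w) (p i)) }
      where open ℤSolver.+-*-Solver

    -- The witness (1/g , 0 , ... , 0) pairs with x to x₀/g, which is no integer when g does not
    -- divide x₀.
    separate-first : ∀ x → x zero ℤ.% g ≢ 0 → Separated x
    separate-first x r≢0 = η , inDual {g⁻¹} {λ _ → 0ℚ} ((λ _ → 0ℤ) , λ j → dot-0 (column B j))
        (1ℤ , trans (cong₂ _+_ gg⁻¹≡1 (dot-0 c)) (ℚP.+-identityʳ 1ℚ)) , x·η∉ℤ
      where
      open ≡-Reasoning
      open ℤSolver.+-*-Solver
      η : Vector ℚ (suc d)
      η = g⁻¹ ∷ λ _ → 0ℚ
      dot-0 : ∀ y → dot y (λ _ → 0ℚ) ≡ 0ℚ
      dot-0 y = sum-zero ℚP.+-0-commutativeMonoid (λ i → fromℤ (y i) * 0ℚ) λ i → ℚP.*-zeroʳ (fromℤ (y i))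
      r : ℕ
      r = x zero ℤ.% g
      q : ℤ
      q = x zero ℤ./ g
      x·η∉ℤ : ∀ k → dot x η ≢ fromℤ k
      x·η∉ℤ k eq = r≢0 (residue-unique g (k ℤ.- q) (ℤD.n%d<d (x zero) g) (ℕP.n≢0⇒n>0 (g≢0 ∘ ℤP.∣i∣≡0⇒i≡0)) (begin
        + r ℤ.- + 0          ≡⟨ solve 3 (λ r q g → r :- con 0ℤ := (r :+ q :* g) :- q :* g) refl (+ r) q g ⟩
        (+ r ℤ.+ q ℤ.* g) ℤ.- q ℤ.* g ≡⟨ cong (ℤ._- q ℤ.* g) (trans (sym (ℤD.a≡a%n+[a/n]*n (x zero) g)) x₀≡) ⟩
        g ℤ.* k ℤ.- q ℤ.* g  ≡⟨ solve 3 (λ g k q → g :* k :- q :* g := g :* (k :- q)) refl g k q ⟩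
        g ℤ.* (k ℤ.- q)      ∎))
        where
        x₀g⁻¹ : fromℤ (x zero) * g⁻¹ ≡ fromℤ k
        x₀g⁻¹ = trans (sym (ℚP.+-identityʳ _)) (trans (cong (λ z → fromℤ (x zero) * g⁻¹ + z) (sym (dot-0 (x ∘ suc)))) eq)
        x₀≡ : x zero ≡ g ℤ.* k
        x₀≡ = fromℤ-injective (trans (sym (g-cancel (fromℤ (x zero)))) (trans (cong (fromℤ g *_) x₀g⁻¹) (fromℤ-* g k)))

    -- A dual vector ξ of B extends to M by the head η₀ with g η₀ + c · ξ = 0. Its pairing with x is
    -- then that of ξ with the vector left over by forward substitution.
    separate-rest : ∀ x z₀ → x zero ≡ z₀ ℤ.* g → ∀ ξ → InDual B ξ →
      (∀ k → dot (λ i → x (suc i) ℤ.+ (ℤ.- z₀) ℤ.* c i) ξ ≢ fromℤ k) → Separated x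
    separate-rest x z₀ x₀≡ ξ dual w·ξ∉ℤ = η , inDual {η zero} {ξ} dual
        (0ℤ , trans (cong (_+ dot c ξ) (g-cancel (- dot c ξ))) (ℚP.+-inverseˡ (dot c ξ))) ,
        λ k eq → w·ξ∉ℤ k (trans (sym x·η≡) eq)
      where
      open ≡-Reasoning
      open +-*-Solver
      η : Vector ℚ (suc d)
      η = ((- dot c ξ) * g⁻¹) ∷ ξ
      x·η≡ : dot x η ≡ dot (λ i → x (suc i) ℤ.+ (ℤ.- z₀) ℤ.* c i) ξ
      x·η≡ = begin
        fromℤ (x zero) * ((- dot c ξ) * g⁻¹) + dot (x ∘ suc) ξ
          ≡⟨ cong (λ z → z * ((- dot c ξ) * g⁻¹) + dot (x ∘ suc) ξ) (trans (cong fromℤ x₀≡) (sym (fromℤ-* z₀ g))) ⟩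
        fromℤ z₀ * fromℤ g * ((- dot c ξ) * g⁻¹) + dot (x ∘ suc) ξ
          ≡⟨ cong (_+ dot (x ∘ suc) ξ) (trans (ℚP.*-assoc (fromℤ z₀) (fromℤ g) ((- dot c ξ) * g⁻¹)) (cong (fromℤ z₀ *_) (g-cancel (- dot c ξ)))) ⟩
        fromℤ z₀ * (- dot c ξ) + dot (x ∘ suc) ξ
          ≡⟨ solve 3 (λ z c x → z :* (:- c) :+ x := x :+ (:- z) :* c) refl (fromℤ z₀) (dot c ξ) (dot (x ∘ suc) ξ) ⟩
        dot (x ∘ suc) ξ + (- fromℤ z₀) * dot c ξ
          ≡⟨ cong (λ z → dot (x ∘ suc) ξ + z * dot c ξ) (fromℤ-neg z₀) ⟩
        dot (x ∘ suc) ξ + fromℤ (ℤ.- z₀) * dot c ξ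
          ≡⟨ sym (dot-+*ˡ (x ∘ suc) c (ℤ.- z₀) ξ) ⟩
        dot (λ i → x (suc i) ℤ.+ (ℤ.- z₀) ℤ.* c i) ξ ∎

    M-separate : ∀ x → InImage M x ⊎ Separated x
    M-separate x with x zero ℤ.% g ℕP.≟ 0
    ... | no  r≢0 = inj₂ (separate-first x r≢0)
    ... | yes r≡0 with separate (λ i → x (suc i) ℤ.+ (ℤ.- (x zero ℤ./ g)) ℤ.* c i)
    ...   | inj₁ w∈B               = inj₁ (M-image (x zero ℤ./ g) x₀≡ w∈B)
      where
      x₀≡ : x zero ≡ (x zero ℤ./ g) ℤ.* g
      x₀≡ = trans (ℤD.a≡a%n+[a/n]*n (x zero) g) (trans (cong (λ r → + r ℤ.+ (x zero ℤ./ g) ℤ.* g) r≡0) (ℤP.+-identityˡ _))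
    ...   | inj₂ (ξ , dual , w·ξ∉) = inj₂ (separate-rest x (x zero ℤ./ g) x₀≡ ξ dual w·ξ∉)
      where
      x₀≡ : x zero ≡ (x zero ℤ./ g) ℤ.* g
      x₀≡ = trans (ℤD.a≡a%n+[a/n]*n (x zero) g) (trans (cong (λ r → + r ℤ.+ (x zero ℤ./ g) ℤ.* g) r≡0) (ℤP.+-identityˡ _))

    dualLattice-block : DualLattice M
    dualLattice-block = record
      { enumeration = M-enumeration
      ; size≡∣det∣  = M-size
      ; separate    = M-separate
      }

  dualLattice : ∀ {d} (A : Matrix d) → det A ≢ 0ℤ → DualLattice A
  dualLattice {zero} A _ = record
    { enumeration = bijection⇒enumeration (T* A) {1} (λ _ → (λ ()) , (λ ()) , λ ())
        (λ { {zero} {zero} _ → refl }) (λ _ → zero , (λ ()) , λ ())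
    ; size≡∣det∣  = refl
    ; separate    = λ _ → inj₁ ((λ ()) , λ ())
    }
  dualLattice {suc d} A det≢0 with reduce A
  ... | M , A~M , row≡0 = dualLattice-~ A~M (Block.dualLattice-block M row≡0 detM≢0 (dualLattice (minor M zero) minor≢0))
    where
    detM≢0 : det M ≢ 0ℤ
    detM≢0 eq = det≢0 (trans (sym (det≡ A~M)) eq)
    minor≢0 : det (minor M zero) ≢ 0ℤ
    minor≢0 eq = detM≢0 (trans (det-block M row≡0) (trans (cong (M zero zero ℤ.*_) eq) (ℤP.*-zeroʳ (M zero zero))))

-- Finite listings: independence of the choice, and the listing of solutions

module Enumerations where

  open import Defs
  open import Algebra.Bundles using (CommutativeMonoid)
  import Algebra.Properties.CommutativeMonoid.Sum as CommutativeMonoidSum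
  open import Data.Fin.Base using (Fin; zero; suc; toℕ; fromℕ<; finToFun; funToFin)
  import Data.Fin.Properties as FinP
  open import Data.Fin.Permutation as Permutation using (Permutation)
  open import Data.Integer.Base as ℤ using (ℤ; +_; -[1+_])
  import Data.Integer.Properties as ℤP
  open import Data.List.Base as List using (List; _∷_)
  import Data.List.Membership.Propositional.Properties as ∈P
  import Data.List.Relation.Unary.All as All
  import Data.List.Relation.Unary.Any as Any
  import Data.List.Relation.Unary.Any.Properties as AnyP
  open import Data.List.Relation.Unary.AllPairs using (AllPairs; _∷_)
  import Data.List.Relation.Unary.Unique.DecSetoid.Properties as UniqueP
  open import Data.Maybe.Base using (Maybe; just; nothing)
  import Data.Maybe.Relation.Unary.Any as MaybeAny
  open import Data.Nat.Base as ℕ using (ℕ; zero; suc)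
  import Data.Nat.Properties as ℕP
  open import Data.Product.Base using (∃; ∃₂; _×_; _,_)
  open import Data.Sum.Base using (inj₁; inj₂)
  open import Data.Vec.Functional using (Vector)
  open import Function.Base using (_∘_)
  open import Function.Bundles using (Inverse; mk↔ₛ′)
  open import Level using (0ℓ)
  open import Relation.Binary.Bundles using (Setoid; DecSetoid)
  open import Relation.Binary.Definitions using (Decidable)
  open import Relation.Binary.PropositionalEquality using (_≡_; refl; sym; trans; cong; cong₂; subst; module ≡-Reasoning)
  open import Relation.Nullary using (yes; no; ¬_; contradiction)
  open import Relation.Nullary.Decidable using (_×-dec_)
  open ColumnReduction using (image-resp)
  open DualLattices using (bijection⇒enumeration; DualLattice; image-dot)

  module _ (S : Setoid 0ℓ 0ℓ) where
    private module S = Setoid S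

    unique⇒lookup-injective : ∀ {xs} → AllPairs (λ x y → ¬ (x S.≈ y)) xs →
      ∀ {i j} → List.lookup xs i S.≈ List.lookup xs j → i ≡ j
    unique⇒lookup-injective (_ ∷ _)   {zero}  {zero}  _  = refl
    unique⇒lookup-injective (x≉ ∷ _)  {zero}  {suc j} eq = contradiction eq (All.lookup x≉ (∈P.∈-lookup j))
    unique⇒lookup-injective (x≉ ∷ _)  {suc i} {zero}  eq = contradiction (S.sym eq) (All.lookup x≉ (∈P.∈-lookup i))
    unique⇒lookup-injective (_ ∷ xs≉) {suc i} {suc j} eq = cong suc (unique⇒lookup-injective xs≉ eq)

    -- Exhaustive search: the defined values are listed and duplicates up to `≈` removed, so f has
    -- only to hit every class at least once.
    partial-surjection⇒enumeration : Decidable S._≈_ → ∀ {n} (f : Fin n → Maybe S.Carrier) →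
      (∀ s → ∃₂ λ i t → f i ≡ just t × t S.≈ s) → Enumeration S
    partial-surjection⇒enumeration _≟_ {n} f covers = bijection⇒enumeration S (List.lookup ys)
        (unique⇒lookup-injective (UniqueP.deduplicate-! decSetoid xs))
        (λ s → Any.index (s∈ys s) , AnyP.lookup-index (s∈ys s))
      where
      decSetoid : DecSetoid 0ℓ 0ℓ
      decSetoid = record { isDecEquivalence = record { isEquivalence = S.isEquivalence ; _≟_ = _≟_ } }
      xs ys : List S.Carrier
      xs = List.mapMaybe f (List.allFin n)
      ys = List.deduplicate _≟_ xs
      s∈ys : ∀ s → Any.Any (S._≈ s) ys
      s∈ys s with covers s
      ... | i , t , fi≡ , t≈s = AnyP.deduplicate⁺ _≟_ (λ y≈x x≈s → S.trans y≈x x≈s)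
        (AnyP.mapMaybe⁺ f (List.allFin n) (AnyP.map⁺ (Any.map (λ { refl → subst (MaybeAny.Any (S._≈ s)) (sym fi≡) (MaybeAny.just t≈s) }) (∈P.∈-allFin i))))

    reindexing : (E F : Enumeration S) → Permutation (Enumeration.size E) (Enumeration.size F)
    reindexing E F = mk↔ₛ′ (F.from ∘ E.to) (E.from ∘ F.to)
        (λ i → F.inverseʳ (E.inverseˡ refl))
        (λ i → E.inverseʳ (F.inverseˡ refl))
      where
      module E = Inverse (Enumeration.inverse E)
      module F = Inverse (Enumeration.inverse F)

    -- Carries the order |det A| from the constructed listing to the arbitrary one of the theorem.
    size-unique : (E F : Enumeration S) → Enumeration.size E ≡ Enumeration.size F
    size-unique E F = Permutation.↔⇒≡ (reindexing E F)

    module _ (M : CommutativeMonoid 0ℓ 0ℓ) where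
      private
        module M = CommutativeMonoid M
        module ΣM = CommutativeMonoidSum M

      -- Lets translations act on sums over the dual group: a translated listing is another listing
      -- of the same group.
      sum-independent : (E F : Enumeration S) (f : S.Carrier → M.Carrier) →
        (∀ {s t} → s S.≈ t → f s M.≈ f t) →
        ΣM.sum (f ∘ Inverse.to (Enumeration.inverse E)) M.≈ ΣM.sum (f ∘ Inverse.to (Enumeration.inverse F))
      sum-independent E F f f-cong = M.trans
        (ΣM.sum-cong-≋ {Enumeration.size E} {f ∘ E.to} {λ i → f (F.to (F.from (E.to i)))} λ i → f-cong (S.sym (F.inverseˡ refl)))
        (M.sym (ΣM.sum-permute (f ∘ F.to) (reindexing E F)))
        where
        module E = Inverse (Enumeration.inverse E)
        module F = Inverse (Enumeration.inverse F)

  difference : ∀ {d} → Vector ℕ d → Vector ℕ d → Vector ℤ d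
  difference a b i = + a i ℤ.- + b i

  ∣⊖∣+2⊓ : ∀ a b → ℤ.∣ a ℤ.⊖ b ∣ ℕ.+ 2 ℕ.* (a ℕ.⊓ b) ≡ a ℕ.+ b
  ∣⊖∣+2⊓ zero    zero    = refl
  ∣⊖∣+2⊓ zero    (suc b) = ℕP.+-identityʳ (suc b)
  ∣⊖∣+2⊓ (suc a) zero    = refl
  ∣⊖∣+2⊓ (suc a) (suc b) = begin
    ℤ.∣ suc a ℤ.⊖ suc b ∣ ℕ.+ 2 ℕ.* suc (a ℕ.⊓ b)   ≡⟨ cong₂ (λ u v → ℤ.∣ u ∣ ℕ.+ v) (ℤP.[1+m]⊖[1+n]≡m⊖n a b) (ℕP.*-suc 2 (a ℕ.⊓ b)) ⟩
    ℤ.∣ a ℤ.⊖ b ∣ ℕ.+ (2 ℕ.+ 2 ℕ.* (a ℕ.⊓ b))       ≡⟨ ℕP.+-comm ℤ.∣ a ℤ.⊖ b ∣ _ ⟩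
    2 ℕ.+ 2 ℕ.* (a ℕ.⊓ b) ℕ.+ ℤ.∣ a ℤ.⊖ b ∣         ≡⟨ cong (2 ℕ.+_) (ℕP.+-comm (2 ℕ.* (a ℕ.⊓ b)) _) ⟩
    2 ℕ.+ (ℤ.∣ a ℤ.⊖ b ∣ ℕ.+ 2 ℕ.* (a ℕ.⊓ b))       ≡⟨ cong (2 ℕ.+_) (∣⊖∣+2⊓ a b) ⟩
    2 ℕ.+ (a ℕ.+ b)                                 ≡⟨ cong suc (sym (ℕP.+-suc a b)) ⟩
    suc a ℕ.+ suc b                                 ∎
    where open ≡-Reasoning

  ∣difference∣+2⊓ : ∀ a b → ℤ.∣ + a ℤ.- + b ∣ ℕ.+ 2 ℕ.* (a ℕ.⊓ b) ≡ a ℕ.+ b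
  ∣difference∣+2⊓ a b = trans (cong (λ z → ℤ.∣ z ∣ ℕ.+ 2 ℕ.* (a ℕ.⊓ b)) (ℤP.m-n≡m⊖n a b)) (∣⊖∣+2⊓ a b)

  -- a = y + x⁺ and b = y + x⁻, inverting x = a − b and y = a ⊓ b.
  positive negative : ℤ → ℕ → ℕ
  positive (+ n)    y = y ℕ.+ n
  positive -[1+ n ] y = y
  negative (+ n)    y = y
  negative -[1+ n ] y = y ℕ.+ suc n

  positive-negative : ∀ x y → + positive x y ℤ.- + negative x y ≡ x
  positive-negative (+ n)    y = trans (cong (ℤ._- + y) (ℤP.+-comm (+ y) (+ n))) (trans (ℤP.+-assoc (+ n) (+ y) (ℤ.- + y))
    (trans (cong (λ z → + n ℤ.+ z) (ℤP.+-inverseʳ (+ y))) (ℤP.+-identityʳ (+ n))))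
  positive-negative -[1+ n ] y = trans (cong (λ z → + y ℤ.+ z) (ℤP.neg-distrib-+ (+ y) (+ suc n)))
    (trans (sym (ℤP.+-assoc (+ y) (ℤ.- + y) -[1+ n ])) (trans (cong (ℤ._+ -[1+ n ]) (ℤP.+-inverseʳ (+ y))) (ℤP.+-identityˡ -[1+ n ])))

  positive+negative : ∀ x y → positive x y ℕ.+ negative x y ≡ ℤ.∣ x ∣ ℕ.+ 2 ℕ.* y
  positive+negative (+ n)    y = trans (cong (ℕ._+ y) (ℕP.+-comm y n)) (trans (ℕP.+-assoc n y y) (cong (λ z → n ℕ.+ (y ℕ.+ z)) (sym (ℕP.+-identityʳ y))))
  positive+negative -[1+ n ] y = trans (sym (ℕP.+-assoc y y (suc n))) (trans (ℕP.+-comm (y ℕ.+ y) (suc n)) (cong (λ z → suc n ℕ.+ (y ℕ.+ z)) (sym (ℕP.+-identityʳ y))))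

  sum-difference-unique : ∀ {a b a′ b′} → a ℕ.+ b ≡ a′ ℕ.+ b′ → + a ℤ.- + b ≡ + a′ ℤ.- + b′ → a ≡ a′ × b ≡ b′
  sum-difference-unique {a} {b} {a′} {b′} sum≡ difference≡ = a≡ , ℕP.+-cancelˡ-≡ a b b′ (trans sum≡ (cong (ℕ._+ b′) (sym a≡)))
    where
    double : ∀ a b → (+ a ℤ.- + b) ℤ.+ + (a ℕ.+ b) ≡ + (a ℕ.+ a)
    double a b = begin
      (+ a ℤ.- + b) ℤ.+ (+ a ℤ.+ + b)   ≡⟨ cong (λ z → (+ a ℤ.- + b) ℤ.+ z) (ℤP.+-comm (+ a) (+ b)) ⟩
      (+ a ℤ.- + b) ℤ.+ (+ b ℤ.+ + a)   ≡⟨ sym (ℤP.+-assoc (+ a ℤ.- + b) (+ b) (+ a)) ⟩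
      ((+ a ℤ.- + b) ℤ.+ + b) ℤ.+ + a   ≡⟨ cong (ℤ._+ + a) (trans (ℤP.+-assoc (+ a) (ℤ.- + b) (+ b)) (trans (cong (λ z → + a ℤ.+ z) (ℤP.+-inverseˡ (+ b))) (ℤP.+-identityʳ (+ a)))) ⟩
      + a ℤ.+ + a                       ∎
      where open ≡-Reasoning
    a+a≡ : a ℕ.+ a ≡ a′ ℕ.+ a′
    a+a≡ = ℤP.+-injective (trans (sym (double a b)) (trans (cong₂ (λ u v → u ℤ.+ + v) difference≡ sum≡) (double a′ b′)))
    a≡ : a ≡ a′
    a≡ = ℕP.*-cancelˡ-≡ a a′ 2 (trans (cong (a ℕ.+_) (ℕP.+-identityʳ a)) (trans a+a≡ (cong (a′ ℕ.+_) (sym (ℕP.+-identityʳ a′)))))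

  module _ {d} {A : Matrix d} (L : DualLattice A) (m : Vector ℕ d) where

    private
      S : Setoid 0ℓ 0ℓ
      S = Solutions A m

      _≟_ : Decidable (Setoid._≈_ S)
      ((x , y) , _) ≟ ((x′ , y′) , _) = FinP.all? (λ i → x i ℤP.≟ x′ i) ×-dec FinP.all? (λ i → y i ℕP.≟ y′ i)

      -- One bound for all coordinates, so that the search space is a power `bound ^ d`, which
      -- `finToFun` decodes.
      bound : ℕ
      bound = suc ∣ m ∣₁

      -- The vector a determines b = m - a, and testing the sum detects truncated subtraction. The
      -- answer of `separate` then decides membership in the image.
      candidate : (Fin d → Fin bound) → Maybe (Setoid.Carrier S)
      candidate f with FinP.all? (λ i → toℕ (f i) ℕ.+ (m i ℕ.∸ toℕ (f i)) ℕP.≟ m i)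
                     | DualLattice.separate L (difference (toℕ ∘ f) (λ i → m i ℕ.∸ toℕ (f i)))
      ... | no  _   | _        = nothing
      ... | yes _   | inj₂ _   = nothing
      ... | yes a+b | inj₁ x∈A = just ((difference a b , λ i → a i ℕ.⊓ b i) , x∈A , λ i → trans (∣difference∣+2⊓ (a i) (b i)) (a+b i))
        where
        a b : Vector ℕ d
        a = toℕ ∘ f
        b i = m i ℕ.∸ toℕ (f i)

      m≤∣m∣ : ∀ {d} (m : Vector ℕ d) i → m i ℕ.≤ ∣ m ∣₁
      m≤∣m∣ m zero    = ℕP.m≤m+n (m zero) _
      m≤∣m∣ m (suc i) = ℕP.≤-trans (m≤∣m∣ (m ∘ suc) i) (ℕP.m≤n+m _ (m zero))

      module _ {x : Vector ℤ d} {y : Vector ℕ d} (x∈A : InImage A x) (eq : ∀ i → ℤ.∣ x i ∣ ℕ.+ 2 ℕ.* y i ≡ m i) where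

        pos neg : Vector ℕ d
        pos i = positive (x i) (y i)
        neg i = negative (x i) (y i)

        pos+neg : ∀ i → pos i ℕ.+ neg i ≡ m i
        pos+neg i = trans (positive+negative (x i) (y i)) (eq i)

        code : Fin d → Fin bound
        code i = fromℕ< (ℕ.s≤s (ℕP.≤-trans (subst (pos i ℕ.≤_) (pos+neg i) (ℕP.m≤m+n (pos i) (neg i))) (m≤∣m∣ m i)))

        -- f is only assumed to agree with `pos` pointwise, because decoding an encoded function
        -- returns it pointwise and not as an equal function.
        module _ (f : Fin d → Fin bound) (f≡pos : ∀ i → toℕ (f i) ≡ pos i) where

          rest≡neg : ∀ i → m i ℕ.∸ toℕ (f i) ≡ neg i
          rest≡neg i = trans (cong₂ ℕ._∸_ (sym (pos+neg i)) (f≡pos i)) (ℕP.m+n∸m≡n (pos i) (neg i))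

          difference≡x : ∀ i → difference (toℕ ∘ f) (λ i → m i ℕ.∸ toℕ (f i)) i ≡ x i
          difference≡x i = trans (cong₂ (λ a b → + a ℤ.- + b) (f≡pos i) (rest≡neg i)) (positive-negative (x i) (y i))

          ⊓≡y : ∀ i → toℕ (f i) ℕ.⊓ (m i ℕ.∸ toℕ (f i)) ≡ y i
          ⊓≡y i = ℕP.*-cancelˡ-≡ _ (y i) 2 (ℕP.+-cancelˡ-≡ ℤ.∣ x i ∣ _ _ (begin
            ℤ.∣ x i ∣ ℕ.+ 2 ℕ.* (toℕ (f i) ℕ.⊓ (m i ℕ.∸ toℕ (f i)))
              ≡⟨ cong (λ z → ℤ.∣ z ∣ ℕ.+ 2 ℕ.* (toℕ (f i) ℕ.⊓ (m i ℕ.∸ toℕ (f i)))) (sym (difference≡x i)) ⟩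
            ℤ.∣ + toℕ (f i) ℤ.- + (m i ℕ.∸ toℕ (f i)) ∣ ℕ.+ 2 ℕ.* (toℕ (f i) ℕ.⊓ (m i ℕ.∸ toℕ (f i)))
              ≡⟨ ∣difference∣+2⊓ (toℕ (f i)) (m i ℕ.∸ toℕ (f i)) ⟩
            toℕ (f i) ℕ.+ (m i ℕ.∸ toℕ (f i))
              ≡⟨ cong₂ ℕ._+_ (f≡pos i) (rest≡neg i) ⟩
            pos i ℕ.+ neg i
              ≡⟨ positive+negative (x i) (y i) ⟩
            ℤ.∣ x i ∣ ℕ.+ 2 ℕ.* y i ∎))
            where open ≡-Reasoning

          candidate-code : ∃ λ t → candidate f ≡ just t × Setoid._≈_ S t ((x , y) , x∈A , eq)
          candidate-code
            with FinP.all? (λ i → toℕ (f i) ℕ.+ (m i ℕ.∸ toℕ (f i)) ℕP.≟ m i)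
               | DualLattice.separate L (difference (toℕ ∘ f) (λ i → m i ℕ.∸ toℕ (f i)))
          ... | no ¬a+b | _ = contradiction (λ i → trans (cong₂ ℕ._+_ (f≡pos i) (rest≡neg i)) (pos+neg i)) ¬a+b
          ... | yes _   | inj₂ (η , dual , ∉ℤ) =
            let k , ≡k = image-dot A (image-resp {A = A} (λ i → sym (difference≡x i)) x∈A) dual in
            contradiction ≡k (∉ℤ k)
          ... | yes a+b | inj₁ d∈A = _ , refl , difference≡x , ⊓≡y

    solutions-enumeration : Enumeration S
    solutions-enumeration = partial-surjection⇒enumeration S _≟_ {bound ℕ.^ d} (candidate ∘ finToFun)
      λ ((x , y) , x∈A , eq) → let t = candidate-code x∈A eq (finToFun (funToFin (code x∈A eq)))
                                     (λ i → trans (cong toℕ (FinP.finToFun-funToFin (code x∈A eq) i)) (FinP.toℕ-fromℕ< _)) in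
        funToFin (code x∈A eq) , t

-- Binomial expansions and their factorial coefficients

module BinomialSums where

  open import Defs using (_!ᵛ)
  open import Algebra.Bundles using (CommutativeSemiring)
  import Algebra.Definitions.RawSemiring as RawSemiringDefs
  import Algebra.Properties.CommutativeSemigroup as CommutativeSemigroupProperties
  import Algebra.Properties.CommutativeMonoid.Sum as CommutativeMonoidSum
  open import Data.Fin.Base using (Fin; zero; suc)
  open import Data.Nat.Base as ℕ using (ℕ; zero; suc; _!)
  import Data.Nat.Properties as ℕP
  open import Data.Nat.Solver using (module +-*-Solver)
  open import Data.Product.Base using (_×_; _,_; proj₁; proj₂)
  open import Data.Sum.Base using (_⊎_; inj₁; inj₂)
  open import Data.Vec.Functional using (Vector; []; _∷_)
  open import Function.Base using (_∘_)
  open import Level using (0ℓ)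
  open import Relation.Binary.PropositionalEquality using (_≡_; refl; sym; trans; cong; cong₂; module ≡-Reasoning)

  -- binSum n φ = ∑ C(n,a) φ(a,b) over a + b = n, unfolded by Pascal's rule, and
  -- boxSum m is its iteration over the coordinates.
  module BinomialSum (R : CommutativeSemiring 0ℓ 0ℓ) where
    private
      module R = CommutativeSemiring R
      module ΣR = CommutativeMonoidSum R.+-commutativeMonoid
    open CommutativeSemigroupProperties R.+-commutativeSemigroup using (interchange)
    open R using (Carrier; _+_; _*_; 0#) renaming (_≈_ to _≈ᴿ_)

    binSum : ℕ → (ℕ → ℕ → Carrier) → Carrier
    binSum zero    φ = φ 0 0
    binSum (suc n) φ = binSum n (λ a b → φ (suc a) b) + binSum n (λ a b → φ a (suc b))

    boxSum : ∀ {d} → Vector ℕ d → (Vector ℕ d → Vector ℕ d → Carrier) → Carrier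
    boxSum {zero}  m φ = φ [] []
    boxSum {suc d} m φ = binSum (m zero) λ a b → boxSum (m ∘ suc) λ as bs → φ (a ∷ as) (b ∷ bs)

    binSum-cong : ∀ n {φ ψ} → (∀ a b → a ℕ.+ b ≡ n → φ a b ≈ᴿ ψ a b) → binSum n φ ≈ᴿ binSum n ψ
    binSum-cong zero    φ≈ψ = φ≈ψ 0 0 refl
    binSum-cong (suc n) φ≈ψ = R.+-cong
      (binSum-cong n λ a b a+b → φ≈ψ (suc a) b (cong suc a+b))
      (binSum-cong n λ a b a+b → φ≈ψ a (suc b) (trans (ℕP.+-suc a b) (cong suc a+b)))

    boxSum-cong : ∀ {d} (m : Vector ℕ d) {φ ψ} → (∀ a b → (∀ i → a i ℕ.+ b i ≡ m i) → φ a b ≈ᴿ ψ a b) →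
                  boxSum m φ ≈ᴿ boxSum m ψ
    boxSum-cong {zero}  m φ≈ψ = φ≈ψ [] [] λ ()
    boxSum-cong {suc d} m φ≈ψ = binSum-cong (m zero) λ a b a+b → boxSum-cong (m ∘ suc) λ as bs as+bs →
      φ≈ψ (a ∷ as) (b ∷ bs) λ { zero → a+b ; (suc i) → as+bs i }

    binSum-0 : ∀ n → binSum n (λ _ _ → 0#) ≈ᴿ 0#
    binSum-0 zero    = R.refl
    binSum-0 (suc n) = R.trans (R.+-cong (binSum-0 n) (binSum-0 n)) (R.+-identityʳ 0#)

    boxSum-0 : ∀ {d} (m : Vector ℕ d) → boxSum m (λ _ _ → 0#) ≈ᴿ 0#
    boxSum-0 {zero}  m = R.refl
    boxSum-0 {suc d} m = R.trans (binSum-cong (m zero) λ _ _ _ → boxSum-0 (m ∘ suc)) (binSum-0 (m zero))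

    binSum-+ : ∀ n φ ψ → binSum n (λ a b → φ a b + ψ a b) ≈ᴿ binSum n φ + binSum n ψ
    binSum-+ zero    φ ψ = R.refl
    binSum-+ (suc n) φ ψ = R.trans (R.+-cong (binSum-+ n _ _) (binSum-+ n _ _)) (interchange _ _ _ _)

    boxSum-+ : ∀ {d} (m : Vector ℕ d) φ ψ → boxSum m (λ a b → φ a b + ψ a b) ≈ᴿ boxSum m φ + boxSum m ψ
    boxSum-+ {zero}  m φ ψ = R.refl
    boxSum-+ {suc d} m φ ψ = R.trans (binSum-cong (m zero) λ _ _ _ → boxSum-+ (m ∘ suc) _ _) (binSum-+ (m zero) _ _)

    boxSum-sum : ∀ {d n} (m : Vector ℕ d) (φ : Fin n → Vector ℕ d → Vector ℕ d → Carrier) →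
      boxSum m (λ a b → ΣR.sum λ s → φ s a b) ≈ᴿ ΣR.sum λ s → boxSum m (φ s)
    boxSum-sum {n = zero}  m φ = boxSum-0 m
    boxSum-sum {n = suc n} m φ = R.trans (boxSum-+ m (φ zero) _) (R.+-congˡ (boxSum-sum m (φ ∘ suc)))

    binSum-*ˡ : ∀ n c φ → binSum n (λ a b → c * φ a b) ≈ᴿ c * binSum n φ
    binSum-*ˡ zero    c φ = R.refl
    binSum-*ˡ (suc n) c φ = R.trans (R.+-cong (binSum-*ˡ n c _) (binSum-*ˡ n c _)) (R.sym (R.distribˡ c _ _))

    boxSum-*ˡ : ∀ {d} (m : Vector ℕ d) c φ → boxSum m (λ a b → c * φ a b) ≈ᴿ c * boxSum m φ
    boxSum-*ˡ {zero}  m c φ = R.refl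
    boxSum-*ˡ {suc d} m c φ = R.trans (binSum-cong (m zero) λ _ _ _ → boxSum-*ˡ (m ∘ suc) c _) (binSum-*ˡ (m zero) c _)

  open RawSemiringDefs ℕ.+-*-rawSemiring using (product)
  private
    module Πℕ = CommutativeMonoidSum ℕP.*-1-commutativeMonoid
    module ℕSum = BinomialSum ℕP.+-*-commutativeSemiring
  open ℕSum using (binSum; boxSum)

  δ : ℕ → ℕ → ℕ
  δ zero    zero    = 1
  δ zero    (suc _) = 0
  δ (suc _) zero    = 0
  δ (suc a) (suc b) = δ a b

  δ-refl : ∀ a → δ a a ≡ 1
  δ-refl zero    = refl
  δ-refl (suc a) = δ-refl a

  δ-dichotomy : ∀ a b → a ≡ b ⊎ δ a b ≡ 0
  δ-dichotomy zero    zero    = inj₁ refl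
  δ-dichotomy zero    (suc _) = inj₂ refl
  δ-dichotomy (suc _) zero    = inj₂ refl
  δ-dichotomy (suc a) (suc b) with δ-dichotomy a b
  ... | inj₁ a≡b = inj₁ (cong suc a≡b)
  ... | inj₂ δ≡0 = inj₂ δ≡0

  -- Characteristic function of the pair (α , β), so that `boxSum m (indicator α β)` counts the
  -- expansion terms landing on that pair.
  indicator : ∀ {d} → Vector ℕ d → Vector ℕ d → Vector ℕ d → Vector ℕ d → ℕ
  indicator α β a b = product λ i → δ (a i) (α i) ℕ.* δ (b i) (β i)

  indicator-diagonal : ∀ {d} (α β a b : Vector ℕ d) → (∀ i → a i ≡ α i × b i ≡ β i) → indicator α β a b ≡ 1
  indicator-diagonal {zero}  α β a b eq = refl
  indicator-diagonal {suc d} α β a b eq = cong₂ ℕ._*_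
    (cong₂ ℕ._*_ (trans (cong (λ z → δ z (α zero)) (proj₁ (eq zero))) (δ-refl (α zero)))
                 (trans (cong (λ z → δ z (β zero)) (proj₂ (eq zero))) (δ-refl (β zero))))
    (indicator-diagonal (α ∘ suc) (β ∘ suc) (a ∘ suc) (b ∘ suc) (eq ∘ suc))

  indicator-dichotomy : ∀ {d} (α β a b : Vector ℕ d) →
    (∀ i → a i ≡ α i × b i ≡ β i) ⊎ indicator α β a b ≡ 0
  indicator-dichotomy {zero}  α β a b = inj₁ λ ()
  indicator-dichotomy {suc d} α β a b
    with δ-dichotomy (a zero) (α zero) | δ-dichotomy (b zero) (β zero)
       | indicator-dichotomy (α ∘ suc) (β ∘ suc) (a ∘ suc) (b ∘ suc)
  ... | inj₂ p | _      | _      = inj₂ (cong (λ z → z ℕ.* δ (b zero) (β zero) ℕ.* indicator (α ∘ suc) (β ∘ suc) (a ∘ suc) (b ∘ suc)) p)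
  ... | inj₁ _ | inj₂ q | _      = inj₂ (cong (ℕ._* indicator (α ∘ suc) (β ∘ suc) (a ∘ suc) (b ∘ suc)) (trans (cong (δ (a zero) (α zero) ℕ.*_) q) (ℕP.*-zeroʳ (δ (a zero) (α zero)))))
  ... | inj₁ _ | inj₁ _ | inj₂ r = inj₂ (trans (cong (δ (a zero) (α zero) ℕ.* δ (b zero) (β zero) ℕ.*_) r) (ℕP.*-zeroʳ (δ (a zero) (α zero) ℕ.* δ (b zero) (β zero))))
  ... | inj₁ p | inj₁ q | inj₁ r = inj₁ λ { zero → p , q ; (suc i) → r i }

  -- The multiplicity of the term (α , β) in `binSum n`, hence the binomial coefficient when α + β =
  -- n. Defining it through `binSum` spares a comparison of coefficients.
  binomial : ℕ → ℕ → ℕ → ℕ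
  binomial n α β = binSum n λ a b → δ a α ℕ.* δ b β

  binSum-vanish : ∀ n {φ} → (∀ a b → φ a b ≡ 0) → binSum n φ ≡ 0
  binSum-vanish n φ≡0 = trans (ℕSum.binSum-cong n λ a b _ → φ≡0 a b) (ℕSum.binSum-0 n)

  -- Pascal's rule with denominators cleared: for α + β = n + 1 the two branches contribute α · n!
  -- and β · n!, and a branch that would lower a zero index vanishes.
  binomial-! : ∀ n α β → α ℕ.+ β ≡ n → binomial n α β ℕ.* (α ! ℕ.* β !) ≡ n !
  binomial-! zero    zero    zero    _ = refl
  binomial-! (suc n) zero    (suc β) refl = begin
    (binSum n (λ a b → 0) ℕ.+ binomial n 0 β) ℕ.* (1 ℕ.* (suc β ℕ.* β !))
      ≡⟨ cong (λ z → (z ℕ.+ binomial n 0 β) ℕ.* (1 ℕ.* (suc β ℕ.* β !))) (ℕSum.binSum-0 n) ⟩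
    binomial n 0 β ℕ.* (1 ℕ.* (suc β ℕ.* β !))
      ≡⟨ solve 3 (λ N s f → N :* (con 1 :* (s :* f)) := s :* (N :* (con 1 :* f))) refl (binomial n 0 β) (suc β) (β !) ⟩
    suc β ℕ.* (binomial n 0 β ℕ.* (1 ℕ.* β !))
      ≡⟨ cong (suc β ℕ.*_) (binomial-! n 0 β refl) ⟩
    suc n ! ∎
    where
    open ≡-Reasoning
    open +-*-Solver
  binomial-! (suc n) (suc α) zero α+0≡n = begin
    (binomial n α 0 ℕ.+ binSum n (λ a b → δ a (suc α) ℕ.* 0)) ℕ.* (suc α ℕ.* α ! ℕ.* 1)
      ≡⟨ cong (λ z → (binomial n α 0 ℕ.+ z) ℕ.* (suc α ℕ.* α ! ℕ.* 1)) (binSum-vanish n λ a b → ℕP.*-zeroʳ (δ a (suc α))) ⟩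
    (binomial n α 0 ℕ.+ 0) ℕ.* (suc α ℕ.* α ! ℕ.* 1)
      ≡⟨ solve 3 (λ N s f → (N :+ con 0) :* (s :* f :* con 1) := s :* (N :* (f :* con 1))) refl (binomial n α 0) (suc α) (α !) ⟩
    suc α ℕ.* (binomial n α 0 ℕ.* (α ! ℕ.* 1))
      ≡⟨ cong₂ ℕ._*_ (trans (sym (ℕP.+-identityʳ (suc α))) α+0≡n) (binomial-! n α 0 (ℕP.suc-injective α+0≡n)) ⟩
    suc n ! ∎
    where
    open ≡-Reasoning
    open +-*-Solver
  binomial-! (suc n) (suc α) (suc β) α+β≡n = begin
    (binomial n α (suc β) ℕ.+ binomial n (suc α) β) ℕ.* (suc α ℕ.* α ! ℕ.* (suc β ℕ.* β !))
      ≡⟨ solve 6 (λ M N s f t g → (M :+ N) :* (s :* f :* (t :* g)) := s :* (M :* (f :* (t :* g))) :+ t :* (N :* (s :* f :* g))) refl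
           (binomial n α (suc β)) (binomial n (suc α) β) (suc α) (α !) (suc β) (β !) ⟩
    suc α ℕ.* (binomial n α (suc β) ℕ.* (α ! ℕ.* suc β !)) ℕ.+ suc β ℕ.* (binomial n (suc α) β ℕ.* (suc α ! ℕ.* β !))
      ≡⟨ cong₂ (λ u v → suc α ℕ.* u ℕ.+ suc β ℕ.* v)
           (binomial-! n α (suc β) (ℕP.suc-injective α+β≡n))
           (binomial-! n (suc α) β (trans (sym (ℕP.+-suc α β)) (ℕP.suc-injective α+β≡n))) ⟩
    suc α ℕ.* n ! ℕ.+ suc β ℕ.* n !
      ≡⟨ sym (ℕP.*-distribʳ-+ (n !) (suc α) (suc β)) ⟩
    (suc α ℕ.+ suc β) ℕ.* n !
      ≡⟨ cong (ℕ._* n !) α+β≡n ⟩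
    suc n ! ∎
    where
    open ≡-Reasoning
    open +-*-Solver

  -- The indicator is a product over the coordinates, so its box sum factors and `binomial-!`
  -- applies to each coordinate.
  boxSum-indicator : ∀ {d} (m α β : Vector ℕ d) → (∀ i → α i ℕ.+ β i ≡ m i) →
    boxSum m (indicator α β) ℕ.* (α !ᵛ ℕ.* β !ᵛ) ≡ m !ᵛ
  boxSum-indicator {zero}  m α β _ = refl
  boxSum-indicator {suc d} m α β α+β≡m = begin
    boxSum m (indicator α β) ℕ.* (α zero ! ℕ.* α′! ℕ.* (β zero ! ℕ.* β′!))
      ≡⟨ cong (ℕ._* (α zero ! ℕ.* α′! ℕ.* (β zero ! ℕ.* β′!))) factor ⟩
    K ℕ.* binomial (m zero) (α zero) (β zero) ℕ.* (α zero ! ℕ.* α′! ℕ.* (β zero ! ℕ.* β′!))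
      ≡⟨ solve 6 (λ K N a a′ b b′ → K :* N :* (a :* a′ :* (b :* b′)) := (N :* (a :* b)) :* (K :* (a′ :* b′))) refl
           K (binomial (m zero) (α zero) (β zero)) (α zero !) α′! (β zero !) β′! ⟩
    (binomial (m zero) (α zero) (β zero) ℕ.* (α zero ! ℕ.* β zero !)) ℕ.* (K ℕ.* (α′! ℕ.* β′!))
      ≡⟨ cong₂ ℕ._*_ (binomial-! (m zero) (α zero) (β zero) (α+β≡m zero))
                     (boxSum-indicator (m ∘ suc) (α ∘ suc) (β ∘ suc) (α+β≡m ∘ suc)) ⟩
    m !ᵛ ∎
    where
    open ≡-Reasoning
    open +-*-Solver
    α′! β′! K : ℕ
    α′! = (α ∘ suc) !ᵛ
    β′! = (β ∘ suc) !ᵛ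
    K = boxSum (m ∘ suc) (indicator (α ∘ suc) (β ∘ suc))
    factor : boxSum m (indicator α β) ≡ K ℕ.* binomial (m zero) (α zero) (β zero)
    factor = trans
      (ℕSum.binSum-cong (m zero) λ a b _ → trans
        (ℕSum.boxSum-*ˡ (m ∘ suc) (δ a (α zero) ℕ.* δ b (β zero)) (indicator (α ∘ suc) (β ∘ suc)))
        (ℕP.*-comm (δ a (α zero) ℕ.* δ b (β zero)) K))
      (ℕSum.binSum-*ˡ (m zero) K (λ a b → δ a (α zero) ℕ.* δ b (β zero)))

  -- The factorials are matched in pairs at each coordinate, because the sign of x i decides which
  -- member of the other pair is (|x i| + y i)!.
  !ᵛ-*-!ᵛ : ∀ {d} (a b a′ b′ : Vector ℕ d) → (∀ i → a i ! ℕ.* b i ! ≡ a′ i ! ℕ.* b′ i !) →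
            a !ᵛ ℕ.* b !ᵛ ≡ a′ !ᵛ ℕ.* b′ !ᵛ
  !ᵛ-*-!ᵛ a b a′ b′ eq = trans (sym (Πℕ.∑-distrib-+ (λ i → a i !) (λ i → b i !)))
    (trans (Πℕ.sum-cong-≋ eq) (Πℕ.∑-distrib-+ (λ i → a′ i !) (λ i → b′ i !)))

-- Expansion of cosine monomials and sums over the dual group

module CharacterSums where

  open import Defs
  import Algebra.Definitions.RawSemiring as RawSemiringDefs
  import Algebra.Properties.Semiring.Sum as SemiringSum
  open import Data.Fin.Base using (Fin; zero; suc)
  open import Data.Integer.Base as ℤ using (ℤ; +_; 0ℤ)
  import Data.Integer.Properties as ℤP
  import Data.Integer.Solver as ℤSolver
  open import Data.Nat.Base as ℕ using (ℕ; zero; suc)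
  import Data.Nat.Properties as ℕP
  open import Data.Product.Base using (_,_; proj₁; proj₂)
  open import Data.Rational.Base using (ℚ; 0ℚ; 1ℚ; _+_; _*_; -_; _-_)
  import Data.Rational.Properties as ℚP
  open import Data.Rational.Solver using (module +-*-Solver)
  open import Data.Vec.Functional using (Vector; _∷_)
  open import Function.Base using (_∘_)
  open import Function.Bundles using (Inverse)
  open import Relation.Binary.Bundles using (Setoid)
  open import Relation.Binary.PropositionalEquality using (_≡_; _≢_; refl; sym; trans; cong; cong₂)
  import Relation.Binary.Reasoning.Setoid as SetoidReasoning
  open Reals
  open CosineOfTurns
  open DualLattices
  open Enumerations
  open BinomialSums

  open ModℤLemmas

  open RawSemiringDefs ℝ-rawSemiring using () renaming (product to productℝ; _^_ to _^ℝ_)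
  private
    module Σℝ = SemiringSum ℝ-Ring.semiring
    module ℕSum = BinomialSum ℕP.+-*-commutativeSemiring
    module ℝSum = BinomialSum ℝ-Ring.commutativeSemiring
    module ≋-Reasoning = SetoidReasoning ℝ-Ring.setoid

  fromℕ : ℕ → ℝ
  fromℕ n = fromℚ (fromℤ (+ n))

  abstract
    fromℕ-+ : ∀ m n → fromℕ (m ℕ.+ n) ≋ fromℕ m +ℝ fromℕ n
    fromℕ-+ m n = pointwise λ _ → sym (fromℤ-+ (+ m) (+ n))

    fromℕ-* : ∀ m n → fromℕ (m ℕ.* n) ≋ fromℕ m *ℝ fromℕ n
    fromℕ-* m n = pointwise λ _ → trans (cong fromℤ (ℤP.pos-* m n)) (sym (fromℤ-* (+ m) (+ n)))

    binSum-fromℕ : ∀ n φ → ℝSum.binSum n (λ a b → fromℕ (φ a b)) ≋ fromℕ (ℕSum.binSum n φ)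
    binSum-fromℕ zero    φ = ℝ-Ring.refl
    binSum-fromℕ (suc n) φ = ℝ-Ring.trans
      (ℝ-Ring.+-cong (binSum-fromℕ n λ a b → φ (suc a) b) (binSum-fromℕ n λ a b → φ a (suc b)))
      (ℝ-Ring.sym (fromℕ-+ (ℕSum.binSum n λ a b → φ (suc a) b) (ℕSum.binSum n λ a b → φ a (suc b))))

    boxSum-fromℕ : ∀ {d} (m : Vector ℕ d) φ → ℝSum.boxSum m (λ a b → fromℕ (φ a b)) ≋ fromℕ (ℕSum.boxSum m φ)
    boxSum-fromℕ {zero}  m φ = ℝ-Ring.refl
    boxSum-fromℕ {suc d} m φ = ℝ-Ring.trans
      (ℝSum.binSum-cong (m zero) λ a b _ → boxSum-fromℕ (m ∘ suc) λ as bs → φ (a ∷ as) (b ∷ bs))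
      (binSum-fromℕ (m zero) λ a b → ℕSum.boxSum (m ∘ suc) λ as bs → φ (a ∷ as) (b ∷ bs))

    sum-1 : ∀ {n} (f : Vector ℝ n) → (∀ i → f i ≋ fromℚ 1ℚ) → Σℝ.sum f ≋ fromℕ n
    sum-1 {zero}  f f≋1 = ℝ-Ring.refl
    sum-1 {suc n} f f≋1 = ℝ-Ring.trans (ℝ-Ring.+-cong (f≋1 zero) (sum-1 (f ∘ suc) (f≋1 ∘ suc))) (ℝ-Ring.sym (fromℕ-+ 1 n))

  module Characters {π : ℝ} (isPi : IsPi π) where

    c : ℚ → ℝ
    c = cos2π isPi

    abstract
      difference-sucˡ : ∀ p q a b → p + fromℤ (+ suc a ℤ.- + b) * q ≡ (p + q) + fromℤ (+ a ℤ.- + b) * q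
      difference-sucˡ p q a b = trans
        (cong (λ z → p + z * q) (trans (cong fromℤ (ℤP.+-assoc (+ 1) (+ a) (ℤ.- + b))) (sym (fromℤ-+ (+ 1) (+ a ℤ.- + b)))))
        (solve 3 (λ p q x → p :+ (con 1ℚ :+ x) :* q := (p :+ q) :+ x :* q) refl p q (fromℤ (+ a ℤ.- + b)))
        where open +-*-Solver

      difference-sucʳ : ∀ p q a b → p + fromℤ (+ a ℤ.- + suc b) * q ≡ (p - q) + fromℤ (+ a ℤ.- + b) * q
      difference-sucʳ p q a b = trans
        (cong (λ z → p + z * q) (trans (cong fromℤ (lemma (+ a) (+ b))) (sym (fromℤ-+ (ℤ.- + 1) (+ a ℤ.- + b)))))
        (solve 3 (λ p q x → p :+ ((:- con 1ℚ) :+ x) :* q := (p :- q) :+ x :* q) refl p q (fromℤ (+ a ℤ.- + b)))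
        where
        open +-*-Solver
        lemma : ∀ a b → a ℤ.- (+ 1 ℤ.+ b) ≡ ℤ.- + 1 ℤ.+ (a ℤ.- b)
        lemma = Z.solve 2 (λ a b → a Z.:- (Z.con (+ 1) Z.:+ b) Z.:= (Z.:- Z.con (+ 1)) Z.:+ (a Z.:- b)) refl
          where module Z = ℤSolver.+-*-Solver

      -- The factor cos 2πp carries the induction: each further cosine turns it into the phases p +
      -- q and p - q, which match the two branches of `binSum`.
      cos-power : ∀ n p q → fromℕ (2 ℕ.^ n) *ℝ ((c q ^ℝ n) *ℝ c p)
                            ≋ ℝSum.binSum n (λ a b → c (p + fromℤ (+ a ℤ.- + b) * q))
      cos-power zero p q = ℝ-Ring.trans
        (pointwise λ n → trans (ℚP.*-identityˡ _) (ℚP.*-identityˡ _))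
        (ℝ-Ring.reflexive (cong c (sym (trans (cong (λ z → p + z) (ℚP.*-zeroˡ q)) (ℚP.+-identityʳ p)))))
      cos-power (suc n) p q = begin
        fromℕ (2 ℕ.^ suc n) *ℝ ((c q *ℝ Y) *ℝ c p)
          ≈⟨ ℝ-Ring.*-congʳ (fromℕ-+ (2 ℕ.^ n) (2 ℕ.^ n ℕ.+ 0)) ⟩
        (X +ℝ fromℕ (2 ℕ.^ n ℕ.+ 0)) *ℝ ((c q *ℝ Y) *ℝ c p)
          ≈⟨ ℝ-Ring.*-congʳ (ℝ-Ring.+-congˡ (ℝ-Ring.reflexive (cong fromℕ (ℕP.+-identityʳ (2 ℕ.^ n))))) ⟩
        (X +ℝ X) *ℝ ((c q *ℝ Y) *ℝ c p)
          ≈⟨ pointwise (λ k → regroup (approx X k) (approx (c q) k) (approx Y k) (approx (c p) k)) ⟩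
        X *ℝ (Y *ℝ ((c p *ℝ c q) +ℝ (c p *ℝ c q)))
          ≈⟨ ℝ-Ring.*-congˡ (ℝ-Ring.*-congˡ (cos2π+cos2π isPi p q)) ⟨
        X *ℝ (Y *ℝ (c (p + q) +ℝ c (p - q)))
          ≈⟨ ℝ-Ring.trans (ℝ-Ring.*-congˡ (ℝ-Ring.distribˡ Y (c (p + q)) (c (p - q)))) (ℝ-Ring.distribˡ X _ _) ⟩
        (X *ℝ (Y *ℝ c (p + q))) +ℝ (X *ℝ (Y *ℝ c (p - q)))
          ≈⟨ ℝ-Ring.+-cong (cos-power n (p + q) q) (cos-power n (p - q) q) ⟩
        ℝSum.binSum n (λ a b → c ((p + q) + fromℤ (+ a ℤ.- + b) * q)) +ℝ ℝSum.binSum n (λ a b → c ((p - q) + fromℤ (+ a ℤ.- + b) * q))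
          ≈⟨ ℝ-Ring.+-cong (ℝSum.binSum-cong n λ a b _ → ℝ-Ring.reflexive (cong c (sym (difference-sucˡ p q a b))))
                           (ℝSum.binSum-cong n λ a b _ → ℝ-Ring.reflexive (cong c (sym (difference-sucʳ p q a b)))) ⟩
        ℝSum.binSum (suc n) (λ a b → c (p + fromℤ (+ a ℤ.- + b) * q)) ∎
        where
        open ≋-Reasoning
        X Y : ℝ
        X = fromℕ (2 ℕ.^ n)
        Y = c q ^ℝ n
        regroup : ∀ x q y p → (x + x) * ((q * y) * p) ≡ x * (y * (p * q + p * q))
        regroup = solve 4 (λ x q y p → (x :+ x) :* ((q :* y) :* p) := x :* (y :* (p :* q :+ p :* q))) refl
          where open +-*-Solver

      -- Here the phase p collects what the coordinates already expanded contribute, so `cos-power`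
      -- can be applied to one coordinate after another.
      cos-monomial : ∀ {d} (m : Vector ℕ d) ξ p →
        fromℕ (2 ℕ.^ ∣ m ∣₁) *ℝ (productℝ (λ i → c (ξ i) ^ℝ m i) *ℝ c p)
        ≋ ℝSum.boxSum m (λ a b → c (p + dot (difference a b) ξ))
      cos-monomial {zero} m ξ p = ℝ-Ring.trans
        (pointwise λ n → trans (ℚP.*-identityˡ _) (ℚP.*-identityˡ _))
        (ℝ-Ring.reflexive (cong c (sym (ℚP.+-identityʳ p))))
      cos-monomial {suc d} m ξ p = begin
        fromℕ (2 ℕ.^ (m zero ℕ.+ ∣ m ∘ suc ∣₁)) *ℝ ((Z *ℝ Y) *ℝ c p)
          ≈⟨ ℝ-Ring.*-congʳ (ℝ-Ring.trans (ℝ-Ring.reflexive (cong fromℕ (ℕP.^-distribˡ-+-* 2 (m zero) ∣ m ∘ suc ∣₁)))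
               (fromℕ-* (2 ℕ.^ m zero) (2 ℕ.^ ∣ m ∘ suc ∣₁))) ⟩
        (W *ℝ X) *ℝ ((Z *ℝ Y) *ℝ c p)
          ≈⟨ pointwise (λ k → regroup (approx W k) (approx X k) (approx Z k) (approx Y k) (approx (c p) k)) ⟩
        (X *ℝ Y) *ℝ (W *ℝ (Z *ℝ c p))
          ≈⟨ ℝ-Ring.*-congˡ (cos-power (m zero) p (ξ zero)) ⟩
        (X *ℝ Y) *ℝ ℝSum.binSum (m zero) (λ a b → c (p₁ a b))
          ≈⟨ ℝSum.binSum-*ˡ (m zero) (X *ℝ Y) (λ a b → c (p₁ a b)) ⟨
        ℝSum.binSum (m zero) (λ a b → (X *ℝ Y) *ℝ c (p₁ a b))
          ≈⟨ ℝSum.binSum-cong (m zero) (λ a b _ → ℝ-Ring.trans (ℝ-Ring.*-assoc X Y (c (p₁ a b)))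
               (ℝ-Ring.trans (cos-monomial (m ∘ suc) (ξ ∘ suc) (p₁ a b))
                 (ℝSum.boxSum-cong (m ∘ suc) λ as bs _ → ℝ-Ring.reflexive (cong c (ℚP.+-assoc p (fromℤ (+ a ℤ.- + b) * ξ zero) _))))) ⟩
        ℝSum.boxSum m (λ a b → c (p + dot (difference a b) ξ)) ∎
        where
        open ≋-Reasoning
        W X Y Z : ℝ
        W = fromℕ (2 ℕ.^ m zero)
        X = fromℕ (2 ℕ.^ ∣ m ∘ suc ∣₁)
        Y = productℝ (λ i → c (ξ (suc i)) ^ℝ m (suc i))
        Z = c (ξ zero) ^ℝ m zero
        p₁ : ℕ → ℕ → ℚ
        p₁ a b = p + fromℤ (+ a ℤ.- + b) * ξ zero
        regroup : ∀ w x z y p → (w * x) * ((z * y) * p) ≡ (x * y) * (w * (z * p))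
        regroup = solve 5 (λ w x z y p → (w :* x) :* ((z :* y) :* p) := (x :* y) :* (w :* (z :* p))) refl
          where open +-*-Solver

    module _ {d} {A : Matrix d} where
      private
        module T* = Setoid (T* A)
        DualVector : Set
        DualVector = T*.Carrier

      characterSum : Enumeration (T* A) → Vector ℤ d → ℝ
      characterSum E x = Σℝ.sum λ i → c (dot x (proj₁ (Inverse.to (Enumeration.inverse E) i)))

      shift : DualVector → DualVector → DualVector
      shift (η , l , q) (ξ , k , p) = (λ i → ξ i + η i) , (λ j → k j ℤ.+ l j) ,
        λ j → trans (dot-+ʳ (λ i → A i j) ξ η) (trans (cong₂ _+_ (p j) (q j)) (fromℤ-+ (k j) (l j)))

      negate : DualVector → DualVector
      negate (η , l , q) = (λ i → - 1ℚ * η i) , (λ j → ℤ.- + 1 ℤ.* l j) ,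
        λ j → trans (dot-*ʳ (λ i → A i j) (- 1ℚ) η) (trans (cong (- 1ℚ *_) (q j)) (fromℤ-* (ℤ.- + 1) (l j)))

      shift-inverse : ∀ (η η′ : DualVector) → (∀ i → proj₁ η i + proj₁ η′ i ≡ 0ℚ) → ∀ ξ → shift η (shift η′ ξ) T*.≈ ξ
      shift-inverse (η , _) (η′ , _) η+η′≡0 (ξ , _) = (λ _ → 0ℤ) , λ i → trans
        (solve 3 (λ x y z → ((x :+ z) :+ y) :- x := y :+ z) refl (ξ i) (η i) (η′ i)) (η+η′≡0 i)
        where open +-*-Solver

      -- Both η and η′ are arguments because the inverse translation proves surjectivity; exchanging
      -- them gives the translation by -η.
      translate : ∀ (η η′ : DualVector) → (∀ i → proj₁ η i + proj₁ η′ i ≡ 0ℚ) → Enumeration (T* A) → Enumeration (T* A)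
      translate η η′ η+η′≡0 E = bijection⇒enumeration (T* A) (shift η ∘ E.to)
          (λ {i} {j} (k , eq) → trans (sym (E.inverseʳ {i} {E.to i} (T*.refl {E.to i})))
            (E.inverseʳ {j} {E.to i} (k , λ n → trans
              (solve 3 (λ x y z → x :- y := (x :+ z) :- (y :+ z)) refl (proj₁ (E.to i) n) (proj₁ (E.to j) n) (proj₁ η n)) (eq n))))
          (λ ξ → E.from (shift η′ ξ) , T*.trans {shift η (E.to (E.from (shift η′ ξ)))} {shift η (shift η′ ξ)} {ξ}
            (shift-cong {E.to (E.from (shift η′ ξ))} {shift η′ ξ} (E.inverseˡ {shift η′ ξ} refl)) (shift-inverse η η′ η+η′≡0 ξ))
        where
        open +-*-Solver
        module E = Inverse (Enumeration.inverse E)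
        shift-cong : ∀ {ξ ζ} → ξ T*.≈ ζ → shift η ξ T*.≈ shift η ζ
        shift-cong {ξ} {ζ} (k , eq) = k , λ n → trans
          (solve 3 (λ x y z → (x :+ z) :- (y :+ z) := x :- y) refl (proj₁ ξ n) (proj₁ ζ n) (proj₁ η n)) (eq n)

      abstract
        c-respects : ∀ x {ξ ζ : DualVector} → ξ T*.≈ ζ → c (dot x (proj₁ ξ)) ≋ c (dot x (proj₁ ζ))
        c-respects x {ξ , _} {ζ , _} ξ≈ζ = let k , eq = dot-modℤ x {ξ} {ζ} ξ≈ζ in
          ℝ-Ring.trans (ℝ-Ring.reflexive (cong c eq)) (cos2π-periodic isPi (dot x ζ) k)

        characterSum-translate : ∀ E x η η′ η+η′≡0 → characterSum E x ≋ characterSum (translate η η′ η+η′≡0 E) x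
        characterSum-translate E x η η′ η+η′≡0 = sum-independent (T* A) ℝ-Ring.+-commutativeMonoid E (translate η η′ η+η′≡0 E)
          (λ ξ → c (dot x (proj₁ ξ))) (λ {ξ} {ζ} → c-respects x {ξ} {ζ})

        characterSum-image : ∀ E {x} → InImage A x → characterSum E x ≋ fromℕ (Enumeration.size E)
        characterSum-image E {x} x∈A = sum-1 _ λ i → c-integer (image-dot A {x} {proj₁ (Inverse.to (Enumeration.inverse E) i)} x∈A (proj₂ (Inverse.to (Enumeration.inverse E) i)))
          where
          c-integer : ∀ {q} → IsInteger q → c q ≋ fromℚ 1ℚ
          c-integer (k , refl) = ℝ-Ring.trans (ℝ-Ring.reflexive (cong c (sym (ℚP.+-identityˡ (fromℤ k)))))
            (ℝ-Ring.trans (cos2π-periodic isPi 0ℚ k) (cos2π-0 isPi))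

        -- Averaging the translates by ±η multiplies the sum by cos(2π x·η) ≠ 1.
        characterSum-separated : ∀ E x (η : DualVector) → (∀ k → dot x (proj₁ η) ≢ fromℤ k) → characterSum E x ≋ fromℚ 0ℚ
        characterSum-separated E x η x·η∉ℤ = cos2π-cancel isPi q x·η∉ℤ S (begin
            S +ℝ S
              ≈⟨ ℝ-Ring.+-cong (characterSum-translate E x η η⁻ inverseʳ) (characterSum-translate E x η⁻ η inverseˡ) ⟩
            Σℝ.sum (λ i → c (dot x (proj₁ (shift η (ξ i))))) +ℝ Σℝ.sum (λ i → c (dot x (proj₁ (shift η⁻ (ξ i)))))
              ≈⟨ Σℝ.∑-distrib-+ (λ i → c (dot x (proj₁ (shift η (ξ i))))) (λ i → c (dot x (proj₁ (shift η⁻ (ξ i))))) ⟨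
            Σℝ.sum (λ i → c (dot x (proj₁ (shift η (ξ i)))) +ℝ c (dot x (proj₁ (shift η⁻ (ξ i)))))
              ≈⟨ Σℝ.sum-cong-≋ (λ i → product-to-sum (proj₁ (ξ i))) ⟩
            Σℝ.sum (λ i → (c (dot x (proj₁ (ξ i))) *ℝ c q) +ℝ (c (dot x (proj₁ (ξ i))) *ℝ c q))
              ≈⟨ Σℝ.∑-distrib-+ (λ i → c (dot x (proj₁ (ξ i))) *ℝ c q) (λ i → c (dot x (proj₁ (ξ i))) *ℝ c q) ⟩
            Σℝ.sum (λ i → c (dot x (proj₁ (ξ i))) *ℝ c q) +ℝ Σℝ.sum (λ i → c (dot x (proj₁ (ξ i))) *ℝ c q)
              ≈⟨ ℝ-Ring.+-cong (Σℝ.*-distribʳ-sum (c q) (λ i → c (dot x (proj₁ (ξ i))))) (Σℝ.*-distribʳ-sum (c q) (λ i → c (dot x (proj₁ (ξ i))))) ⟨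
            (S *ℝ c q) +ℝ (S *ℝ c q) ∎)
          where
          open ≋-Reasoning
          q : ℚ
          q = dot x (proj₁ η)
          S : ℝ
          S = characterSum E x
          η⁻ : DualVector
          η⁻ = negate η
          ξ : Fin (Enumeration.size E) → DualVector
          ξ = Inverse.to (Enumeration.inverse E)
          inverseʳ : ∀ i → proj₁ η i + - 1ℚ * proj₁ η i ≡ 0ℚ
          inverseʳ i = solve 1 (λ a → a :+ (:- con 1ℚ) :* a := con 0ℚ) refl (proj₁ η i)
            where open +-*-Solver
          inverseˡ : ∀ i → - 1ℚ * proj₁ η i + proj₁ η i ≡ 0ℚ
          inverseˡ i = solve 1 (λ a → (:- con 1ℚ) :* a :+ a := con 0ℚ) refl (proj₁ η i)
            where open +-*-Solver
          product-to-sum : ∀ ζ → c (dot x (λ i → ζ i + proj₁ η i)) +ℝ c (dot x (λ i → ζ i + - 1ℚ * proj₁ η i))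
                                 ≋ (c (dot x ζ) *ℝ c q) +ℝ (c (dot x ζ) *ℝ c q)
          product-to-sum ζ = ℝ-Ring.trans
            (ℝ-Ring.reflexive (cong₂ (λ u v → c u +ℝ c v) (dot-+ʳ x ζ (proj₁ η))
              (trans (dot-+ʳ x ζ (λ i → - 1ℚ * proj₁ η i)) (cong (λ z → dot x ζ + z)
                (trans (dot-*ʳ x (- 1ℚ) (proj₁ η)) (solve 1 (λ a → (:- con 1ℚ) :* a := :- a) refl q))))))
            (cos2π+cos2π isPi (dot x ζ) q)
            where open +-*-Solver

-- Double counting of expansion terms and solutions

module Assembly where

  open import Defs
  import Algebra.Definitions.RawSemiring as RawSemiringDefs
  import Algebra.Properties.Semiring.Sum as SemiringSum
  open import Algebra.Bundles using (CommutativeRing)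
  open import Data.Fin.Base using (Fin; zero; suc)
  open import Data.Integer.Base as ℤ using (ℤ; +_; -[1+_]; 0ℤ)
  import Data.Integer.Properties as ℤP
  open import Data.Nat.Base as ℕ using (ℕ; zero; suc; NonZero; _!)
  import Data.Nat.Properties as ℕP
  open import Data.Product.Base using (∃; _×_; _,_; proj₁; proj₂)
  open import Data.Rational.Base as ℚ using (ℚ; 0ℚ; _+_; _*_; -_; _-_; _/_)
  import Data.Rational.Properties as ℚP
  import Data.Rational.Unnormalised.Base as ℚᵘ
  import Data.Rational.Unnormalised.Properties as ℚᵘP
  open import Data.Sum.Base using (_⊎_; inj₁; inj₂)
  open import Data.Vec.Functional using (Vector)
  open import Function.Base using (_∘_)
  open import Function.Bundles using (Inverse)
  open import Relation.Binary.Bundles using (Setoid)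
  open import Relation.Binary.PropositionalEquality using (_≡_; _≢_; refl; sym; trans; cong; cong₂; module ≡-Reasoning)
  open import Relation.Nullary using (¬_; contradiction)
  import Relation.Binary.Reasoning.Setoid as SetoidReasoning
  open Reals
  open CosineOfTurns
  open ColumnReduction using (image-resp)
  open Determinant
  open DualLattices
  open Enumerations
  open BinomialSums
  open CharacterSums

  open ModℤLemmas

  open RawSemiringDefs ℝ-rawSemiring using () renaming (product to productℝ; _^_ to _^ℝ_)
  private
    module Σℕ = SemiringSum ℕP.+-*-semiring
    module Σℝ = SemiringSum ℝ-Ring.semiring
    module Σℚ = SemiringSum (CommutativeRing.semiring ℚP.+-*-commutativeRing)
    module ℕSum = BinomialSum ℕP.+-*-commutativeSemiring
    module ℝSum = BinomialSum ℝ-Ring.commutativeSemiring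
    module ≋-Reasoning = SetoidReasoning ℝ-Ring.setoid

  abstract
    /≡fromℤ : ∀ w n D .{{_ : NonZero D}} → w ℕ.* D ≡ n → + n / D ≡ fromℤ (+ w)
    /≡fromℤ w n (suc D) wD≡n = ℚP.toℚᵘ-injective (begin
      ℚ.toℚᵘ (+ n / suc D)     ≈⟨ TrigLemmas.toℚᵘ-/ (+ n) (suc D) ⟩
      + n ℚᵘ./ suc D           ≈⟨ ℚᵘ.*≡* (trans (ℤP.*-identityʳ (+ n)) (trans (cong +_ (sym wD≡n)) (ℤP.pos-* w (suc D)))) ⟩
      + w ℚᵘ./ 1               ≈⟨ TrigLemmas.toℚᵘ-/ (+ w) 1 ⟨
      ℚ.toℚᵘ (fromℤ (+ w))     ∎)
      where open ℚᵘP.≃-Reasoning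

    /-*-fromℤ : ∀ n D .{{_ : NonZero D}} → fromℤ (+ D) * (+ n / D) ≡ fromℤ (+ n)
    /-*-fromℤ n (suc D) = ℚP.toℚᵘ-injective (begin
      ℚ.toℚᵘ (fromℤ (+ suc D) * (+ n / suc D))            ≈⟨ ℚP.toℚᵘ-homo-* (fromℤ (+ suc D)) (+ n / suc D) ⟩
      ℚ.toℚᵘ (fromℤ (+ suc D)) ℚᵘ.* ℚ.toℚᵘ (+ n / suc D)  ≈⟨ ℚᵘP.*-cong (TrigLemmas.toℚᵘ-/ (+ suc D) 1) (TrigLemmas.toℚᵘ-/ (+ n) (suc D)) ⟩
      (+ suc D ℚᵘ./ 1) ℚᵘ.* (+ n ℚᵘ./ suc D)              ≈⟨ ℚᵘ.*≡* (trans (ℤP.*-identityʳ (+ suc D ℤ.* + n)) (trans (ℤP.*-comm (+ suc D) (+ n)) (cong (λ z → + n ℤ.* + z) (sym (ℕP.+-identityʳ (suc D)))))) ⟩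
      + n ℚᵘ./ 1                                          ≈⟨ TrigLemmas.toℚᵘ-/ (+ n) 1 ⟨
      ℚ.toℚᵘ (fromℤ (+ n))                                ∎)
      where open ℚᵘP.≃-Reasoning

    sum-fromℤ-+ : ∀ {n} (f : Vector ℕ n) → Σℚ.sum (λ i → fromℤ (+ f i)) ≡ fromℤ (+ Σℕ.sum f)
    sum-fromℤ-+ {zero}  f = refl
    sum-fromℤ-+ {suc n} f = trans (cong (λ z → fromℤ (+ f zero) + z) (sum-fromℤ-+ (f ∘ suc))) (fromℤ-+ (+ f zero) (+ Σℕ.sum (f ∘ suc)))

  positive!*negative! : ∀ x y → (ℤ.∣ x ∣ ℕ.+ y) ! ℕ.* y ! ≡ positive x y ! ℕ.* negative x y !
  positive!*negative! (+ n)    y = cong (λ z → z ! ℕ.* y !) (ℕP.+-comm n y)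
  positive!*negative! -[1+ n ] y = trans (ℕP.*-comm ((suc n ℕ.+ y) !) (y !)) (cong (λ z → y ! ℕ.* z !) (ℕP.+-comm (suc n) y))

  module Count {d} {A : Matrix d} {m : Vector ℕ d} (F : Enumeration (Solutions A m)) where

    n : ℕ
    n = Enumeration.size F
    private module F = Inverse (Enumeration.inverse F)

    x : Fin n → Vector ℤ d
    x s = proj₁ (proj₁ (F.to s))
    y α β : Fin n → Vector ℕ d
    y s = proj₂ (proj₁ (F.to s))
    α s i = positive (x s i) (y s i)
    β s i = negative (x s i) (y s i)

    α+β : ∀ s i → α s i ℕ.+ β s i ≡ m i
    α+β s i = trans (positive+negative (x s i) (y s i)) (proj₂ (proj₂ (F.to s)) i)

    count : Fin n → ℕ
    count s = ℕSum.boxSum m (indicator (α s) (β s))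

    -- Each weight is a natural number, the product of the binomials C(m i, α i): in every
    -- coordinate (|x i| + y i)! · y i ! equals α i ! · β i !. This moves the comparison of the two
    -- sides into ℕ.
    weight≡count : ∀ s → weight m (x s) (y s) ≡ fromℤ (+ count s)
    weight≡count s = /≡fromℤ (count s) (m !ᵛ) ((absᵛ (x s) +ᵛ y s) !ᵛ ℕ.* y s !ᵛ)
      {{ℕP.m*n≢0 _ _ {{factorial-nonZero (absᵛ (x s) +ᵛ y s)}} {{factorial-nonZero (y s)}}}}
      (trans (cong (count s ℕ.*_) (!ᵛ-*-!ᵛ (absᵛ (x s) +ᵛ y s) (y s) (α s) (β s) λ i → positive!*negative! (x s i) (y s i)))
        (boxSum-indicator m (α s) (β s) (α+β s)))

    module _ (a b : Vector ℕ d) (a+b : ∀ i → a i ℕ.+ b i ≡ m i) where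

      -- The pair comes from the solution x = a - b, y = a ⊓ b, and from one index only, since the
      -- listing F has no repetitions.
      covered : InImage A (difference a b) → Σℕ.sum (λ s → indicator (α s) (β s) a b) ≡ 1
      covered a-b∈A = trans (sum-single ℕP.+-0-commutativeMonoid _ s₀ vanish)
          (indicator-diagonal (α s₀) (β s₀) a b λ i → sum-difference-unique
            (trans (a+b i) (sym (α+β s₀ i)))
            (trans (sym (proj₁ to-s₀ i)) (sym (positive-negative (x s₀ i) (y s₀ i)))))
        where
        solution : Setoid.Carrier (Solutions A m)
        solution = (difference a b , λ i → a i ℕ.⊓ b i) , a-b∈A , λ i → trans (∣difference∣+2⊓ (a i) (b i)) (a+b i)
        s₀ : Fin n
        s₀ = F.from solution
        to-s₀ : Setoid._≈_ (Solutions A m) (F.to s₀) solution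
        to-s₀ = F.inverseˡ refl
        vanish : ∀ s → s ≢ s₀ → indicator (α s) (β s) a b ≡ 0
        vanish s s≢s₀ with indicator-dichotomy (α s) (β s) a b
        ... | inj₂ ≡0 = ≡0
        ... | inj₁ ≡s = contradiction (trans (sym (F.inverseʳ {s} {F.to s} (Setoid.refl (Solutions A m) {F.to s}))) (F.from-cong (x≡ , y≡))) s≢s₀
          where
          x≡ : ∀ i → x s i ≡ difference a b i
          x≡ i = trans (sym (positive-negative (x s i) (y s i))) (sym (cong₂ (λ u v → + u ℤ.- + v) (proj₁ (≡s i)) (proj₂ (≡s i))))
          y≡ : ∀ i → y s i ≡ a i ℕ.⊓ b i
          y≡ i = ℕP.*-cancelˡ-≡ (y s i) _ 2 (ℕP.+-cancelˡ-≡ ℤ.∣ x s i ∣ _ _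
            (trans (proj₂ (proj₂ (F.to s)) i) (trans (sym (proj₂ (proj₂ solution) i)) (cong (λ z → ℤ.∣ z ∣ ℕ.+ 2 ℕ.* (a i ℕ.⊓ b i)) (sym (x≡ i))))))

      uncovered : ¬ InImage A (difference a b) → Σℕ.sum (λ s → indicator (α s) (β s) a b) ≡ 0
      uncovered a-b∉A = sum-zero ℕP.+-0-commutativeMonoid _ vanish
        where
        vanish : ∀ s → indicator (α s) (β s) a b ≡ 0
        vanish s with indicator-dichotomy (α s) (β s) a b
        ... | inj₂ ≡0 = ≡0
        ... | inj₁ ≡s = contradiction (image-resp {A = A} (λ i → trans (sym (positive-negative (x s i) (y s i)))
                (sym (cong₂ (λ u v → + u ℤ.- + v) (proj₁ (≡s i)) (proj₂ (≡s i))))) (proj₁ (proj₂ (F.to s)))) a-b∉A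

  module Final {d} {A : Matrix d} (L : DualLattice A) {m : Vector ℕ d} {π : ℝ} (isPi : IsPi π)
               (E : Enumeration (T* A)) (F : Enumeration (Solutions A m)) where

    open Characters isPi
    open Count {A = A} {m} F

    N P K : ℕ
    N = ℤ.∣ det A ∣
    P = 2 ℕ.^ ∣ m ∣₁
    K = Σℕ.sum count

    ξ : Fin (Enumeration.size E) → Vector ℚ d
    ξ i = proj₁ (Inverse.to (Enumeration.inverse E) i)

    size≡N : Enumeration.size E ≡ N
    size≡N = trans (size-unique (T* A) E (DualLattice.enumeration {A = A} L)) (DualLattice.size≡∣det∣ {A = A} L)

    lhs rhs : ℝ
    lhs = ∑ℝ E λ (ξ , _) → cos[2 π * ξ ] ^ᵛ m
    rhs = fromℚ (coefficient A m * ∑ℚ F λ ((x , y) , _) → weight m x y)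

    -- The number of solutions lying over (a , b), which is 0 or 1, stands for the characteristic
    -- function of the image. Both cases become one formula, and its sum over F can be exchanged
    -- with `boxSum`.
    characterSum≋ : ∀ a b → (∀ i → a i ℕ.+ b i ≡ m i) →
      characterSum {A = A} E (difference a b) ≋ fromℕ (N ℕ.* Σℕ.sum (λ s → indicator (α s) (β s) a b))
    characterSum≋ a b a+b = cases (DualLattice.separate {A = A} L (difference a b))
      where
      covering : ℕ
      covering = Σℕ.sum (λ s → indicator (α s) (β s) a b)
      cases : (InImage A (difference a b) ⊎ ∃ λ η → InDual A η × (∀ k → dot (difference a b) η ≢ fromℤ k)) →
              characterSum {A = A} E (difference a b) ≋ fromℕ (N ℕ.* covering)
      cases (inj₁ a-b∈A) = ℝ-Ring.trans (characterSum-image {A = A} E {difference a b} a-b∈A) (ℝ-Ring.reflexive (cong fromℕ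
        (trans size≡N (trans (sym (ℕP.*-identityʳ N)) (cong (N ℕ.*_) (sym (covered a b a+b a-b∈A)))))))
      cases (inj₂ (η , dual , ∉ℤ)) = ℝ-Ring.trans (characterSum-separated {A = A} E (difference a b) (η , dual) ∉ℤ)
        (ℝ-Ring.reflexive (cong fromℕ (trans (sym (ℕP.*-zeroʳ N)) (cong (N ℕ.*_) (sym (uncovered a b a+b
          λ a-b∈A → let k , eq = image-dot A {difference a b} {η} a-b∈A dual in ∉ℤ k eq))))))

    scaled-lhs : fromℕ P *ℝ lhs ≋ fromℕ (N ℕ.* K)
    scaled-lhs = begin
      fromℕ P *ℝ lhs
        ≈⟨ Σℝ.*-distribˡ-sum (fromℕ P) monomial ⟩
      Σℝ.sum (λ i → fromℕ P *ℝ monomial i)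
        -- The factor cos 0 = 1 is inserted as the initial phase that `cos-monomial` expects.
        ≈⟨ Σℝ.sum-cong-≋ (λ i → ℝ-Ring.trans
             (ℝ-Ring.*-congˡ (ℝ-Ring.trans (ℝ-Ring.sym (ℝ-Ring.*-identityʳ (monomial i))) (ℝ-Ring.*-congˡ (ℝ-Ring.sym (cos2π-0 isPi)))))
             (ℝ-Ring.trans (cos-monomial m (ξ i) 0ℚ)
               (ℝSum.boxSum-cong m λ a b _ → ℝ-Ring.reflexive (cong c (ℚP.+-identityˡ (dot (difference a b) (ξ i))))))) ⟩
      Σℝ.sum (λ i → ℝSum.boxSum m λ a b → c (dot (difference a b) (ξ i)))
        ≈⟨ ℝSum.boxSum-sum m (λ i a b → c (dot (difference a b) (ξ i))) ⟨
      ℝSum.boxSum m (λ a b → characterSum {A = A} E (difference a b))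
        ≈⟨ ℝSum.boxSum-cong m characterSum≋ ⟩
      ℝSum.boxSum m (λ a b → fromℕ (N ℕ.* Σℕ.sum λ s → indicator (α s) (β s) a b))
        ≈⟨ boxSum-fromℕ m (λ a b → N ℕ.* Σℕ.sum λ s → indicator (α s) (β s) a b) ⟩
      fromℕ (ℕSum.boxSum m λ a b → N ℕ.* Σℕ.sum λ s → indicator (α s) (β s) a b)
        -- The order of counting is reversed: for each solution, the expansion terms that land on
        -- it.
        ≈⟨ ℝ-Ring.reflexive (cong fromℕ (trans (ℕSum.boxSum-*ˡ m N _) (cong (N ℕ.*_) (ℕSum.boxSum-sum m λ s → indicator (α s) (β s))))) ⟩
      fromℕ (N ℕ.* K) ∎
      where
      open ≋-Reasoning
      monomial : Fin (Enumeration.size E) → ℝ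
      monomial i = productℝ λ j → c (ξ i j) ^ℝ m j

    scaled-rhs : fromℕ P *ℝ rhs ≋ fromℕ (N ℕ.* K)
    scaled-rhs = pointwise λ _ → begin
      fromℤ (+ P) * (coefficient A m * Σℚ.sum (λ s → weight m (x s) (y s)))
        ≡⟨ sym (ℚP.*-assoc (fromℤ (+ P)) (coefficient A m) _) ⟩
      fromℤ (+ P) * coefficient A m * Σℚ.sum (λ s → weight m (x s) (y s))
        ≡⟨ cong₂ _*_ (/-*-fromℤ N P {{ℕP.m^n≢0 2 ∣ m ∣₁}}) (trans (Σℚ.sum-cong-≋ weight≡count) (sum-fromℤ-+ count)) ⟩
      fromℤ (+ N) * fromℤ (+ K)
        ≡⟨ trans (fromℤ-* (+ N) (+ K)) (cong fromℤ (sym (ℤP.pos-* N K))) ⟩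
      fromℤ (+ (N ℕ.* K)) ∎
      where open ≡-Reasoning

    P≢0 : + P ≢ 0ℤ
    P≢0 eq = ℕ.≢-nonZero⁻¹ P {{ℕP.m^n≢0 2 ∣ m ∣₁}} (ℤP.+-injective eq)

    lhs≋rhs : lhs ≋ rhs
    lhs≋rhs = begin
      lhs                      ≈⟨ cancel lhs ⟨
      h *ℝ (fromℕ P *ℝ lhs)    ≈⟨ ℝ-Ring.*-congˡ (ℝ-Ring.trans scaled-lhs (ℝ-Ring.sym scaled-rhs)) ⟩
      h *ℝ (fromℕ P *ℝ rhs)    ≈⟨ cancel rhs ⟩
      rhs                      ∎
      where
      open ≋-Reasoning
      h : ℝ
      h = fromℚ (proj₁ (fromℤ-inverse P≢0))
      cancel : ∀ z → h *ℝ (fromℕ P *ℝ z) ≋ z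
      cancel z = pointwise λ n → trans (sym (ℚP.*-assoc (proj₁ (fromℤ-inverse P≢0)) (fromℤ (+ P)) (approx z n)))
        (trans (cong (_* approx z n) (trans (ℚP.*-comm (proj₁ (fromℤ-inverse P≢0)) (fromℤ (+ P))) (proj₂ (fromℤ-inverse P≢0))))
               (ℚP.*-identityˡ (approx z n)))

open import Defs
open import Data.Integer.Base using (0ℤ)
open import Data.Nat.Base using (ℕ)
open import Data.Product.Base using (_×_; _,_)
open import Data.Rational.Base using (_*_)
open import Data.Vec.Functional using (Vector)
open import Relation.Binary.PropositionalEquality using (_≢_)
open DualLattices using (DualLattice; dualLattice)

corollary1p1 : ∀ {d : ℕ} (A : Matrix d) → det A ≢ 0ℤ → (m : Vector ℕ d) →
  Enumeration (T* A) × Enumeration (Solutions A m) ×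
  (∀ (π : ℝ) → IsPi π →
   ∀ (E : Enumeration (T* A)) (F : Enumeration (Solutions A m)) →
     ∑ℝ E (λ (ξ , _) → cos[2 π * ξ ] ^ᵛ m)
       ≈ fromℚ (coefficient A m * ∑ℚ F (λ ((x , y) , _) → weight m x y)))
corollary1p1 A det≢0 m =
    DualLattice.enumeration {A = A} L , Enumerations.solutions-enumeration {A = A} L m ,
    λ π isPi E F → Reals.unwrap (Assembly.Final.lhs≋rhs {A = A} L {m} isPi E F)
  where
  L : DualLattice A
  L = dualLattice A det≢0
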